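{- Let $q$ be a power of a prime $p$, $A=\mathbb{F}_q[T]$, and let $\mathfrak{n}$ be a non-zero ideal of $A$ that has no prime factor of degree $1$. Let $u\in A$ be any monic polynomial of degree $1$. For any non-zero ideal $\mathfrak{p}$ of $A$, let $P$ denote its monic generator. Then the modular symbol $x(u:1)$ is cuspidal, and in $\mathbb{M}(\mathfrak{n},\mathbb{Z})/p\,\mathbb{M}(\mathfrak{n},\mathbb{Z})$ we have $$\sum_{\deg\mathfrak{p}\leq1}T_\mathfrak{p}\,x(u:1)=\sum_{\deg\mathfrak{p}=1}\ \sum_{\substack{v\in A_{+\leq1}\\ v\neq u,\ v\neq P}}x(Pu:v),$$ where $A_{+\leq1}$ is the set of monic polynomials in $A$ of degree at most $1$ and $\mathfrak{p}$ runs over non-zero ideals of $A$ of the indicated degrees.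
   Context: "Ideal of $A$" means non-zero ideal; its degree is the degree of its monic generator. $K=\mathbb{F}_q(T)$, $A_+$ is the set of monic polynomials in $A$, and $\Gamma_0(\mathfrak{n})=\{\left(\begin{smallmatrix} a & b \\ c & d \end{smallmatrix}\right)\in \mathrm{GL}_2(A): c\in\mathfrak{n}\}$. For an ideal $\mathfrak{p}$, $S_\mathfrak{p}$ is the set of matrices $\left(\begin{smallmatrix} a & b \\ 0 & d \end{smallmatrix}\right)$ with $a,d\in A_+$, $(ad)=\mathfrak{p}$, $(a)+\mathfrak{n}=A$, $b\in A$, $\deg b<\deg d$. **Modular symbols.** $\mathbb{M}(\mathfrak{n},\mathbb{Z})=H_0(\Gamma_0(\mathfrak{n}),\mathrm{Div}^0(\mathbb{P}^1(K)))$ is the group of $\Gamma_0(\mathfrak{n})$-coinvariants of the degree-$0$ divisors supported on $\mathbb{P}^1(K)$ ($\mathrm{GL}_2(K)$ acting by fractional linear transformations); $[r,s]$ denotes the class of $(s)-(r)$. A modular symbol is cuspidal if it is in the kernel $\mathbb{M}_0(\mathfrak{n},\mathbb{Z})$ of the boundary map $\mathbb{M}(\mathfrak{n},\mathbb{Z})\to\mathrm{Div}^0(\Gamma_0(\mathfrak{n})\backslash\mathbb{P}^1(K))$, $[r,s]\mapsto(\Gamma_0(\mathfrak{n})s)-(\Gamma_0(\mathfrak{n})r)$; an element of $\mathbb{M}(\mathfrak{n},\mathbb{Z})/p\,\mathbb{M}(\mathfrak{n},\mathbb{Z})$ is cuspidal if it is in the kernel of the boundary map tensored with $\mathbb{F}_p$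 (equivalently, in the image of $\mathbb{M}_0(\mathfrak{n},\mathbb{Z})$). Hecke operators: $T_\mathfrak{p}[r,s]=\sum_{g\in S_\mathfrak{p}}[gr,gs]$, extended linearly and reduced modulo $p$. **Manin–Teitelbaum symbols.** $\mathbb{P}^1(A/\mathfrak{n})$ is the set of classes $(u:v)$ of pairs $(u,v)\in A\times A$ with $(u)+(v)+\mathfrak{n}=A$, where $(u_1,v_1)\sim(u_2,v_2)$ if there is $w\in A$ with $(w)+\mathfrak{n}=A$, $u_2\equiv wu_1$, $v_2\equiv wv_1\bmod\mathfrak{n}$. The map $\Gamma_0(\mathfrak{n})\left(\begin{smallmatrix} a & b \\ u & v \end{smallmatrix}\right)\mapsto(u:v)$ is a bijection $\Gamma_0(\mathfrak{n})\backslash\mathrm{GL}_2(A)\to\mathbb{P}^1(A/\mathfrak{n})$. For $(u:v)\in\mathbb{P}^1(A/\mathfrak{n})$ represented by $g=\left(\begin{smallmatrix} a & b \\ u & v \end{smallmatrix}\right)\in\mathrm{GL}_2(A)$, set $\xi(u:v)=[g(0),g(\infty)]=[b/v,a/u]\in\mathbb{M}(\mathfrak{n},\mathbb{Z})$, and let $x(u:v)$ be the image of $\xi(u:v)$ in $\mathbb{M}(\mathfrak{n},\mathbb{Z})/p\,\mathbb{M}(\mathfrak{n},\mathbb{Z})\simeq\mathbb{M}(\mathfrak{n},\mathbb{Z})\otimes_\mathbb{Z}\mathbb{F}_p$. -}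

module Defs where

open import Algebra.Bundles using (RawRing; CommutativeRing; AbelianGroup)
import Algebra.Properties.AbelianGroup as AbelianGroupProperties
import Algebra.Properties.Group as GroupProperties
import Algebra.Properties.Monoid.Mult as MonoidMult
import Algebra.Properties.Monoid.Mult.TCOptimised as MonoidMultOpt
import Algebra.Properties.Ring as RingProperties
import Algebra.Properties.Semiring.Divisibility as SemiringDivisibility
import Algebra.Properties.Semiring.Mult as SemiringMult
import Algebra.Properties.Semiring.Primality as SemiringPrimality
import Algebra.Solver.Ring
open import Algebra.Solver.Ring.AlmostCommutativeRing using (fromCommutativeRing; _-Raw-AlmostCommutative⟶_)
open import Data.Fin.Base as Fin using (Fin)
import Data.Fin.Properties as Fin
open import Data.Integer.Base as ℤ using (ℤ; 0ℤ)
import Data.Integer.Properties as ℤ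
import Data.Integer.Solver as ℤSolver
open import Data.List.Base using (List; []; _∷_; _++_; map; concatMap; foldr; filter; length; allFin; cartesianProduct; mapMaybe)
import Data.List.Properties as List
import Data.List.Relation.Binary.Permutation.Setoid as Permutation
import Data.List.Relation.Binary.Permutation.Setoid.Properties as PermutationProperties
open import Data.Maybe.Base using (Maybe; just; nothing)
open import Data.Nat.Base as ℕ using (ℕ; zero; suc; _≤_; _<_; z≤n; s≤s)
import Data.Nat.Properties as ℕ
open import Data.Product.Base using (Σ-syntax; ∃-syntax; _×_; _,_; proj₁; proj₂)
open import Data.Sum.Base using (_⊎_; inj₁; inj₂)
open import Data.Vec.Base as Vec using (Vec; []; _∷_)
open import Function.Base using (id)
open import Function.Bundles using (Inverse)
open import Level using (_⊔_) renaming (suc to lsuc)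
open import Relation.Binary.Bundles using (Setoid)
open import Relation.Binary.Definitions using (tri<; tri≈; tri>)
open import Relation.Binary.PropositionalEquality as ≡ using (_≡_)
import Relation.Binary.Reasoning.Setoid as SetoidReasoning
open import Relation.Binary.Structures using (IsEquivalence)
open import Relation.Nullary using (¬_; Dec; yes; no; contradiction)
import Relation.Nullary.Decidable as Dec
open import Relation.Nullary.Decidable using (_×-dec_)
open import Relation.Unary using (Pred; Decidable; Universal; _⊆_)

-- Coefficients are formal differences (m , n) = m - n of natural numbers.
module CommutativeRingSolver {c ℓ} (R : CommutativeRing c ℓ) where
  open CommutativeRing R
  private
    module M = MonoidMult +-monoid
    module O = MonoidMultOpt +-monoid
    module SM = SemiringMult semiring
    module RP = RingProperties ring
    module GP = AbelianGroupProperties +-abelianGroup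
    open SetoidReasoning setoid

    rawCoeff : RawRing _ _
    rawCoeff = record
      { Carrier = ℕ × ℕ
      ; _≈_ = _≡_
      ; _+_ = λ (a , b) (c , d) → a ℕ.+ c , b ℕ.+ d
      ; _*_ = λ (a , b) (c , d) → a ℕ.* c ℕ.+ b ℕ.* d , a ℕ.* d ℕ.+ b ℕ.* c
      ; -_  = λ (a , b) → b , a
      ; 0#  = 0 , 0
      ; 1#  = 1 , 0
      }

    ⟦_⟧ : ℕ × ℕ → Carrier
    ⟦ a , 0 ⟧     = a O.× 1#
    ⟦ a , suc b ⟧ = a O.× 1# - suc b O.× 1#

    ν : ℕ → Carrier
    ν n = n M.× 1#

    ν-O : ∀ n → n O.× 1# ≈ ν n
    ν-O n = sym (O.×ᵤ≈× n 1#)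

    ⟦⟧≈ : ∀ x → ⟦ x ⟧ ≈ ν (proj₁ x) - ν (proj₂ x)
    ⟦⟧≈ (a , 0) = begin
      a O.× 1#   ≈⟨ ν-O a ⟩
      ν a        ≈⟨ +-identityʳ _ ⟨
      ν a + 0#   ≈⟨ +-congˡ (GP.ε⁻¹≈ε) ⟨
      ν a - 0#   ∎
    ⟦⟧≈ (a , suc b) = +-cong (ν-O a) (-‿cong (ν-O (suc b)))

    swap4 : ∀ x y z w → (x + y) + (z + w) ≈ (x + z) + (y + w)
    swap4 x y z w = begin
      (x + y) + (z + w) ≈⟨ +-assoc _ _ _ ⟩
      x + (y + (z + w)) ≈⟨ +-congˡ (+-assoc _ _ _) ⟨
      x + ((y + z) + w) ≈⟨ +-congˡ (+-congʳ (+-comm _ _)) ⟩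
      x + ((z + y) + w) ≈⟨ +-congˡ (+-assoc _ _ _) ⟩
      x + (z + (y + w)) ≈⟨ +-assoc _ _ _ ⟨
      (x + z) + (y + w) ∎

    sub-add : ∀ x y z w → (x + z) - (y + w) ≈ (x - y) + (z - w)
    sub-add x y z w = begin
      (x + z) - (y + w)         ≈⟨ +-congˡ (GP.⁻¹-∙-comm y w) ⟨
      (x + z) + (- y + - w)     ≈⟨ swap4 _ _ _ _ ⟩
      (x - y) + (z - w)         ∎

    sub-mul : ∀ x y z w → (x * z + y * w) - (x * w + y * z) ≈ (x - y) * (z - w)
    sub-mul x y z w = sym (begin
      (x - y) * (z - w)                                   ≈⟨ distribʳ _ _ _ ⟩
      x * (z - w) + - y * (z - w)                         ≈⟨ +-cong (distribˡ _ _ _) (distribˡ _ _ _) ⟩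
      (x * z + x * - w) + (- y * z + - y * - w)           ≈⟨ +-congˡ (+-comm _ _) ⟩
      (x * z + x * - w) + (- y * - w + - y * z)           ≈⟨ swap4 _ _ _ _ ⟩
      (x * z + - y * - w) + (x * - w + - y * z)           ≈⟨ +-cong (+-congˡ neg-neg) (+-cong (RP.-‿distribʳ-* _ _) (RP.-‿distribˡ-* _ _)) ⟨
      (x * z + y * w) + (- (x * w) + - (y * z))           ≈⟨ +-congˡ (GP.⁻¹-∙-comm _ _) ⟩
      (x * z + y * w) - (x * w + y * z)                   ∎)
      where
      neg-neg : y * w ≈ - y * - w
      neg-neg = begin
        y * w         ≈⟨ GP.⁻¹-involutive _ ⟨
        - - (y * w)   ≈⟨ -‿cong (RP.-‿distribˡ-* _ _) ⟩
        - (- y * w)   ≈⟨ RP.-‿distribʳ-* _ _ ⟩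
        - y * - w     ∎

    morphism : rawCoeff -Raw-AlmostCommutative⟶ fromCommutativeRing R
    morphism = record
      { ⟦_⟧    = ⟦_⟧
      ; +-homo = λ { x@(a , b) y@(c , d) → begin
          ⟦ a ℕ.+ c , b ℕ.+ d ⟧            ≈⟨ ⟦⟧≈ (a ℕ.+ c , b ℕ.+ d) ⟩
          ν (a ℕ.+ c) - ν (b ℕ.+ d)        ≈⟨ +-cong (M.×-homo-+ 1# a c) (-‿cong (M.×-homo-+ 1# b d)) ⟩
          (ν a + ν c) - (ν b + ν d)        ≈⟨ sub-add _ _ _ _ ⟩
          (ν a - ν b) + (ν c - ν d)        ≈⟨ +-cong (⟦⟧≈ x) (⟦⟧≈ y) ⟨
          ⟦ x ⟧ + ⟦ y ⟧                    ∎ }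
      ; *-homo = λ { x@(a , b) y@(c , d) → begin
          ⟦ a ℕ.* c ℕ.+ b ℕ.* d , a ℕ.* d ℕ.+ b ℕ.* c ⟧
            ≈⟨ ⟦⟧≈ (a ℕ.* c ℕ.+ b ℕ.* d , a ℕ.* d ℕ.+ b ℕ.* c) ⟩
          ν (a ℕ.* c ℕ.+ b ℕ.* d) - ν (a ℕ.* d ℕ.+ b ℕ.* c)
            ≈⟨ +-cong (M.×-homo-+ 1# (a ℕ.* c) (b ℕ.* d)) (-‿cong (M.×-homo-+ 1# (a ℕ.* d) (b ℕ.* c))) ⟩
          (ν (a ℕ.* c) + ν (b ℕ.* d)) - (ν (a ℕ.* d) + ν (b ℕ.* c))
            ≈⟨ +-cong (+-cong (SM.×1-homo-* a c) (SM.×1-homo-* b d)) (-‿cong (+-cong (SM.×1-homo-* a d) (SM.×1-homo-* b c))) ⟩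
          (ν a * ν c + ν b * ν d) - (ν a * ν d + ν b * ν c)       ≈⟨ sub-mul _ _ _ _ ⟩
          (ν a - ν b) * (ν c - ν d)        ≈⟨ *-cong (⟦⟧≈ x) (⟦⟧≈ y) ⟨
          ⟦ x ⟧ * ⟦ y ⟧                    ∎ }
      ; -‿homo = λ { x@(a , b) → begin
          ⟦ b , a ⟧       ≈⟨ ⟦⟧≈ (b , a) ⟩
          ν b - ν a       ≈⟨ GP.⁻¹-anti-homo‿- (ν a) (ν b) ⟨
          - (ν a - ν b)   ≈⟨ -‿cong (⟦⟧≈ x) ⟨
          - ⟦ x ⟧         ∎ }
      ; 0-homo = refl
      ; 1-homo = refl
      }

    _≟_ : (x y : ℕ × ℕ) → Maybe (⟦ x ⟧ ≈ ⟦ y ⟧)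
    x@(a , b) ≟ y@(c , d) with a ℕ.+ d ℕ.≟ c ℕ.+ b
    ... | no _ = nothing
    ... | yes a+d≡c+b = just (begin
      ⟦ x ⟧                               ≈⟨ ⟦⟧≈ x ⟩
      ν a - ν b                           ≈⟨ +-identityʳ _ ⟨
      (ν a - ν b) + 0#                    ≈⟨ +-congˡ (-‿inverseʳ (ν d)) ⟨
      (ν a - ν b) + (ν d - ν d)           ≈⟨ sub-add _ _ _ _ ⟨
      (ν a + ν d) - (ν b + ν d)           ≈⟨ +-cong (trans (sym (M.×-homo-+ 1# a d)) (trans (reflexive (≡.cong ν a+d≡c+b)) (M.×-homo-+ 1# c b))) (-‿cong (+-comm _ _)) ⟩
      (ν c + ν b) - (ν d + ν b)           ≈⟨ sub-add _ _ _ _ ⟩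
      (ν c - ν d) + (ν b - ν b)           ≈⟨ +-congˡ (-‿inverseʳ (ν b)) ⟩
      (ν c - ν d) + 0#                    ≈⟨ +-identityʳ _ ⟩
      ν c - ν d                           ≈⟨ ⟦⟧≈ y ⟨
      ⟦ y ⟧                               ∎)

  open Algebra.Solver.Ring rawCoeff (fromCommutativeRing R) morphism _≟_ public
    using (solve; _:=_; _:+_; _:*_; _:-_; :-_; con)

  :0 :1 : ∀ {n} → Algebra.Solver.Ring.Polynomial rawCoeff (fromCommutativeRing R) morphism _≟_ n
  :0 = con (0 , 0)
  :1 = con (1 , 0)

module Matrices {c ℓ} (R : CommutativeRing c ℓ) where
  open CommutativeRing R
  open SemiringDivisibility semiring using (_∣_; _,_)
  open CommutativeRingSolver R

  infix  4 _≈ᴹ_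
  infixl 7 _*ᴹ_

  record Mat₂ : Set c where
    constructor mat
    field a₁₁ a₁₂ a₂₁ a₂₂ : Carrier

  open Mat₂ public

  record _≈ᴹ_ (M N : Mat₂) : Set ℓ where
    constructor mat-≈
    field
      ≈₁₁ : a₁₁ M ≈ a₁₁ N
      ≈₁₂ : a₁₂ M ≈ a₁₂ N
      ≈₂₁ : a₂₁ M ≈ a₂₁ N
      ≈₂₂ : a₂₂ M ≈ a₂₂ N

  open _≈ᴹ_ public

  det : Mat₂ → Carrier
  det (mat a b c d) = a * d - b * c

  _*ᴹ_ : Mat₂ → Mat₂ → Mat₂
  mat a b c d *ᴹ mat a′ b′ c′ d′ =
    mat (a * a′ + b * c′) (a * b′ + b * d′) (c * a′ + d * c′) (c * b′ + d * d′)

  1ᴹ : Mat₂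
  1ᴹ = mat 1# 0# 0# 1#

  IsUnit : Carrier → Set (c ⊔ ℓ)
  IsUnit x = x ∣ 1#

  isUnit : ∀ {x} u → u * x ≈ 1# → IsUnit x
  isUnit u ux≈1 = u , ux≈1

  det-* : ∀ M N → det (M *ᴹ N) ≈ det M * det N
  det-* (mat a b c d) (mat a′ b′ c′ d′) =
    solve 8 (λ a b c d a′ b′ c′ d′ →
      (a :* a′ :+ b :* c′) :* (c :* b′ :+ d :* d′) :- (a :* b′ :+ b :* d′) :* (c :* a′ :+ d :* c′)
      := (a :* d :- b :* c) :* (a′ :* d′ :- b′ :* c′)) refl a b c d a′ b′ c′ d′

  det-1 : det 1ᴹ ≈ 1#
  det-1 = solve 0 (:1 :* :1 :- :0 :* :0 := :1) refl

  record GL₂ : Set (c ⊔ ℓ) where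
    constructor gl
    field
      matrix     : Mat₂
      invertible : IsUnit (det matrix)

  open GL₂ public

  IsUnit-* : ∀ {x y} → IsUnit x → IsUnit y → IsUnit (x * y)
  IsUnit-* {x} {y} (p , px≈1) (q , qy≈1) = q * p ,
    trans (solve 4 (λ p q x y → (q :* p) :* (x :* y) := (p :* x) :* (q :* y)) refl p q x y)
      (trans (*-cong px≈1 qy≈1) (*-identityˡ 1#))

  infixl 7 _*ᴳ_

  opaque
    1ᴹ-invertible : IsUnit (det 1ᴹ)
    1ᴹ-invertible = 1# , trans (*-identityˡ _) det-1

    *ᴹ-invertible : ∀ M N → IsUnit (det M) → IsUnit (det N) → IsUnit (det (M *ᴹ N))
    *ᴹ-invertible M N p q with IsUnit-* p q
    ... | u , eq = u , trans (*-congˡ (det-* M N)) eq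

    inverse-invertible : ∀ {a b c d e} → e * (a * d - b * c) ≈ 1# → IsUnit (det (mat (e * d) (- (e * b)) (- (e * c)) (e * a)))
    inverse-invertible {a} {b} {c} {d} {e} e*det≈1 = a * d - b * c ,
      trans (solve 5 (λ e a b c d →
          (a :* d :- b :* c) :* ((e :* d) :* (e :* a) :- (:- (e :* b)) :* (:- (e :* c)))
          := (e :* (a :* d :- b :* c)) :* (e :* (a :* d :- b :* c))) refl e a b c d)
        (trans (*-cong e*det≈1 e*det≈1) (*-identityˡ 1#))

  1ᴳ : GL₂
  1ᴳ = gl 1ᴹ 1ᴹ-invertible

  _*ᴳ_ : GL₂ → GL₂ → GL₂
  gl M p *ᴳ gl N q = gl (M *ᴹ N) (*ᴹ-invertible M N p q)

  _⁻¹ᴳ : GL₂ → GL₂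
  gl (mat a b c d) (e , e*det≈1) ⁻¹ᴳ = gl (mat (e * d) (- (e * b)) (- (e * c)) (e * a)) (inverse-invertible e*det≈1)

  inverseˡ : ∀ g → matrix (g ⁻¹ᴳ *ᴳ g) ≈ᴹ 1ᴹ
  inverseˡ (gl M@(mat a b c d) (e , e*det≈1)) = mat-≈
    (trans (solve 5 (λ e a b c d → (e :* d) :* a :+ (:- (e :* b)) :* c := e :* (a :* d :- b :* c)) refl e a b c d) e*det≈1)
    (solve 3 (λ e b d → (e :* d) :* b :+ (:- (e :* b)) :* d := :0) refl e b d)
    (solve 3 (λ e a c → (:- (e :* c)) :* a :+ (e :* a) :* c := :0) refl e a c)
    (trans (solve 5 (λ e a b c d → (:- (e :* c)) :* b :+ (e :* a) :* d := e :* (a :* d :- b :* c)) refl e a b c d) e*det≈1)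

-- Only ever applied to a field K, where the unit scale ranges over K \ {0}.
module ProjectiveLine {c ℓ} (K : CommutativeRing c ℓ) where
  open CommutativeRing K
  open SemiringDivisibility semiring using (_∣_; _,_)
  open CommutativeRingSolver K
  open Matrices K

  record ℙ¹ : Set (c ⊔ ℓ) where
    constructor _∶_[_]
    field
      X Y     : Carrier
      nonzero : ¬ (X ≈ 0# × Y ≈ 0#)

  open ℙ¹ public

  infix 4 _≈ᴾ_
  infixr 8 _·_

  record _≈ᴾ_ (r s : ℙ¹) : Set (c ⊔ ℓ) where
    constructor scaled
    field
      scale      : Carrier
      scale-unit : IsUnit scale
      X-scaled   : X s ≈ scale * X r
      Y-scaled   : Y s ≈ scale * Y r

  ≈ᴾ-isEquivalence : IsEquivalence _≈ᴾ_
  ≈ᴾ-isEquivalence = record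
    { refl  = scaled 1# (1# , *-identityˡ 1#) (sym (*-identityˡ _)) (sym (*-identityˡ _))
    ; sym   = λ { (scaled t (t⁻¹ , t⁻¹t≈1) eX eY) →
        scaled t⁻¹ (t , trans (*-comm t t⁻¹) t⁻¹t≈1) (inv t t⁻¹ t⁻¹t≈1 eX) (inv t t⁻¹ t⁻¹t≈1 eY) }
    ; trans = λ { (scaled t t-unit eX eY) (scaled s s-unit eX′ eY′) →
        scaled (s * t) (IsUnit-* s-unit t-unit) (comp eX eX′) (comp eY eY′) }
    }
    where
    inv : ∀ t t⁻¹ → t⁻¹ * t ≈ 1# → ∀ {x y} → y ≈ t * x → x ≈ t⁻¹ * y
    inv t t⁻¹ e {x} {y} y≈tx = sym (trans (*-congˡ y≈tx) (trans (sym (*-assoc _ _ _)) (trans (*-congʳ e) (*-identityˡ _))))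
    comp : ∀ {s t x y z} → y ≈ t * x → z ≈ s * y → z ≈ (s * t) * x
    comp e e′ = trans e′ (trans (*-congˡ e) (sym (*-assoc _ _ _)))

  ℙ¹-setoid : Setoid (c ⊔ ℓ) (c ⊔ ℓ)
  ℙ¹-setoid = record { isEquivalence = ≈ᴾ-isEquivalence }

  opaque
    ·-nonzero : ∀ {a b c d x y} → IsUnit (det (mat a b c d)) → ¬ (x ≈ 0# × y ≈ 0#) →
                ¬ (a * x + b * y ≈ 0# × c * x + d * y ≈ 0#)
    ·-nonzero {a} {b} {c} {d} {x} {y} (e , e*det≈1) xy≉0 (p , q) = xy≉0
      ( trans (unscale x) (trans (solve 7 (λ e a b c d x y → (e :* (a :* d :- b :* c)) :* x
          := e :* (d :* (a :* x :+ b :* y) :- b :* (c :* x :+ d :* y))) refl e a b c d x y) (cancel p q))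
      , trans (unscale y) (trans (solve 7 (λ e a b c d x y → (e :* (a :* d :- b :* c)) :* y
          := e :* (a :* (c :* x :+ d :* y) :- c :* (a :* x :+ b :* y))) refl e a b c d x y) (cancel q p)))
      where
      unscale : ∀ z → z ≈ (e * (a * d - b * c)) * z
      unscale z = sym (trans (*-congʳ e*det≈1) (*-identityˡ z))
      cancel : ∀ {u v w z} → u ≈ 0# → v ≈ 0# → e * (w * u - z * v) ≈ 0#
      cancel {u} {v} {w} {z} u≈0 v≈0 = trans
        (*-congˡ (+-cong (*-congˡ u≈0) (-‿cong (*-congˡ v≈0))))
        (solve 3 (λ e w z → e :* (w :* :0 :- z :* :0) := :0) refl e w z)

  _·_ : GL₂ → ℙ¹ → ℙ¹
  gl (mat a b c d) inv · (x ∶ y [ nz ]) = (a * x + b * y) ∶ (c * x + d * y) [ ·-nonzero {a} {b} {c} {d} {x} {y} inv nz ]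

  ·-cong : ∀ {g h r s} → matrix g ≈ᴹ matrix h → r ≈ᴾ s → g · r ≈ᴾ h · s
  ·-cong (mat-≈ ea eb ec ed) (scaled t t-unit eX eY) = scaled t t-unit (lin ea eb) (lin ec ed)
    where
    lin : ∀ {a b a′ b′} → a ≈ a′ → b ≈ b′ → a′ * _ + b′ * _ ≈ t * (a * _ + b * _)
    lin {a} {b} e₁ e₂ = trans (+-cong (*-cong (sym e₁) eX) (*-cong (sym e₂) eY))
      (solve 5 (λ a b t x y → a :* (t :* x) :+ b :* (t :* y) := t :* (a :* x :+ b :* y)) refl a b t _ _)

  ·-congʳ : ∀ g {r s} → r ≈ᴾ s → g · r ≈ᴾ g · s
  ·-congʳ g = ·-cong {g} {g} (mat-≈ refl refl refl refl)

  ·-identity : ∀ g → matrix g ≈ᴹ 1ᴹ → ∀ r → g · r ≈ᴾ r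
  ·-identity g (mat-≈ ea eb ec ed) (x ∶ y [ _ ]) = scaled 1# (1# , *-identityˡ 1#)
    (sym (trans (*-identityˡ _) (trans (+-cong (*-congʳ ea) (*-congʳ eb)) (solve 2 (λ x y → :1 :* x :+ :0 :* y := x) refl x y))))
    (sym (trans (*-identityˡ _) (trans (+-cong (*-congʳ ec) (*-congʳ ed)) (solve 2 (λ x y → :0 :* x :+ :1 :* y := y) refl x y))))

  ·-assoc : ∀ g h r → (g *ᴳ h) · r ≈ᴾ g · (h · r)
  ·-assoc (gl (mat a b c d) _) (gl (mat a′ b′ c′ d′) _) (x ∶ y [ _ ]) =
    scaled 1# (1# , *-identityˡ 1#) (row a b) (row c d)
    where
    row : ∀ a b → a * (a′ * x + b′ * y) + b * (c′ * x + d′ * y) ≈ 1# * ((a * a′ + b * c′) * x + (a * b′ + b * d′) * y)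
    row a b = solve 8 (λ a b a′ b′ c′ d′ x y →
      a :* (a′ :* x :+ b′ :* y) :+ b :* (c′ :* x :+ d′ :* y)
      := :1 :* ((a :* a′ :+ b :* c′) :* x :+ (a :* b′ :+ b :* d′) :* y)) refl a b a′ b′ c′ d′ x y

module AbelianGroups {a ℓ} (G : AbelianGroup a ℓ) where
  open AbelianGroup G
  private
    module GP = AbelianGroupProperties G
    open SetoidReasoning setoid
  open MonoidMult monoid using () renaming (_×_ to _·ℕ_)

  data ⟨_⟩ {s} (S : Pred Carrier s) : Pred Carrier (a ⊔ ℓ ⊔ s) where
    gen  : ∀ {x} → S x → ⟨ S ⟩ x
    unit : ⟨ S ⟩ ε
    mult : ∀ {x y} → ⟨ S ⟩ x → ⟨ S ⟩ y → ⟨ S ⟩ (x ∙ y)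
    inv  : ∀ {x} → ⟨ S ⟩ x → ⟨ S ⟩ (x ⁻¹)
    resp : ∀ {x y} → x ≈ y → ⟨ S ⟩ x → ⟨ S ⟩ y

  module _ {s} (S : Pred Carrier s) where

    infix 4 _≈[S]_

    record _≈[S]_ (x y : Carrier) : Set (a ⊔ ℓ ⊔ s) where
      constructor congruent
      field difference : ⟨ S ⟩ (x ∙ y ⁻¹)

    ≈⇒≈[S] : ∀ {x y} → x ≈ y → x ≈[S] y
    ≈⇒≈[S] x≈y = congruent (resp (sym (GP.x≈y⇒x∙y⁻¹≈ε x≈y)) unit)

    private
      interchange : ∀ x y u v → (x ∙ y ⁻¹) ∙ (u ∙ v ⁻¹) ≈ (x ∙ u) ∙ (y ∙ v) ⁻¹
      interchange x y u v = begin
        (x ∙ y ⁻¹) ∙ (u ∙ v ⁻¹)   ≈⟨ assoc _ _ _ ⟩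
        x ∙ (y ⁻¹ ∙ (u ∙ v ⁻¹))   ≈⟨ ∙-congˡ (assoc _ _ _) ⟨
        x ∙ ((y ⁻¹ ∙ u) ∙ v ⁻¹)   ≈⟨ ∙-congˡ (∙-congʳ (comm _ _)) ⟩
        x ∙ ((u ∙ y ⁻¹) ∙ v ⁻¹)   ≈⟨ ∙-congˡ (assoc _ _ _) ⟩
        x ∙ (u ∙ (y ⁻¹ ∙ v ⁻¹))   ≈⟨ assoc _ _ _ ⟨
        (x ∙ u) ∙ (y ⁻¹ ∙ v ⁻¹)   ≈⟨ ∙-congˡ (GP.⁻¹-∙-comm y v) ⟩
        (x ∙ u) ∙ (y ∙ v) ⁻¹      ∎

      telescope : ∀ x y z → (x ∙ y ⁻¹) ∙ (y ∙ z ⁻¹) ≈ x ∙ z ⁻¹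
      telescope x y z = begin
        (x ∙ y ⁻¹) ∙ (y ∙ z ⁻¹)   ≈⟨ assoc _ _ _ ⟩
        x ∙ (y ⁻¹ ∙ (y ∙ z ⁻¹))   ≈⟨ ∙-congˡ (assoc _ _ _) ⟨
        x ∙ ((y ⁻¹ ∙ y) ∙ z ⁻¹)   ≈⟨ ∙-congˡ (∙-congʳ (inverseˡ y)) ⟩
        x ∙ (ε ∙ z ⁻¹)            ≈⟨ ∙-congˡ (identityˡ _) ⟩
        x ∙ z ⁻¹                  ∎

      isEquivalence[S] : IsEquivalence _≈[S]_
      isEquivalence[S] = record
        { refl  = ≈⇒≈[S] refl
        ; sym   = λ { {x} {y} (congruent p) → congruent (resp (GP.⁻¹-anti-homo‿- x y) (inv p)) }
        ; trans = λ { {x} {y} {z} (congruent p) (congruent q) → congruent (resp (telescope x y z) (mult p q)) }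
        }

    infixl 6 _/⟨_⟩

    _/⟨_⟩ : AbelianGroup a (a ⊔ ℓ ⊔ s)
    _/⟨_⟩ = record
      { Carrier = Carrier
      ; _≈_ = _≈[S]_
      ; _∙_ = _∙_
      ; ε = ε
      ; _⁻¹ = _⁻¹
      ; isAbelianGroup = record
        { isGroup = record
          { isMonoid = record
            { isSemigroup = record
              { isMagma = record
                { isEquivalence = isEquivalence[S]
                ; ∙-cong = λ { {x} {y} {u} {v} (congruent p) (congruent q) → congruent (resp (interchange x y u v) (mult p q)) }
                }
              ; assoc = λ x y z → ≈⇒≈[S] (assoc x y z)
              }
            ; identity = (λ x → ≈⇒≈[S] (identityˡ x)) , (λ x → ≈⇒≈[S] (identityʳ x))
            }
          ; inverse = (λ x → ≈⇒≈[S] (inverseˡ x)) , (λ x → ≈⇒≈[S] (inverseʳ x))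
          ; ⁻¹-cong = λ { {x} {y} (congruent p) → congruent (resp (sym (GP.⁻¹-∙-comm x (y ⁻¹))) (inv p)) }
          }
        ; comm = λ x y → ≈⇒≈[S] (comm x y)
        }
      }

  -- The subset p G, so that G /ℕ p below is G ⊗ ℤ/p.
  Multiple : ℕ → Pred Carrier (a ⊔ ℓ)
  Multiple p z = ∃[ w ] z ≈ p ·ℕ w

  ∑ : ∀ {i} {I : Set i} → List I → (I → Carrier) → Carrier
  ∑ []       f = ε
  ∑ (i ∷ is) f = f i ∙ ∑ is f

open AbelianGroups public using (_/⟨_⟩)

infixl 6 _/ℕ_

_/ℕ_ : ∀ {a ℓ} → AbelianGroup a ℓ → ℕ → AbelianGroup a (a ⊔ ℓ)
G /ℕ p = G /⟨ AbelianGroups.Multiple G p ⟩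

∑-syntax : ∀ {a ℓ i} (G : AbelianGroup a ℓ) {I : Set i} → List I → (I → AbelianGroup.Carrier G) → AbelianGroup.Carrier G
∑-syntax G = AbelianGroups.∑ G

syntax ∑-syntax G is (λ i → x) = ∑[ i ∈ is ] x in[ G ]

module Divisors {x ℓ} (X : Setoid x ℓ) where
  open Setoid X using () renaming (Carrier to Point)
  open Permutation X using (_↭_; ↭-refl; ↭-sym; ↭-trans)
  open PermutationProperties X

  infix  4 _≈ᴰ_
  infixl 6 _+ᴰ_

  -- A divisor is a formal difference pos − neg of finite multisets of points.
  record Div : Set x where
    constructor _⊝_
    field pos neg : List Point

  open Div public

  -- The free commutative monoid is cancellative, so this is the equality of
  -- its group completion.
  record _≈ᴰ_ (D E : Div) : Set (x ⊔ ℓ) where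
    constructor div-≈
    field balanced : pos D ++ neg E ↭ pos E ++ neg D

  _+ᴰ_ : Div → Div → Div
  (p ⊝ n) +ᴰ (p′ ⊝ n′) = (p ++ p′) ⊝ (n ++ n′)

  0ᴰ : Div
  0ᴰ = [] ⊝ []

  -ᴰ_ : Div → Div
  -ᴰ (p ⊝ n) = n ⊝ p

  degree : Div → ℤ
  degree (p ⊝ n) = ℤ.+ length p ℤ.- ℤ.+ length n

  private
    module CM where
      open import Algebra.Solver.CommutativeMonoid ++-commutativeMonoid public

    ++-cancelʳ : ∀ {ps qs} rs → ps ++ rs ↭ qs ++ rs → ps ↭ qs
    ++-cancelʳ {ps} {qs} rs eq = ↭-trans (↭-sym (++-identityʳ ps))
      (↭-trans (dropMiddle {rs} [] [] (↭-trans (++⁺ˡ rs (++-identityʳ ps)) (↭-trans (++-comm rs ps)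
        (↭-trans eq (↭-trans (++-comm qs rs) (++⁺ˡ rs (↭-sym (++-identityʳ qs)))))))) (++-identityʳ qs))

    rearrange : ∀ ps qs rs ss → (ps ++ qs) ++ (rs ++ ss) ↭ (ps ++ rs) ++ (qs ++ ss)
    rearrange ps qs rs ss = CM.solve 4 (λ p q r s → (p ⊕ q) ⊕ (r ⊕ s) ⊜ (p ⊕ r) ⊕ (q ⊕ s)) ↭-refl ps qs rs ss
      where open CM

  ≈ᴰ-isEquivalence : IsEquivalence _≈ᴰ_
  ≈ᴰ-isEquivalence = record
    { refl  = div-≈ ↭-refl
    ; sym   = λ { (div-≈ eq) → div-≈ (↭-sym eq) }
    ; trans = λ { {p ⊝ n} {p′ ⊝ n′} {p″ ⊝ n″} (div-≈ eq) (div-≈ eq′) → div-≈ (++-cancelʳ (p′ ++ n′)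
        (↭-trans (CM₁ p n″ p′ n′) (↭-trans (++⁺ eq eq′) (CM₂ p′ n p″ n′)))) }
    }
    where
    open CM
    CM₁ : ∀ a b c d → (a ++ b) ++ (c ++ d) ↭ (a ++ d) ++ (c ++ b)
    CM₁ = CM.solve 4 (λ a b c d → (a ⊕ b) ⊕ (c ⊕ d) ⊜ (a ⊕ d) ⊕ (c ⊕ b)) ↭-refl
    CM₂ : ∀ a b c d → (a ++ b) ++ (c ++ d) ↭ (c ++ b) ++ (a ++ d)
    CM₂ = CM.solve 4 (λ a b c d → (a ⊕ b) ⊕ (c ⊕ d) ⊜ (c ⊕ b) ⊕ (a ⊕ d)) ↭-refl

  private
    ≡⇒≈ᴰ : ∀ {D E} → D ≡ E → D ≈ᴰ E
    ≡⇒≈ᴰ = IsEquivalence.reflexive ≈ᴰ-isEquivalence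

    +ᴰ-comm : ∀ D E → D +ᴰ E ≈ᴰ E +ᴰ D
    +ᴰ-comm (p ⊝ n) (p′ ⊝ n′) = div-≈ (++⁺ (++-comm p p′) (++-comm n′ n))

    +ᴰ-inverseˡ : ∀ D → (-ᴰ D) +ᴰ D ≈ᴰ 0ᴰ
    +ᴰ-inverseˡ (p ⊝ n) = div-≈ (↭-trans (++-identityʳ (n ++ p)) (++-comm n p))

    +ᴰ-identityˡ : ∀ D → 0ᴰ +ᴰ D ≈ᴰ D
    +ᴰ-identityˡ (p ⊝ n) = div-≈ ↭-refl

  divisorGroup : AbelianGroup x (x ⊔ ℓ)
  divisorGroup = record
    { Carrier = Div
    ; _≈_ = _≈ᴰ_
    ; _∙_ = _+ᴰ_
    ; ε = 0ᴰ
    ; _⁻¹ = -ᴰ_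
    ; isAbelianGroup = record
      { isGroup = record
        { isMonoid = record
          { isSemigroup = record
            { isMagma = record
              { isEquivalence = ≈ᴰ-isEquivalence
              ; ∙-cong = λ { {p ⊝ n} {p′ ⊝ n′} {q ⊝ m} {q′ ⊝ m′} (div-≈ eq) (div-≈ eq′) →
                  div-≈ (↭-trans (rearrange p q n′ m′) (↭-trans (++⁺ eq eq′) (rearrange p′ n q′ m))) }
              }
            ; assoc = λ { (p ⊝ n) (p′ ⊝ n′) (p″ ⊝ n″) →
                ≡⇒≈ᴰ (≡.cong₂ _⊝_ (List.++-assoc p p′ p″) (List.++-assoc n n′ n″)) }
            }
          ; identity = +ᴰ-identityˡ , λ D → trans (+ᴰ-comm D 0ᴰ) (+ᴰ-identityˡ D)
          }
        ; inverse = +ᴰ-inverseˡ , λ D → trans (+ᴰ-comm D (-ᴰ D)) (+ᴰ-inverseˡ D)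
        ; ⁻¹-cong = λ { {p ⊝ n} {p′ ⊝ n′} (div-≈ eq) →
            div-≈ (↭-trans (++-comm n p′) (↭-trans (↭-sym eq) (++-comm p n′))) }
        }
      ; comm = +ᴰ-comm
      }
    }
    where open IsEquivalence ≈ᴰ-isEquivalence using (trans)

  degree-+ : ∀ D E → degree (D +ᴰ E) ≡ degree D ℤ.+ degree E
  degree-+ (p ⊝ n) (p′ ⊝ n′) rewrite List.length-++ p {p′} | List.length-++ n {n′} =
    solve 4 (λ a b c d → (a :+ b) :- (c :+ d) := (a :- c) :+ (b :- d)) ≡.refl
      (ℤ.+ length p) (ℤ.+ length p′) (ℤ.+ length n) (ℤ.+ length n′)
    where open ℤSolver.+-*-Solver

  degree-neg : ∀ D → degree (-ᴰ D) ≡ ℤ.- degree D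
  degree-neg (p ⊝ n) = solve 2 (λ a b → b :- a := :- (a :- b)) ≡.refl (ℤ.+ length p) (ℤ.+ length n)
    where open ℤSolver.+-*-Solver

  record Div⁰ : Set x where
    constructor _,deg0_
    field
      divisor  : Div
      degree≡0 : degree divisor ≡ 0ℤ

  open Div⁰ public

  infix 4 _≈ᴰ⁰_

  record _≈ᴰ⁰_ (D E : Div⁰) : Set (x ⊔ ℓ) where
    constructor div⁰-≈
    field divisor-≈ : divisor D ≈ᴰ divisor E

  open _≈ᴰ⁰_ public

  divisor⁰Group : AbelianGroup x (x ⊔ ℓ)
  divisor⁰Group = record
    { Carrier = Div⁰
    ; _≈_ = _≈ᴰ⁰_
    ; _∙_ = λ { (D ,deg0 d) (E ,deg0 e) → (D +ᴰ E) ,deg0 ≡.trans (degree-+ D E) (≡.cong₂ ℤ._+_ d e) }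
    ; ε = 0ᴰ ,deg0 ≡.refl
    ; _⁻¹ = λ { (D ,deg0 d) → (-ᴰ D) ,deg0 ≡.trans (degree-neg D) (≡.cong ℤ.-_ d) }
    ; isAbelianGroup = record
      { isGroup = record
        { isMonoid = record
          { isSemigroup = record
            { isMagma = record
              { isEquivalence = record
                { refl  = div⁰-≈ refl
                ; sym   = λ { (div⁰-≈ eq) → div⁰-≈ (sym eq) }
                ; trans = λ { (div⁰-≈ eq) (div⁰-≈ eq′) → div⁰-≈ (trans eq eq′) }
                }
              ; ∙-cong = λ { (div⁰-≈ eq) (div⁰-≈ eq′) → div⁰-≈ (∙-cong eq eq′) }
              }
            ; assoc = λ D E F → div⁰-≈ (assoc (divisor D) (divisor E) (divisor F))
            }
          ; identity = (λ D → div⁰-≈ (identityˡ (divisor D))) , (λ D → div⁰-≈ (identityʳ (divisor D)))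
          }
        ; inverse = (λ D → div⁰-≈ (inverseˡ (divisor D))) , (λ D → div⁰-≈ (inverseʳ (divisor D)))
        ; ⁻¹-cong = λ { (div⁰-≈ eq) → div⁰-≈ (⁻¹-cong eq) }
        }
      ; comm = λ D E → div⁰-≈ (comm (divisor D) (divisor E))
      }
    }
    where open AbelianGroup divisorGroup

  -- (s) − (r), whose class is the modular symbol [r, s].
  _⟶_ : Point → Point → Div⁰
  r ⟶ s = ((s ∷ []) ⊝ (r ∷ [])) ,deg0 ≡.refl

module _ {x ℓ y m} {X : Setoid x ℓ} {Y : Setoid y m} where
  private
    module X = Divisors X
    module Y = Divisors Y

  pushforward : (Setoid.Carrier X → Setoid.Carrier Y) → X.Div → Y.Div
  pushforward f (p X.⊝ n) = map f p Y.⊝ map f n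

  pushforward-degree : ∀ f D → Y.degree (pushforward f D) ≡ X.degree D
  pushforward-degree f (p X.⊝ n) rewrite List.length-map f p | List.length-map f n = ≡.refl

  pushforward⁰ : (Setoid.Carrier X → Setoid.Carrier Y) → X.Div⁰ → Y.Div⁰
  pushforward⁰ f (D X.,deg0 d) = pushforward f D Y.,deg0 ≡.trans (pushforward-degree f D) d

module Comaximality {c ℓ} (R : CommutativeRing c ℓ) where
  open CommutativeRing R
  open SemiringDivisibility semiring using (_∣_; _,_)
  open CommutativeRingSolver R

  infixl 6 _⊞_

  ⟪_⟫ : Carrier → Pred Carrier (c ⊔ ℓ)
  ⟪ a ⟫ f = a ∣ f

  _⊞_ : ∀ {i j} → Pred Carrier i → Pred Carrier j → Pred Carrier (c ⊔ ℓ ⊔ i ⊔ j)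
  (I ⊞ J) f = ∃[ g ] ∃[ h ] (I g × J h × f ≈ g + h)

  whole₂ : ∀ {a b} → (∃[ x ] ∃[ y ] x * a + y * b ≈ 1#) → Universal (⟪ a ⟫ ⊞ ⟪ b ⟫)
  whole₂ {a} {b} (x , y , e) f = f * x * a , f * y * b , (f * x , refl) , (f * y , refl) ,
    trans (sym (*-identityʳ f)) (trans (*-congˡ (sym e))
      (solve 5 (λ f x y a b → f :* (x :* a :+ y :* b) := f :* x :* a :+ f :* y :* b) refl f x y a b))

  combination₂ : ∀ {a b} → Universal (⟪ a ⟫ ⊞ ⟪ b ⟫) → ∃[ x ] ∃[ y ] x * a + y * b ≈ 1#
  combination₂ w with w 1#
  ... | _ , _ , (x , xa≈g) , (y , yb≈h) , 1≈g+h = x , y , trans (+-cong xa≈g yb≈h) (sym 1≈g+h)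

  whole₃ : ∀ {a b n} → (∃[ x ] ∃[ y ] ∃[ z ] x * a + y * b + z * n ≈ 1#) → Universal (⟪ a ⟫ ⊞ ⟪ b ⟫ ⊞ ⟪ n ⟫)
  whole₃ {a} {b} {n} (x , y , z , e) f = f * x * a + f * y * b , f * z * n ,
    (f * x * a , f * y * b , (f * x , refl) , (f * y , refl) , refl) , (f * z , refl) ,
    trans (sym (*-identityʳ f)) (trans (*-congˡ (sym e))
      (solve 7 (λ f x y z a b n → f :* (x :* a :+ y :* b :+ z :* n) := f :* x :* a :+ f :* y :* b :+ f :* z :* n) refl f x y z a b n))

  combination₃ : ∀ {a b n} → Universal (⟪ a ⟫ ⊞ ⟪ b ⟫ ⊞ ⟪ n ⟫) → ∃[ x ] ∃[ y ] ∃[ z ] x * a + y * b + z * n ≈ 1#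
  combination₃ w with w 1#
  ... | _ , _ , (_ , _ , (x , xa≈g) , (y , yb≈h) , k≈g+h) , (z , zn≈l) , 1≈k+l =
    x , y , z , trans (+-cong (trans (+-cong xa≈g yb≈h) (sym k≈g+h)) zn≈l) (sym 1≈k+l)

  Comaximal : Carrier → Carrier → Set (c ⊔ ℓ)
  Comaximal a b = Universal (⟪ a ⟫ ⊞ ⟪ b ⟫)

  comaximal-* : ∀ {a b m} → Comaximal a m → Comaximal b m → Comaximal (a * b) m
  comaximal-* {a} {b} {m} wa wb with combination₂ wa | combination₂ wb
  ... | x , y , e | x′ , y′ , e′ = whole₂ (x * x′ , (x * a * y′ + y * x′ * b + y * y′ * m) ,
    trans (solve 7 (λ x y x′ y′ a b m → x :* x′ :* (a :* b) :+ (x :* a :* y′ :+ y :* x′ :* b :+ y :* y′ :* m) :* m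
        := (x :* a :+ y :* m) :* (x′ :* b :+ y′ :* m)) refl x y x′ y′ a b m)
      (trans (*-cong e e′) (*-identityˡ 1#)))

  comaximal-sym : ∀ {a b} → Comaximal a b → Comaximal b a
  comaximal-sym w with combination₂ w
  ... | x , y , e = whole₂ (y , x , trans (+-comm _ _) e)

  comaximal-reduce : ∀ {a u n} → Comaximal a u → Comaximal a (u + a * n)
  comaximal-reduce {a} {u} {n} w with combination₂ w
  ... | x , y , e = whole₂ (x - y * n , y ,
    trans (solve 5 (λ x y n a u → (x :- y :* n) :* a :+ y :* (u :+ a :* n) := x :* a :+ y :* u) refl x y n a u) e)

  comaximal-respˡ : ∀ {a a′ b} → a ≈ a′ → Comaximal a b → Comaximal a′ b
  comaximal-respˡ e w with combination₂ w
  ... | x , y , e′ = whole₂ (x , y , trans (+-congʳ (*-congˡ (sym e))) e′)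

  comaximal-difference : ∀ v w → (v - w) ∣ 1# → Comaximal w v
  comaximal-difference v w (s , e) = whole₂ (- s , s ,
    trans (solve 3 (λ s v w → (:- s) :* w :+ s :* v := s :* (v :- w)) refl s v w) e)

  unit-comaximal : ∀ {a b} → b ≈ 1# → Comaximal a b
  unit-comaximal {a} {b} e = whole₂ (0# , 1# , trans (solve 2 (λ a b → :0 :* a :+ :1 :* b := b) refl a b) e)

  comaximal⇒whole₃ : ∀ {a b} n → Comaximal a b → Universal (⟪ a ⟫ ⊞ ⟪ b ⟫ ⊞ ⟪ n ⟫)
  comaximal⇒whole₃ n w with combination₂ w
  ... | x , y , e = whole₃ (x , y , 0# , trans (+-cong e (zeroˡ n)) (+-identityʳ 1#))

  record Bézout (f g : Carrier) : Set (c ⊔ ℓ) where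
    field
      gcd x y  : Carrier
      identity : x * f + y * g ≈ gcd
      gcd∣f    : gcd ∣ f
      gcd∣g    : gcd ∣ g

  module _ {f g} (b : Bézout f g) where
    open Bézout b

    gcd∣1⇒comaximal : gcd ∣ 1# → Comaximal f g
    gcd∣1⇒comaximal (s , e) = whole₂ (s * x , s * y ,
      trans (solve 5 (λ s x y a b → s :* x :* a :+ s :* y :* b := s :* (x :* a :+ y :* b)) refl s x y f g) (trans (*-congˡ identity) e))

    comaximal⇒gcd∣1 : Comaximal f g → gcd ∣ 1#
    comaximal⇒gcd∣1 w with combination₂ w | gcd∣f | gcd∣g
    ... | x , y , e | (s , e₁) | (t , e₂) = x * s + y * t , trans
      (solve 5 (λ x y s t g → (x :* s :+ y :* t) :* g := x :* (s :* g) :+ y :* (t :* g)) refl x y s t gcd)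
      (trans (+-cong (*-congˡ e₁) (*-congˡ e₂)) e)

  private
    combination-lift : ∀ {α β γ u v n a x y} → α * u + β * v + γ * n ≈ 1# → x * a + y * u ≈ 1# →
      (γ * x) * (u + a * n) + (α + γ * n * y - γ * x) * u + β * v ≈ 1#
    combination-lift {α} {β} {γ} {u} {v} {n} {a} {x} {y} eq e = trans
      (solve 9 (λ α β γ x y n a u v → γ :* x :* (u :+ a :* n) :+ (α :+ γ :* n :* y :- γ :* x) :* u :+ β :* v
          := α :* u :+ β :* v :+ γ :* (n :* (x :* a :+ y :* u))) refl α β γ x y n a u v)
      (trans (+-congˡ (*-congˡ (trans (*-congˡ e) (*-identityʳ n)))) eq)

    combination-gcd : ∀ {α β γ y u v s t g} → s * g ≈ u → t * g ≈ v → α * y + β * u + γ * v ≈ 1# →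
      (β * s + γ * t) * g + α * y ≈ 1#
    combination-gcd {α} {β} {γ} {y} {u} {v} {s} {t} {g} e e′ eq = trans
      (solve 7 (λ α β γ s t g y → (β :* s :+ γ :* t) :* g :+ α :* y := α :* y :+ β :* (s :* g) :+ γ :* (t :* g)) refl α β γ s t g y)
      (trans (+-cong (+-congˡ (*-congˡ e)) (*-congˡ e′)) eq)

    combination-shift : ∀ {α β γ u v n} → α * u + β * v + γ * n ≈ 1# → α * u + β * (v + 1# * n) + (γ - β) * n ≈ 1#
    combination-shift {α} {β} {γ} {u} {v} {n} eq = trans
      (solve 6 (λ α β γ u v n → α :* u :+ β :* (v :+ :1 :* n) :+ (γ :- β) :* n := α :* u :+ β :* v :+ γ :* n) refl α β γ u v n) eq

  -- A factorisation v = v₁ v₂ with v₁ coprime to u, such that every prime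
  -- factor of v₂ divides both u and v.
  record Split (u v : Carrier) : Set (c ⊔ ℓ) where
    field
      v₁ v₂    : Carrier
      v≈v₁v₂   : v ≈ v₁ * v₂
      coprime₁ : Comaximal v₁ u
      coprime₂ : ∀ y → (∃[ α ] ∃[ β ] ∃[ γ ] α * y + β * u + γ * v ≈ 1#) → Comaximal v₂ y

  split-coprime : ∀ {u v} → Comaximal u v → Split u v
  split-coprime {u} {v} w = record
    { v₁ = v ; v₂ = 1# ; v≈v₁v₂ = sym (*-identityʳ v)
    ; coprime₁ = comaximal-sym w
    ; coprime₂ = λ y _ → comaximal-sym (unit-comaximal refl)
    }

  split-factor : ∀ {u v t g} → g ∣ u → t * g ≈ v → Split u t → Split u v
  split-factor {u} {v} {t} {g} (s , sg≈u) tg≈v σ = record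
    { v₁ = v₁ ; v₂ = g * v₂
    ; v≈v₁v₂ = trans (sym tg≈v) (trans (*-congʳ v≈v₁v₂) (trans (*-assoc v₁ v₂ g) (*-congˡ (*-comm v₂ g))))
    ; coprime₁ = coprime₁
    ; coprime₂ = λ { y (α , β , γ , eq) → comaximal-*
        (whole₂ (β * s + γ * t , α , combination-gcd sg≈u tg≈v eq))
        (coprime₂ y (α , β , γ * g , trans (+-congˡ (trans (*-assoc _ _ _) (*-congˡ (trans (*-comm _ _) tg≈v)))) eq)) }
    }
    where open Split σ

  split⇒lift : ∀ {u v} n → Split u v → (∃[ α ] ∃[ β ] ∃[ γ ] α * u + β * v + γ * n ≈ 1#) → ∃[ t ] Comaximal (u + t * n) v
  split⇒lift {u} {v} n σ (α , β , γ , eq) with combination₂ (Split.coprime₁ σ)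
  ... | x , y , e = v₁ , comaximal-sym (comaximal-respˡ (sym v≈v₁v₂) (comaximal-* (comaximal-reduce coprime₁)
    (coprime₂ (u + v₁ * n) (γ * x , α + γ * n * y - γ * x , β , combination-lift eq e))))
    where open Split σ

  -- If every pair (u , v) with v ≉ 0 splits then coprime pairs modulo n lift.
  lift-comaximal : (∀ x → Dec (x ≈ 0#)) → (∀ u v → ¬ (v ≈ 0#) → Split u v) →
                   ∀ u v n → ¬ (n ≈ 0#) → Universal (⟪ u ⟫ ⊞ ⟪ v ⟫ ⊞ ⟪ n ⟫) →
                   ∃[ s ] ∃[ t ] Comaximal (u + s * n) (v + t * n)
  lift-comaximal _≟0 split u v n n≉0 w with v ≟0
  ... | no v≉0  = unshifted (split⇒lift n (split u v v≉0) (combination₃ w))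
    where
    unshifted : ∃[ s ] Comaximal (u + s * n) v → ∃[ s ] ∃[ t ] Comaximal (u + s * n) (v + t * n)
    unshifted (s , cm) = s , 0# , comaximal-sym (comaximal-respˡ (sym (trans (+-congˡ (zeroˡ n)) (+-identityʳ v))) (comaximal-sym cm))
  ... | yes v≈0 = shifted (split⇒lift n (split u (v + 1# * n) v+n≉0) (combination (combination₃ w)))
    where
    v+n≉0 : ¬ (v + 1# * n ≈ 0#)
    v+n≉0 e = n≉0 (trans (sym (trans (+-congʳ v≈0) (trans (+-identityˡ _) (*-identityˡ n)))) e)
    combination : (∃[ α ] ∃[ β ] ∃[ γ ] α * u + β * v + γ * n ≈ 1#) → ∃[ α ] ∃[ β ] ∃[ γ ] α * u + β * (v + 1# * n) + γ * n ≈ 1#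
    combination (α , β , γ , eq) = α , β , γ - β , combination-shift eq
    shifted : ∃[ s ] Comaximal (u + s * n) (v + 1# * n) → ∃[ s ] ∃[ t ] Comaximal (u + s * n) (v + t * n)
    shifted (s , cm) = s , 1# , cm

record IsIntegralDomain {c ℓ} (R : CommutativeRing c ℓ) : Set (c ⊔ ℓ) where
  open CommutativeRing R
  field
    1≉0       : ¬ (1# ≈ 0#)
    *-≉0      : ∀ {x y} → ¬ (x ≈ 0#) → ¬ (y ≈ 0#) → ¬ (x * y ≈ 0#)
    *-cancelˡ : ∀ x {y z} → ¬ (x ≈ 0#) → x * y ≈ x * z → y ≈ z

module FractionField {c ℓ} (R : CommutativeRing c ℓ) (isIntegralDomain : IsIntegralDomain R) where
  open CommutativeRing R
  open IsIntegralDomain isIntegralDomain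
  open SemiringDivisibility semiring using (_,_)
  open CommutativeRingSolver R
  private
    module MR = Matrices R

  infix  4 _≈ᶠ_
  infixl 6 _+ᶠ_
  infixl 7 _*ᶠ_

  record Frac : Set (c ⊔ ℓ) where
    constructor _/_[_]
    field
      num den : Carrier
      den≉0   : ¬ (den ≈ 0#)

  open Frac public

  record _≈ᶠ_ (x y : Frac) : Set ℓ where
    constructor cross
    field cross-≈ : num x * den y ≈ num y * den x

  _+ᶠ_ _*ᶠ_ : Frac → Frac → Frac
  (n / d [ d≉0 ]) +ᶠ (n′ / d′ [ d′≉0 ]) = (n * d′ + n′ * d) / (d * d′) [ *-≉0 d≉0 d′≉0 ]
  (n / d [ d≉0 ]) *ᶠ (n′ / d′ [ d′≉0 ]) = (n * n′) / (d * d′) [ *-≉0 d≉0 d′≉0 ]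

  -ᶠ_ : Frac → Frac
  -ᶠ (n / d [ d≉0 ]) = (- n) / d [ d≉0 ]

  ι : Carrier → Frac
  ι x = x / 1# [ 1≉0 ]

  private
    cross-trans : ∀ {n d n′ d′ n″ d″} → ¬ (d′ ≈ 0#) → n * d′ ≈ n′ * d → n′ * d″ ≈ n″ * d′ → n * d″ ≈ n″ * d
    cross-trans {n} {d} {n′} {d′} {n″} {d″} d′≉0 e e′ = *-cancelˡ d′ d′≉0 (trans
      (solve 3 (λ n d′ d″ → d′ :* (n :* d″) := (n :* d′) :* d″) refl n d′ d″) (trans (*-congʳ e) (trans
      (solve 3 (λ n′ d d″ → (n′ :* d) :* d″ := (n′ :* d″) :* d) refl n′ d d″) (trans (*-congʳ e′)
      (solve 3 (λ n″ d d′ → (n″ :* d′) :* d := d′ :* (n″ :* d)) refl n″ d d′)))))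

    cross-+ : ∀ {n d n′ d′ m e m′ e′} → n * d′ ≈ n′ * d → m * e′ ≈ m′ * e →
              (n * e + m * d) * (d′ * e′) ≈ (n′ * e′ + m′ * d′) * (d * e)
    cross-+ {n} {d} {n′} {d′} {m} {e} {m′} {e′} p q = trans
      (solve 6 (λ n d d′ m e e′ → (n :* e :+ m :* d) :* (d′ :* e′) := (n :* d′) :* (e :* e′) :+ (m :* e′) :* (d :* d′)) refl n d d′ m e e′)
      (trans (+-cong (*-congʳ p) (*-congʳ q))
      (solve 6 (λ n′ d d′ m′ e e′ → (n′ :* d) :* (e :* e′) :+ (m′ :* e) :* (d :* d′) := (n′ :* e′ :+ m′ :* d′) :* (d :* e)) refl n′ d d′ m′ e e′))

    cross-* : ∀ {n d n′ d′ m e m′ e′} → n * d′ ≈ n′ * d → m * e′ ≈ m′ * e → (n * m) * (d′ * e′) ≈ (n′ * m′) * (d * e)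
    cross-* {n} {d} {n′} {d′} {m} {e} {m′} {e′} p q = trans
      (solve 4 (λ n m d′ e′ → (n :* m) :* (d′ :* e′) := (n :* d′) :* (m :* e′)) refl n m d′ e′)
      (trans (*-cong p q)
      (solve 4 (λ n′ m′ d e → (n′ :* d) :* (m′ :* e) := (n′ :* m′) :* (d :* e)) refl n′ m′ d e))

    cross-neg : ∀ {n d n′ d′} → n * d′ ≈ n′ * d → - n * d′ ≈ - n′ * d
    cross-neg {n} {d} {n′} {d′} p = trans (solve 2 (λ n d′ → (:- n) :* d′ := :- (n :* d′)) refl n d′)
      (trans (-‿cong p) (solve 2 (λ n d → :- (n :* d) := (:- n) :* d) refl n′ d))

    +ᶠ-comm : ∀ x y → x +ᶠ y ≈ᶠ y +ᶠ x
    +ᶠ-comm (n / d [ _ ]) (m / e [ _ ]) = cross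
      (solve 4 (λ n d m e → (n :* e :+ m :* d) :* (e :* d) := (m :* d :+ n :* e) :* (d :* e)) refl n d m e)

    +ᶠ-assoc : ∀ x y z → (x +ᶠ y) +ᶠ z ≈ᶠ x +ᶠ (y +ᶠ z)
    +ᶠ-assoc (n / d [ _ ]) (m / e [ _ ]) (k / f [ _ ]) = cross (solve 6 (λ n d m e k f →
      ((n :* e :+ m :* d) :* f :+ k :* (d :* e)) :* (d :* (e :* f))
      := (n :* (e :* f) :+ (m :* f :+ k :* e) :* d) :* ((d :* e) :* f)) refl n d m e k f)

    +ᶠ-identityˡ : ∀ x → ι 0# +ᶠ x ≈ᶠ x
    +ᶠ-identityˡ (n / d [ _ ]) = cross (solve 2 (λ n d → (:0 :* d :+ n :* :1) :* d := n :* (:1 :* d)) refl n d)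

    +ᶠ-inverseˡ : ∀ x → (-ᶠ x) +ᶠ x ≈ᶠ ι 0#
    +ᶠ-inverseˡ (n / d [ _ ]) = cross (solve 2 (λ n d → ((:- n) :* d :+ n :* d) :* :1 := :0 :* (d :* d)) refl n d)

    *ᶠ-comm : ∀ x y → x *ᶠ y ≈ᶠ y *ᶠ x
    *ᶠ-comm (n / d [ _ ]) (m / e [ _ ]) = cross (solve 4 (λ n d m e → (n :* m) :* (e :* d) := (m :* n) :* (d :* e)) refl n d m e)

    *ᶠ-assoc : ∀ x y z → (x *ᶠ y) *ᶠ z ≈ᶠ x *ᶠ (y *ᶠ z)
    *ᶠ-assoc (n / d [ _ ]) (m / e [ _ ]) (k / f [ _ ]) = cross (solve 6 (λ n d m e k f →
      ((n :* m) :* k) :* (d :* (e :* f)) := (n :* (m :* k)) :* ((d :* e) :* f)) refl n d m e k f)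

    *ᶠ-identityˡ : ∀ x → ι 1# *ᶠ x ≈ᶠ x
    *ᶠ-identityˡ (n / d [ _ ]) = cross (solve 2 (λ n d → (:1 :* n) :* d := n :* (:1 :* d)) refl n d)

    *ᶠ-distribˡ : ∀ x y z → x *ᶠ (y +ᶠ z) ≈ᶠ x *ᶠ y +ᶠ x *ᶠ z
    *ᶠ-distribˡ (n / d [ _ ]) (m / e [ _ ]) (k / f [ _ ]) = cross (solve 6 (λ n d m e k f →
      (n :* (m :* f :+ k :* e)) :* ((d :* e) :* (d :* f))
      := ((n :* m) :* (d :* f) :+ (n :* k) :* (d :* e)) :* (d :* (e :* f))) refl n d m e k f)

  ≈ᶠ-isEquivalence : IsEquivalence _≈ᶠ_
  ≈ᶠ-isEquivalence = record
    { refl  = cross refl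
    ; sym   = λ { (cross e) → cross (sym e) }
    ; trans = λ { {x} {y} {z} (cross e) (cross e′) → cross (cross-trans (den≉0 y) e e′) }
    }

  fractionField : CommutativeRing (c ⊔ ℓ) ℓ
  fractionField = record
    { Carrier = Frac
    ; _≈_ = _≈ᶠ_
    ; _+_ = _+ᶠ_
    ; _*_ = _*ᶠ_
    ; -_ = -ᶠ_
    ; 0# = ι 0#
    ; 1# = ι 1#
    ; isCommutativeRing = record
      { isRing = record
        { +-isAbelianGroup = record
          { isGroup = record
            { isMonoid = record
              { isSemigroup = record
                { isMagma = record
                  { isEquivalence = ≈ᶠ-isEquivalence
                  ; ∙-cong = λ { (cross p) (cross q) → cross (cross-+ p q) }
                  }
                ; assoc = +ᶠ-assoc
                }
              ; identity = +ᶠ-identityˡ , λ x → E.trans (+ᶠ-comm x (ι 0#)) (+ᶠ-identityˡ x)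
              }
            ; inverse = +ᶠ-inverseˡ , λ x → E.trans (+ᶠ-comm x (-ᶠ x)) (+ᶠ-inverseˡ x)
            ; ⁻¹-cong = λ { (cross p) → cross (cross-neg p) }
            }
          ; comm = +ᶠ-comm
          }
        ; *-cong = λ { (cross p) (cross q) → cross (cross-* p q) }
        ; *-assoc = *ᶠ-assoc
        ; *-identity = *ᶠ-identityˡ , λ x → E.trans (*ᶠ-comm x (ι 1#)) (*ᶠ-identityˡ x)
        ; distrib = *ᶠ-distribˡ , λ x y z → E.trans (*ᶠ-comm (y +ᶠ z) x) (E.trans (*ᶠ-distribˡ x y z) (+-congᶠ (*ᶠ-comm x y) (*ᶠ-comm x z)))
        }
      ; *-comm = *ᶠ-comm
      }
    }
    where
    module E = IsEquivalence ≈ᶠ-isEquivalence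
    +-congᶠ : ∀ {x x′ y y′} → x ≈ᶠ x′ → y ≈ᶠ y′ → x +ᶠ y ≈ᶠ x′ +ᶠ y′
    +-congᶠ (cross p) (cross q) = cross (cross-+ p q)

  1≉0ᶠ : ¬ (ι 1# ≈ᶠ ι 0#)
  1≉0ᶠ (cross e) = 1≉0 (trans (sym (*-identityˡ 1#)) (trans e (zeroˡ 1#)))

  private
    module MK = Matrices fractionField

  ιᴹ : MR.Mat₂ → MK.Mat₂
  ιᴹ (MR.mat a b c d) = MK.mat (ι a) (ι b) (ι c) (ι d)

  opaque
    ιᴹ-invertible : ∀ M → MR.IsUnit (MR.det M) → MK.IsUnit (MK.det (ιᴹ M))
    ιᴹ-invertible (MR.mat a b c d) (e , e*det≈1) = MK.isUnit (ι e) (cross (trans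
      (solve 5 (λ e a b c d → (e :* ((a :* d) :* (:1 :* :1) :+ (:- (b :* c)) :* (:1 :* :1))) :* :1 := e :* (a :* d :- b :* c)) refl e a b c d)
      (trans e*det≈1 (solve 0 (:1 := :1 :* (:1 :* ((:1 :* :1) :* (:1 :* :1)))) refl))))

    upperTriangular-invertible : ∀ {a} b {d} → ¬ (a ≈ 0#) → ¬ (d ≈ 0#) → MK.IsUnit (MK.det (ιᴹ (MR.mat a b 0# d)))
    upperTriangular-invertible {a} b {d} a≉0 d≉0 = MK.isUnit (1# / (a * d) [ *-≉0 a≉0 d≉0 ]) (cross
      (solve 3 (λ a b d → (:1 :* ((a :* d) :* (:1 :* :1) :+ (:- (b :* :0)) :* (:1 :* :1))) :* :1
        := :1 :* ((a :* d) :* ((:1 :* :1) :* (:1 :* :1)))) refl a b d))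

  ιᴳ : MR.GL₂ → MK.GL₂
  ιᴳ (MR.gl M inv) = MK.gl (ιᴹ M) (ιᴹ-invertible M inv)

  upperTriangular : (a b d : Carrier) → ¬ (a ≈ 0#) → ¬ (d ≈ 0#) → MK.GL₂
  upperTriangular a b d a≉0 d≉0 = MK.gl (ιᴹ (MR.mat a b 0# d)) (upperTriangular-invertible b a≉0 d≉0)

  ιᴳ-* : ∀ g h → MK.matrix (ιᴳ (g MR.*ᴳ h)) MK.≈ᴹ MK.matrix (ιᴳ g MK.*ᴳ ιᴳ h)
  ιᴳ-* (MR.gl (MR.mat a b c d) _) (MR.gl (MR.mat a′ b′ c′ d′) _) =
    MK.mat-≈ (entry a a′ b c′) (entry a b′ b d′) (entry c a′ d c′) (entry c b′ d d′)
    where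
    entry : ∀ x y z w → ι (x * y + z * w) ≈ᶠ (ι x *ᶠ ι y) +ᶠ (ι z *ᶠ ι w)
    entry x y z w = cross (solve 4 (λ x y z w → (x :* y :+ z :* w) :* ((:1 :* :1) :* (:1 :* :1))
      := ((x :* y) :* (:1 :* :1) :+ (z :* w) :* (:1 :* :1)) :* :1) refl x y z w)

  ιᴹ-cong : ∀ {M N} → M MR.≈ᴹ N → ιᴹ M MK.≈ᴹ ιᴹ N
  ιᴹ-cong (MR.mat-≈ e₁ e₂ e₃ e₄) = MK.mat-≈ (cross (*-congʳ e₁)) (cross (*-congʳ e₂)) (cross (*-congʳ e₃)) (cross (*-congʳ e₄))

module BottomRow {c ℓ} (R : CommutativeRing c ℓ) where
  open CommutativeRing R
  open SemiringDivisibility semiring using (_∣_; _,_)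
  open CommutativeRingSolver R
  open Matrices R
  open Comaximality R

  completeRow : ∀ {u v} → Comaximal u v → Σ[ g ∈ GL₂ ] (a₂₁ (matrix g) ≡ u × a₂₂ (matrix g) ≡ v)
  completeRow {u} {v} w with combination₂ w
  ... | x , y , e = gl (mat y (- x) u v) (isUnit 1# (trans (*-identityˡ _) (trans (det-row u v x y) e))) , ≡.refl , ≡.refl
    where
    det-row : ∀ u v x y → y * v - (- x) * u ≈ x * u + y * v
    det-row = solve 4 (λ u v x y → y :* v :- (:- x) :* u := x :* u :+ y :* v) refl

  bottomRow-whole : ∀ g n → Universal (⟪ a₂₁ (matrix g) ⟫ ⊞ ⟪ a₂₂ (matrix g) ⟫ ⊞ ⟪ n ⟫)
  bottomRow-whole (gl (mat a b u v) (e , e*det≈1)) n = comaximal⇒whole₃ n (whole₂ (- (e * b) , e * a ,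
    trans (solve 5 (λ e a b u v → (:- (e :* b)) :* u :+ (e :* a) :* v := e :* (a :* v :- b :* u)) refl e a b u v) e*det≈1))

  shift-congruent : ∀ u s n → ⟪ n ⟫ (u - 1# * (u + s * n))
  shift-congruent u s n = - s , solve 3 (λ u s n → (:- s) :* n := u :- :1 :* (u :+ s :* n)) refl u s n

  1-comaximal : ∀ n → Comaximal 1# n
  1-comaximal n = comaximal-sym (unit-comaximal refl)

  ⟪⟫-linear : ∀ {n x y} a b → ⟪ n ⟫ x → ⟪ n ⟫ y → ⟪ n ⟫ (x * a + b * y)
  ⟪⟫-linear {n} {x} {y} a b (s , sn≈x) (t , tn≈y) = s * a + b * t , trans
    (solve 5 (λ s t a b n → (s :* a :+ b :* t) :* n := (s :* n) :* a :+ b :* (t :* n)) refl s t a b n)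
    (+-cong (*-congʳ sn≈x) (*-congˡ tn≈y))

  ⟪⟫-neg : ∀ {n x} e → ⟪ n ⟫ x → ⟪ n ⟫ (- (e * x))
  ⟪⟫-neg {n} {x} e (s , sn≈x) = - (e * s) , trans
    (solve 3 (λ e s n → (:- (e :* s)) :* n := :- (e :* (s :* n))) refl e s n) (-‿cong (*-congˡ sn≈x))

-- Γ₀(n) = { (a b ; c d) ∈ GL₂(R) : c ∈ (n) }, acting on ℙ¹(K) for K = Frac R.
module CongruenceSubgroup {c ℓ} (R : CommutativeRing c ℓ) (isIntegralDomain : IsIntegralDomain R) (n : CommutativeRing.Carrier R) where
  open CommutativeRing R
  open SemiringDivisibility semiring using (_,_)
  open Comaximality R using (⟪_⟫)
  open BottomRow R
  open Matrices R
  open FractionField R isIntegralDomain public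

  K : CommutativeRing (c ⊔ ℓ) ℓ
  K = fractionField

  private
    module K = CommutativeRing K
  module GL₂K = Matrices K
  open ProjectiveLine K public

  record Γ₀ : Set (c ⊔ ℓ) where
    constructor γ₀
    field
      element   : GL₂
      lowerLeft : ⟪ n ⟫ (a₂₁ (matrix element))

    actsAs : GL₂K.GL₂
    actsAs = ιᴳ element

  open Γ₀ public

  record _~_ (r s : ℙ¹) : Set (c ⊔ ℓ) where
    constructor orbit
    field
      by    : Γ₀
      moves : actsAs by · r ≈ᴾ s

  private
    module P = IsEquivalence ≈ᴾ-isEquivalence

  ι1≈1 : ιᴹ 1ᴹ GL₂K.≈ᴹ GL₂K.1ᴹ
  ι1≈1 = GL₂K.mat-≈ K.refl K.refl K.refl K.refl

  compose : ∀ g h r → ιᴳ (g *ᴳ h) · r ≈ᴾ ιᴳ g · (ιᴳ h · r)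
  compose g h r = P.trans (·-cong {ιᴳ (g *ᴳ h)} {ιᴳ g GL₂K.*ᴳ ιᴳ h} (ιᴳ-* g h) (P.refl {r})) (·-assoc (ιᴳ g) (ιᴳ h) r)

  identity-acts : ∀ r → ιᴳ 1ᴳ · r ≈ᴾ r
  identity-acts r = ·-identity (ιᴳ 1ᴳ) ι1≈1 r

  inverse-acts : ∀ g r → ιᴳ (g ⁻¹ᴳ *ᴳ g) · r ≈ᴾ r
  inverse-acts g r = P.trans (·-cong {ιᴳ (g ⁻¹ᴳ *ᴳ g)} {ιᴳ 1ᴳ} (ιᴹ-cong (inverseˡ g)) (P.refl {r})) (identity-acts r)

  back : ∀ g {r s} → ιᴳ g · r ≈ᴾ s → ιᴳ (g ⁻¹ᴳ) · s ≈ᴾ r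
  back g {r} gr≈s = P.trans (·-congʳ (ιᴳ (g ⁻¹ᴳ)) (P.sym gr≈s)) (P.trans (P.sym (compose (g ⁻¹ᴳ) g r)) (inverse-acts g r))

  inverse∈ : ∀ g → ⟪ n ⟫ (a₂₁ (matrix g)) → ⟪ n ⟫ (a₂₁ (matrix (g ⁻¹ᴳ)))
  inverse∈ (gl (mat _ _ _ _) (e , _)) g∈ = ⟪⟫-neg e g∈

  product∈ : ∀ g h → ⟪ n ⟫ (a₂₁ (matrix g)) → ⟪ n ⟫ (a₂₁ (matrix h)) → ⟪ n ⟫ (a₂₁ (matrix (g *ᴳ h)))
  product∈ (gl (mat _ _ _ d) _) (gl (mat a′ _ _ _) _) g∈ h∈ = ⟪⟫-linear a′ d g∈ h∈

  ~-trans : ∀ {r s t} → r ~ s → s ~ t → r ~ t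
  ~-trans {r} (orbit (γ₀ g g∈) gr≈s) (orbit (γ₀ h h∈) hs≈t) =
    orbit (γ₀ (h *ᴳ g) (product∈ h g h∈ g∈)) (P.trans (compose h g r) (P.trans (·-congʳ (ιᴳ h) gr≈s) hs≈t))

  orbits : Setoid (c ⊔ ℓ) (c ⊔ ℓ)
  orbits = record
    { Carrier = ℙ¹
    ; _≈_ = _~_
    ; isEquivalence = record
      { refl  = λ {r} → orbit (γ₀ 1ᴳ (0# , zeroˡ n)) (identity-acts r)
      ; sym   = λ { (orbit (γ₀ g g∈) gr≈s) → orbit (γ₀ (g ⁻¹ᴳ) (inverse∈ g g∈)) (back g gr≈s) }
      ; trans = ~-trans
      }
    }

  𝟎 ∞ : ℙ¹
  𝟎 = K.0# ∶ K.1# [ (λ { (_ , 1≈0) → 1≉0ᶠ 1≈0 }) ]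
  ∞ = K.1# ∶ K.0# [ (λ { (1≈0 , _) → 1≉0ᶠ 1≈0 }) ]

record FiniteField c ℓ (q : ℕ) : Set (lsuc (c ⊔ ℓ)) where
  field
    commutativeRing : CommutativeRing c ℓ

  open CommutativeRing commutativeRing public
  open SemiringDivisibility semiring using (_∣_)

  field
    1≉0         : ¬ (1# ≈ 0#)
    invertible  : ∀ x → ¬ (x ≈ 0#) → x ∣ 1#
    enumeration : Inverse (≡.setoid (Fin q)) setoid

  elements : List Carrier
  elements = map (Inverse.to enumeration) (allFin q)

  _≟_ : ∀ x y → Dec (x ≈ y)
  x ≟ y = Dec.map′ from-injective (Inverse.from-cong enumeration) (Inverse.from enumeration x Fin.≟ Inverse.from enumeration y)
    where
    from-injective : Inverse.from enumeration x ≡ Inverse.from enumeration y → x ≈ y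
    from-injective eq = trans (sym (Inverse.strictlyInverseˡ enumeration x))
      (trans (Inverse.to-cong enumeration eq) (Inverse.strictlyInverseˡ enumeration y))

  x≉0∧y≉0⇒xy≉0 : ∀ {x y} → ¬ (x ≈ 0#) → ¬ (y ≈ 0#) → ¬ (x * y ≈ 0#)
  x≉0∧y≉0⇒xy≉0 {x} {y} x≉0 y≉0 xy≈0 with invertible x x≉0
  ... | record { quotient = x⁻¹ ; equality = x⁻¹x≈1 } = y≉0 (begin
    y               ≈⟨ *-identityˡ y ⟨
    1# * y          ≈⟨ *-congʳ x⁻¹x≈1 ⟨
    x⁻¹ * x * y     ≈⟨ *-assoc _ _ _ ⟩
    x⁻¹ * (x * y)   ≈⟨ *-congˡ xy≈0 ⟩
    x⁻¹ * 0#        ≈⟨ zeroʳ _ ⟩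
    0#              ∎)
    where open SetoidReasoning setoid

module Polynomials {c ℓ q} (F : FiniteField c ℓ q) where
  private
    module F = FiniteField F
    open module FS = CommutativeRingSolver F.commutativeRing using (_:=_; _:+_; _:*_; _:-_; :-_; :0; :1)
  open F using (0#; 1#) renaming (Carrier to 𝔽)

  -- The coefficient list, constant term first; trailing zeros are allowed.
  Poly : Set c
  Poly = List 𝔽

  coeff : Poly → ℕ → 𝔽
  coeff []      _       = 0#
  coeff (a ∷ f) zero    = a
  coeff (a ∷ f) (suc n) = coeff f n

  infix  4 _≈_
  infixl 6 _+_
  infixl 7 _*_ _⋆_
  infix  8 -_

  record _≈_ (f g : Poly) : Set ℓ where
    constructor coeffs-≈
    field coeff-≈ : ∀ n → coeff f n F.≈ coeff g n

  open _≈_ public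

  0ᴬ 1ᴬ : Poly
  0ᴬ = []
  1ᴬ = 1# ∷ []

  _⋆_ : 𝔽 → Poly → Poly
  a ⋆ f = map (a F.*_) f

  coeff-⋆ : ∀ a f n → coeff (a ⋆ f) n F.≈ a F.* coeff f n
  coeff-⋆ a []      n       = F.sym (F.zeroʳ a)
  coeff-⋆ a (b ∷ f) zero    = F.refl
  coeff-⋆ a (b ∷ f) (suc n) = coeff-⋆ a f n

  ≈-isEquivalence : IsEquivalence _≈_
  ≈-isEquivalence = record
    { refl  = coeffs-≈ λ _ → F.refl
    ; sym   = λ { (coeffs-≈ e) → coeffs-≈ λ n → F.sym (e n) }
    ; trans = λ { (coeffs-≈ e) (coeffs-≈ e′) → coeffs-≈ λ n → F.trans (e n) (e′ n) }
    }

  open IsEquivalence ≈-isEquivalence using (refl; sym; trans)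

  private
    polySetoid : Setoid c ℓ
    polySetoid = record { isEquivalence = ≈-isEquivalence }

  ∷-cong : ∀ {a b f g} → a F.≈ b → f ≈ g → (a ∷ f) ≈ (b ∷ g)
  ∷-cong a≈b (coeffs-≈ e) = coeffs-≈ λ { zero → a≈b ; (suc n) → e n }

  ⋆-cong : ∀ {a b f g} → a F.≈ b → f ≈ g → a ⋆ f ≈ b ⋆ g
  ⋆-cong {a} {b} {f} {g} a≈b (coeffs-≈ e) = coeffs-≈ λ n →
    F.trans (coeff-⋆ a f n) (F.trans (F.*-cong a≈b (e n)) (F.sym (coeff-⋆ b g n)))

  private
    0∷0 : (0# ∷ []) ≈ 0ᴬ
    0∷0 = coeffs-≈ λ { zero → F.refl ; (suc n) → F.refl }

  opaque
    _+_ : Poly → Poly → Poly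
    []      + g       = g
    (a ∷ f) + []      = a ∷ f
    (a ∷ f) + (b ∷ g) = (a F.+ b) ∷ (f + g)

    -_ : Poly → Poly
    - f = map F.-_ f

    _*_ : Poly → Poly → Poly
    []      * g = []
    (a ∷ f) * g = a ⋆ g + (0# ∷ (f * g))

    coeff-+ : ∀ f g n → coeff (f + g) n F.≈ coeff f n F.+ coeff g n
    coeff-+ []      g       n       = F.sym (F.+-identityˡ _)
    coeff-+ (a ∷ f) []      n       = F.sym (F.+-identityʳ _)
    coeff-+ (a ∷ f) (b ∷ g) zero    = F.refl
    coeff-+ (a ∷ f) (b ∷ g) (suc n) = coeff-+ f g n

    coeff-neg : ∀ f n → coeff (- f) n F.≈ F.- coeff f n
    coeff-neg []      n       = F.sym (AbelianGroupProperties.ε⁻¹≈ε F.+-abelianGroup)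
    coeff-neg (a ∷ f) zero    = F.refl
    coeff-neg (a ∷ f) (suc n) = coeff-neg f n

    +-cong : ∀ {f f′ g g′} → f ≈ f′ → g ≈ g′ → f + g ≈ f′ + g′
    +-cong {f} {f′} {g} {g′} (coeffs-≈ e) (coeffs-≈ e′) = coeffs-≈ λ n →
      F.trans (coeff-+ f g n) (F.trans (F.+-cong (e n) (e′ n)) (F.sym (coeff-+ f′ g′ n)))

    +-assoc : ∀ f g h → (f + g) + h ≈ f + (g + h)
    +-assoc f g h = coeffs-≈ λ n → begin
      coeff (f + g + h) n                        ≈⟨ coeff-+ (f + g) h n ⟩
      coeff (f + g) n F.+ coeff h n              ≈⟨ F.+-congʳ (coeff-+ f g n) ⟩
      coeff f n F.+ coeff g n F.+ coeff h n      ≈⟨ F.+-assoc _ _ _ ⟩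
      coeff f n F.+ (coeff g n F.+ coeff h n)    ≈⟨ F.+-congˡ (coeff-+ g h n) ⟨
      coeff f n F.+ coeff (g + h) n              ≈⟨ coeff-+ f (g + h) n ⟨
      coeff (f + (g + h)) n                      ∎
      where open SetoidReasoning F.setoid

    +-comm : ∀ f g → f + g ≈ g + f
    +-comm f g = coeffs-≈ λ n → F.trans (coeff-+ f g n) (F.trans (F.+-comm _ _) (F.sym (coeff-+ g f n)))

    +-identityʳ : ∀ f → f + 0ᴬ ≈ f
    +-identityʳ f = +-comm f 0ᴬ

    -‿inverseʳ : ∀ f → f + (- f) ≈ 0ᴬ
    -‿inverseʳ f = coeffs-≈ λ n → F.trans (coeff-+ f (- f) n) (F.trans (F.+-congˡ (coeff-neg f n)) (F.-‿inverseʳ _))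

    -‿cong : ∀ {f g} → f ≈ g → - f ≈ - g
    -‿cong {f} {g} (coeffs-≈ e) = coeffs-≈ λ n → F.trans (coeff-neg f n) (F.trans (F.-‿cong (e n)) (F.sym (coeff-neg g n)))

    +-swap4 : ∀ f g h k → (f + g) + (h + k) ≈ (f + h) + (g + k)
    +-swap4 f g h k = begin
      (f + g) + (h + k)   ≈⟨ +-assoc f g (h + k) ⟩
      f + (g + (h + k))   ≈⟨ +-cong (refl {f}) (+-assoc g h k) ⟨
      f + ((g + h) + k)   ≈⟨ +-cong (refl {f}) (+-cong (+-comm g h) (refl {k})) ⟩
      f + ((h + g) + k)   ≈⟨ +-cong (refl {f}) (+-assoc h g k) ⟩
      f + (h + (g + k))   ≈⟨ +-assoc f h (g + k) ⟨
      (f + h) + (g + k)   ∎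
      where open SetoidReasoning polySetoid

    ⋆-distrib-+ : ∀ a f g → a ⋆ (f + g) ≈ a ⋆ f + a ⋆ g
    ⋆-distrib-+ a f g = coeffs-≈ λ n → begin
      coeff (a ⋆ (f + g)) n                        ≈⟨ coeff-⋆ a (f + g) n ⟩
      a F.* coeff (f + g) n                        ≈⟨ F.*-congˡ (coeff-+ f g n) ⟩
      a F.* (coeff f n F.+ coeff g n)              ≈⟨ F.distribˡ _ _ _ ⟩
      a F.* coeff f n F.+ a F.* coeff g n          ≈⟨ F.+-cong (coeff-⋆ a f n) (coeff-⋆ a g n) ⟨
      coeff (a ⋆ f) n F.+ coeff (a ⋆ g) n          ≈⟨ coeff-+ (a ⋆ f) (a ⋆ g) n ⟨
      coeff (a ⋆ f + a ⋆ g) n                      ∎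
      where open SetoidReasoning F.setoid

    ⋆-⋆ : ∀ a b f → a ⋆ (b ⋆ f) ≈ (a F.* b) ⋆ f
    ⋆-⋆ a b f = coeffs-≈ λ n → F.trans (coeff-⋆ a (b ⋆ f) n) (F.trans (F.*-congˡ (coeff-⋆ b f n))
      (F.trans (F.sym (F.*-assoc _ _ _)) (F.sym (coeff-⋆ (a F.* b) f n))))

    0⋆ : ∀ f → 0# ⋆ f ≈ 0ᴬ
    0⋆ f = coeffs-≈ λ n → F.trans (coeff-⋆ 0# f n) (F.zeroˡ _)

    1⋆ : ∀ f → 1# ⋆ f ≈ f
    1⋆ f = coeffs-≈ λ n → F.trans (coeff-⋆ 1# f n) (F.*-identityˡ _)

    0∷-+ : ∀ f g → (0# ∷ (f + g)) ≈ (0# ∷ f) + (0# ∷ g)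
    0∷-+ f g = ∷-cong (F.sym (F.+-identityˡ 0#)) refl

    *-congˡ : ∀ f {g g′} → g ≈ g′ → f * g ≈ f * g′
    *-congˡ []      e = refl
    *-congˡ (a ∷ f) e = +-cong (⋆-cong F.refl e) (∷-cong F.refl (*-congˡ f e))

    distribˡ : ∀ f g h → f * (g + h) ≈ f * g + f * h
    distribˡ []      g h = refl
    distribˡ (a ∷ f) g h = begin
      a ⋆ (g + h) + (0# ∷ f * (g + h))                          ≈⟨ +-cong (⋆-distrib-+ a g h) (∷-cong F.refl (distribˡ f g h)) ⟩
      (a ⋆ g + a ⋆ h) + (0# ∷ (f * g + f * h))                  ≈⟨ +-cong (refl {a ⋆ g + a ⋆ h}) (0∷-+ (f * g) (f * h)) ⟩
      (a ⋆ g + a ⋆ h) + ((0# ∷ f * g) + (0# ∷ f * h))           ≈⟨ +-swap4 (a ⋆ g) (a ⋆ h) (0# ∷ f * g) (0# ∷ f * h) ⟩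
      (a ⋆ g + (0# ∷ f * g)) + (a ⋆ h + (0# ∷ f * h))           ∎
      where open SetoidReasoning polySetoid

    *-[] : ∀ f → f * [] ≈ []
    *-[] []      = refl
    *-[] (a ∷ f) = trans (∷-cong F.refl (*-[] f)) 0∷0

    *-∷ : ∀ f b g → f * (b ∷ g) ≈ b ⋆ f + (0# ∷ f * g)
    *-∷ []      b g = sym 0∷0
    *-∷ (a ∷ f) b g = ∷-cong (F.+-congʳ (F.*-comm a b)) (begin
      a ⋆ g + f * (b ∷ g)                     ≈⟨ +-cong (refl {a ⋆ g}) (*-∷ f b g) ⟩
      a ⋆ g + (b ⋆ f + (0# ∷ f * g))          ≈⟨ +-assoc (a ⋆ g) (b ⋆ f) _ ⟨
      (a ⋆ g + b ⋆ f) + (0# ∷ f * g)          ≈⟨ +-cong (+-comm (a ⋆ g) (b ⋆ f)) refl ⟩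
      (b ⋆ f + a ⋆ g) + (0# ∷ f * g)          ≈⟨ +-assoc (b ⋆ f) (a ⋆ g) _ ⟩
      b ⋆ f + (a ⋆ g + (0# ∷ f * g))          ∎)
      where open SetoidReasoning polySetoid

    *-comm : ∀ f g → f * g ≈ g * f
    *-comm []      g = sym (*-[] g)
    *-comm (a ∷ f) g = trans (+-cong (refl {a ⋆ g}) (∷-cong F.refl (*-comm f g))) (sym (*-∷ g a f))

    *-cong : ∀ {f f′ g g′} → f ≈ f′ → g ≈ g′ → f * g ≈ f′ * g′
    *-cong {f} {f′} {g} {g′} e e′ = begin
      f * g     ≈⟨ *-comm f g ⟩
      g * f     ≈⟨ *-congˡ g e ⟩
      g * f′    ≈⟨ *-comm g f′ ⟩
      f′ * g    ≈⟨ *-congˡ f′ e′ ⟩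
      f′ * g′   ∎
      where open SetoidReasoning polySetoid

    distribʳ : ∀ f g h → (g + h) * f ≈ g * f + h * f
    distribʳ f g h = trans (*-comm (g + h) f) (trans (distribˡ f g h) (+-cong (*-comm f g) (*-comm f h)))

    ⋆-* : ∀ a f g → (a ⋆ f) * g ≈ a ⋆ (f * g)
    ⋆-* a []      g = refl
    ⋆-* a (b ∷ f) g = begin
      (a F.* b) ⋆ g + (0# ∷ (a ⋆ f) * g)          ≈⟨ +-cong (sym (⋆-⋆ a b g)) (∷-cong (F.sym (F.zeroʳ a)) (⋆-* a f g)) ⟩
      a ⋆ (b ⋆ g) + a ⋆ (0# ∷ f * g)              ≈⟨ ⋆-distrib-+ a (b ⋆ g) (0# ∷ f * g) ⟨
      a ⋆ (b ⋆ g + (0# ∷ f * g))                  ∎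
      where open SetoidReasoning polySetoid

    0∷-* : ∀ f g → (0# ∷ f) * g ≈ (0# ∷ f * g)
    0∷-* f g = +-cong (0⋆ g) (refl {0# ∷ f * g})

    *-assoc : ∀ f g h → (f * g) * h ≈ f * (g * h)
    *-assoc []      g h = refl
    *-assoc (a ∷ f) g h = begin
      (a ⋆ g + (0# ∷ f * g)) * h            ≈⟨ distribʳ h (a ⋆ g) (0# ∷ f * g) ⟩
      (a ⋆ g) * h + (0# ∷ f * g) * h        ≈⟨ +-cong (⋆-* a g h) (0∷-* (f * g) h) ⟩
      a ⋆ (g * h) + (0# ∷ f * g * h)        ≈⟨ +-cong (refl {a ⋆ (g * h)}) (∷-cong F.refl (*-assoc f g h)) ⟩
      a ⋆ (g * h) + (0# ∷ f * (g * h))      ∎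
      where open SetoidReasoning polySetoid

    *-identityˡ : ∀ f → 1ᴬ * f ≈ f
    *-identityˡ f = trans (+-cong (1⋆ f) 0∷0) (+-identityʳ f)

    ≈0⇒*≈0 : ∀ {f} g → f ≈ 0ᴬ → f * g ≈ 0ᴬ
    ≈0⇒*≈0 {f} g e = *-cong {f} {[]} {g} e refl

    +-identityˡ : ∀ f → 0ᴬ + f ≈ f
    +-identityˡ f = refl

    *-∷ˡ : ∀ a f g → (a ∷ f) * g ≈ a ⋆ g + (0# ∷ f * g)
    *-∷ˡ a f g = refl

    ∷-+-∷ : ∀ a b f g → (a ∷ f) + (b ∷ g) ≈ ((a F.+ b) ∷ (f + g))
    ∷-+-∷ a b f g = refl

  polynomialRing : CommutativeRing c ℓ
  polynomialRing = record
    { Carrier = Poly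
    ; _≈_ = _≈_
    ; _+_ = _+_
    ; _*_ = _*_
    ; -_ = -_
    ; 0# = 0ᴬ
    ; 1# = 1ᴬ
    ; isCommutativeRing = record
      { isRing = record
        { +-isAbelianGroup = record
          { isGroup = record
            { isMonoid = record
              { isSemigroup = record
                { isMagma = record { isEquivalence = ≈-isEquivalence ; ∙-cong = +-cong }
                ; assoc = +-assoc
                }
              ; identity = +-identityˡ , +-identityʳ
              }
            ; inverse = (λ f → trans (+-comm (- f) f) (-‿inverseʳ f)) , -‿inverseʳ
            ; ⁻¹-cong = -‿cong
            }
          ; comm = +-comm
          }
        ; *-cong = *-cong
        ; *-assoc = *-assoc
        ; *-identity = *-identityˡ , λ f → trans (*-comm f 1ᴬ) (*-identityˡ f)
        ; distrib = distribˡ , distribʳ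
        }
      ; *-comm = *-comm
      }
    }

  -- deg f < d, where the zero polynomial has degree -∞.
  DegreeBelow : ℕ → Poly → Set ℓ
  DegreeBelow d f = ∀ m → d ≤ m → coeff f m F.≈ 0#

  record HasDegree (d : ℕ) (f : Poly) : Set ℓ where
    field
      leading : ¬ (coeff f d F.≈ 0#)
      bounded : DegreeBelow (suc d) f

  record IsMonic (d : ℕ) (f : Poly) : Set ℓ where
    field
      leading≈1 : coeff f d F.≈ 1#
      bounded   : DegreeBelow (suc d) f

  IsMonic⇒HasDegree : ∀ {d f} → IsMonic d f → HasDegree d f
  IsMonic⇒HasDegree m = record
    { leading = λ e → F.1≉0 (F.trans (F.sym (IsMonic.leading≈1 m)) e)
    ; bounded = IsMonic.bounded m
    }

  HasDegree⇒≉0 : ∀ {d f} → HasDegree d f → ¬ (f ≈ 0ᴬ)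
  HasDegree⇒≉0 h (coeffs-≈ e) = HasDegree.leading h (e _)

  degree? : ∀ f → (f ≈ 0ᴬ) ⊎ ∃[ d ] HasDegree d f
  degree? [] = inj₁ refl
  degree? (a ∷ f) with degree? f
  ... | inj₂ (d , h) = inj₂ (suc d , record
    { leading = HasDegree.leading h
    ; bounded = λ { (suc m) (s≤s d<m) → HasDegree.bounded h m d<m }
    })
  ... | inj₁ (coeffs-≈ f≈0) with a F.≟ 0#
  ...   | yes a≈0 = inj₁ (coeffs-≈ λ { zero → a≈0 ; (suc n) → f≈0 n })
  ...   | no  a≉0 = inj₂ (0 , record { leading = a≉0 ; bounded = λ { (suc m) _ → f≈0 m } })

  _≟0 : ∀ f → Dec (f ≈ 0ᴬ)
  f ≟0 with degree? f
  ... | inj₁ f≈0     = yes f≈0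
  ... | inj₂ (d , h) = no (HasDegree⇒≉0 h)

  _≟_ : ∀ f g → Dec (f ≈ g)
  f ≟ g = Dec.map′ (GroupProperties.x∙y⁻¹≈ε⇒x≈y group f g) (GroupProperties.x≈y⇒x∙y⁻¹≈ε group) ((f + (- g)) ≟0)
    where open CommutativeRing polynomialRing using () renaming (+-group to group)

  DegreeBelow-length : ∀ f → DegreeBelow (length f) f
  DegreeBelow-length []      m       _         = F.refl
  DegreeBelow-length (a ∷ f) (suc m) (s≤s le)  = DegreeBelow-length f m le

  private
    DegreeBelow-0 : ∀ {f} → DegreeBelow 0 f → f ≈ 0ᴬ
    DegreeBelow-0 b = coeffs-≈ λ n → b n z≤n

    DegreeBelow-tail : ∀ {d a f} → DegreeBelow (suc d) (a ∷ f) → DegreeBelow d f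
    DegreeBelow-tail b m le = b (suc m) (s≤s le)

    coeff-*-suc : ∀ a f g n → coeff ((a ∷ f) * g) (suc n) F.≈ a F.* coeff g (suc n) F.+ coeff (f * g) n
    coeff-*-suc a f g n = F.trans (coeff-≈ (*-∷ˡ a f g) (suc n)) (F.trans (coeff-+ (a ⋆ g) (0# ∷ f * g) (suc n)) (F.+-congʳ (coeff-⋆ a g (suc n))))

  *-DegreeBelow : ∀ d e f g → DegreeBelow d f → DegreeBelow (suc e) g → DegreeBelow (d ℕ.+ e) (f * g)
  *-DegreeBelow zero    e f       g bf bg m le = coeff-≈ (≈0⇒*≈0 g (DegreeBelow-0 bf)) m
  *-DegreeBelow (suc d) e []      g bf bg m le = coeff-≈ (≈0⇒*≈0 g refl) m
  *-DegreeBelow (suc d) e (a ∷ f) g bf bg (suc m) (s≤s le) = begin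
    coeff ((a ∷ f) * g) (suc m)                     ≈⟨ coeff-*-suc a f g m ⟩
    a F.* coeff g (suc m) F.+ coeff (f * g) m       ≈⟨ F.+-cong (F.*-congˡ (bg (suc m) (s≤s (ℕ.≤-trans (ℕ.m≤n+m e d) le))))
                                                         (*-DegreeBelow d e f g (DegreeBelow-tail {a = a} bf) bg m le) ⟩
    a F.* 0# F.+ 0#                                 ≈⟨ F.trans (F.+-identityʳ _) (F.zeroʳ a) ⟩
    0#                                              ∎
    where open SetoidReasoning F.setoid

  *-leading : ∀ d e f g → DegreeBelow (suc d) f → DegreeBelow (suc e) g →
              coeff (f * g) (d ℕ.+ e) F.≈ coeff f d F.* coeff g e
  *-leading d e [] g bf bg = F.trans (coeff-≈ (≈0⇒*≈0 g refl) (d ℕ.+ e)) (F.sym (F.zeroˡ _))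
  *-leading zero e (a ∷ f) g bf bg = begin
    coeff ((a ∷ f) * g) e                            ≈⟨ coeff-≈ (*-∷ˡ a f g) e ⟩
    coeff (a ⋆ g + (0# ∷ f * g)) e                   ≈⟨ coeff-+ (a ⋆ g) (0# ∷ f * g) e ⟩
    coeff (a ⋆ g) e F.+ coeff (0# ∷ f * g) e         ≈⟨ F.+-cong (coeff-⋆ a g e) (coeff-≈ 0∷fg≈0 e) ⟩
    a F.* coeff g e F.+ 0#                           ≈⟨ F.+-identityʳ _ ⟩
    a F.* coeff g e                                  ∎
    where
    open SetoidReasoning F.setoid
    0∷fg≈0 : (0# ∷ f * g) ≈ 0ᴬ
    0∷fg≈0 = trans (∷-cong F.refl (≈0⇒*≈0 g (DegreeBelow-0 (DegreeBelow-tail {a = a} bf)))) 0∷0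
  *-leading (suc d) e (a ∷ f) g bf bg = begin
    coeff ((a ∷ f) * g) (suc (d ℕ.+ e))                          ≈⟨ coeff-*-suc a f g (d ℕ.+ e) ⟩
    a F.* coeff g (suc (d ℕ.+ e)) F.+ coeff (f * g) (d ℕ.+ e)    ≈⟨ F.+-cong (F.*-congˡ (bg _ (s≤s (ℕ.m≤n+m e d))))
                                                                     (*-leading d e f g (DegreeBelow-tail {a = a} bf) bg) ⟩
    a F.* 0# F.+ coeff f d F.* coeff g e                         ≈⟨ F.trans (F.+-congʳ (F.zeroʳ a)) (F.+-identityˡ _) ⟩
    coeff f d F.* coeff g e                                      ∎
    where open SetoidReasoning F.setoid

  *-HasDegree : ∀ {d e f g} → HasDegree d f → HasDegree e g → HasDegree (d ℕ.+ e) (f * g)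
  *-HasDegree {d} {e} {f} {g} hf hg = record
    { leading = λ eq → F.x≉0∧y≉0⇒xy≉0 (HasDegree.leading hf) (HasDegree.leading hg)
        (F.trans (F.sym (*-leading d e f g (HasDegree.bounded hf) (HasDegree.bounded hg))) eq)
    ; bounded = *-DegreeBelow (suc d) e f g (HasDegree.bounded hf) (HasDegree.bounded hg)
    }

  *-≉0 : ∀ {f g} → ¬ (f ≈ 0ᴬ) → ¬ (g ≈ 0ᴬ) → ¬ (f * g ≈ 0ᴬ)
  *-≉0 {f} {g} f≉0 g≉0 with degree? f | degree? g
  ... | inj₁ f≈0     | _              = contradiction f≈0 f≉0
  ... | inj₂ _       | inj₁ g≈0       = contradiction g≈0 g≉0
  ... | inj₂ (d , h) | inj₂ (e , h′)  = HasDegree⇒≉0 (*-HasDegree h h′)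

  1≉0 : ¬ (1ᴬ ≈ 0ᴬ)
  1≉0 (coeffs-≈ e) = F.1≉0 (e 0)

  HasDegree-unique : ∀ {d e f g} → f ≈ g → HasDegree d f → HasDegree e g → d ≡ e
  HasDegree-unique {d} {e} (coeffs-≈ eq) hf hg with ℕ.<-cmp d e
  ... | tri< d<e _ _ = contradiction (F.trans (F.sym (eq e)) (HasDegree.bounded hf e d<e)) (HasDegree.leading hg)
  ... | tri≈ _ d≡e _ = d≡e
  ... | tri> _ _ e<d = contradiction (F.trans (eq d) (HasDegree.bounded hg d e<d)) (HasDegree.leading hf)

  *-cancelˡ : ∀ f {g h} → ¬ (f ≈ 0ᴬ) → f * g ≈ f * h → g ≈ h
  *-cancelˡ f {g} {h} f≉0 eq with (g + (- h)) ≟0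
  ... | yes g-h≈0 = GroupProperties.x∙y⁻¹≈ε⇒x≈y (CommutativeRing.+-group polynomialRing) g h g-h≈0
  ... | no  g-h≉0 = contradiction
    (trans (RingProperties.x[y-z]≈xy-xz (CommutativeRing.ring polynomialRing) f g h)
      (GroupProperties.x≈y⇒x∙y⁻¹≈ε (CommutativeRing.+-group polynomialRing) eq))
    (*-≉0 f≉0 g-h≉0)

  private
    module AS = CommutativeRingSolver polynomialRing

  open SemiringDivisibility (CommutativeRing.semiring polynomialRing) public using (_∣_; _,_)

  record DivMod (d : ℕ) (f g : Poly) : Set (c ⊔ ℓ) where
    field
      quo rem   : Poly
      division  : f ≈ quo * g + rem
      rem-bound : DegreeBelow d rem

  divMod : ∀ {d} f g → HasDegree d g → DivMod d f g
  divMod []      g h = record { quo = [] ; rem = [] ; division = sym (trans (+-identityʳ ([] * g)) (≈0⇒*≈0 g refl)) ; rem-bound = λ _ _ → F.refl }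
  divMod {d} (a ∷ f) g h with divMod f g h | F.invertible (coeff g d) (HasDegree.leading h)
  ... | record { quo = q₀ ; rem = r₀ ; division = f≈q₀g+r₀ ; rem-bound = r₀-bound } | (lc⁻¹ , lc⁻¹lc≈1) = record
    { quo       = t ∷ q₀
    ; rem       = s + (- (t ⋆ g))
    ; division  = begin
        (a ∷ f)                                             ≈⟨ ∷-cong (F.sym (F.+-identityˡ a)) f≈q₀g+r₀ ⟩
        ((0# F.+ a) ∷ (q₀ * g + r₀))                        ≈⟨ ∷-+-∷ 0# a (q₀ * g) r₀ ⟨
        (0# ∷ q₀ * g) + s                                   ≈⟨ AS.solve 3 (λ x y z → x AS.:+ y AS.:= (z AS.:+ x) AS.:+ (y AS.:- z)) refl (0# ∷ q₀ * g) s (t ⋆ g) ⟩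
        (t ⋆ g + (0# ∷ q₀ * g)) + (s + (- (t ⋆ g)))         ≈⟨ +-cong (*-∷ˡ t q₀ g) refl ⟨
        (t ∷ q₀) * g + (s + (- (t ⋆ g)))                    ∎
    ; rem-bound = bound
    }
    where
    open SetoidReasoning polySetoid
    s : Poly
    s = a ∷ r₀
    t : 𝔽
    t = coeff s d F.* lc⁻¹
    s-bound : DegreeBelow (suc d) s
    s-bound (suc m) (s≤s le) = r₀-bound m le
    coeff-rem : ∀ m → coeff (s + (- (t ⋆ g))) m F.≈ coeff s m F.- t F.* coeff g m
    coeff-rem m = F.trans (coeff-+ s (- (t ⋆ g)) m) (F.+-congˡ (F.trans (coeff-neg (t ⋆ g) m) (F.-‿cong (coeff-⋆ t g m))))
    bound : DegreeBelow d (s + (- (t ⋆ g)))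
    bound m le with ℕ.m≤n⇒m<n∨m≡n le
    ... | inj₁ d<m = F.trans (coeff-rem m) (F.trans
      (F.+-cong (s-bound m d<m) (F.-‿cong (F.*-congˡ (HasDegree.bounded h m d<m))))
      (FS.solve 1 (λ t → :0 :- t :* :0 := :0) F.refl t))
    ... | inj₂ ≡.refl = F.trans (coeff-rem d) (F.trans
      (FS.solve 3 (λ x y z → x :- x :* y :* z := x :* (:1 :- y :* z)) F.refl (coeff s d) lc⁻¹ (coeff g d))
      (F.trans (F.*-congˡ (F.+-congˡ (F.-‿cong lc⁻¹lc≈1))) (FS.solve 1 (λ x → x :* (:1 :- :1) := :0) F.refl (coeff s d))))

  open Comaximality polynomialRing public

  bézout : ∀ f g → Bézout f g
  bézout f g = go (length g) f g (DegreeBelow-length g)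
    where
    stop : ∀ f g → g ≈ 0ᴬ → Bézout f g
    stop f g g≈0 = record
      { gcd = f ; x = 1ᴬ ; y = 0ᴬ
      ; identity = AS.solve 2 (λ f g → AS.:1 AS.:* f AS.:+ AS.:0 AS.:* g AS.:= f) refl f g
      ; gcd∣f = 1ᴬ , *-identityˡ f
      ; gcd∣g = 0ᴬ , trans (≈0⇒*≈0 f refl) (sym g≈0)
      }
    step : ∀ {d} f g → (h : HasDegree d g) → Bézout g (DivMod.rem (divMod f g h)) → Bézout f g
    step f g h record { gcd = e ; x = x ; y = y ; identity = xg+yr≈e ; gcd∣f = (s , se≈g) ; gcd∣g = (t , te≈r) } = record
      { gcd = e ; x = y ; y = x + (- (y * quo))
      ; identity = trans (+-cong (*-congˡ y division) refl)
          (trans (AS.solve 5 (λ x y q r g → y AS.:* (q AS.:* g AS.:+ r) AS.:+ (x AS.:- y AS.:* q) AS.:* g AS.:= x AS.:* g AS.:+ y AS.:* r) refl x y quo rem g) xg+yr≈e)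
      ; gcd∣f = quo * s + t , trans (AS.solve 4 (λ q s t e → (q AS.:* s AS.:+ t) AS.:* e AS.:= q AS.:* (s AS.:* e) AS.:+ t AS.:* e) refl quo s t e)
          (trans (+-cong (*-congˡ quo se≈g) te≈r) (sym division))
      ; gcd∣g = s , se≈g
      }
      where open DivMod (divMod f g h)
    go : ∀ n f g → DegreeBelow n g → Bézout f g
    go zero    f g b = stop f g (DegreeBelow-0 b)
    go (suc n) f g b with degree? g
    ... | inj₁ g≈0     = stop f g g≈0
    ... | inj₂ (d , h) = step f g h (go n g _ λ m n≤m → DivMod.rem-bound (divMod f g h) m (ℕ.≤-trans d≤n n≤m))
      where
      d≤n : d ≤ n
      d≤n = ℕ.≮⇒≥ λ n<d → HasDegree.leading h (b d n<d)

  HasDegree-∣1 : ∀ {d f} → f ∣ 1ᴬ → HasDegree d f → d ≡ 0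
  HasDegree-∣1 {d} {f} (s , sf≈1) h with degree? s
  ... | inj₁ s≈0      = contradiction (trans (sym sf≈1) (≈0⇒*≈0 f s≈0)) 1≉0
  ... | inj₂ (e , h′) = ℕ.m+n≡0⇒n≡0 e (HasDegree-unique sf≈1 (*-HasDegree h′ h) 1-degree)
    where
    1-degree : HasDegree 0 1ᴬ
    1-degree = record { leading = F.1≉0 ; bounded = λ { (suc m) _ → F.refl } }

  degree0⇒∣1 : ∀ {f} → HasDegree 0 f → f ∣ 1ᴬ
  degree0⇒∣1 {f} h with F.invertible (coeff f 0) (HasDegree.leading h)
  ... | (t , t*f₀≈1) = (t ∷ []) , coeffs-≈ λ
    { zero    → F.trans (coeff-t*f 0) t*f₀≈1
    ; (suc n) → F.trans (coeff-t*f (suc n)) (F.trans (F.*-congˡ (HasDegree.bounded h (suc n) (s≤s z≤n))) (F.zeroʳ t)) }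
    where
    coeff-t*f : ∀ n → coeff ((t ∷ []) * f) n F.≈ t F.* coeff f n
    coeff-t*f n = F.trans (coeff-≈ (trans (*-∷ˡ t [] f) (trans (+-cong (refl {t ⋆ f}) (trans (∷-cong F.refl (≈0⇒*≈0 f refl)) 0∷0))
      (+-identityʳ (t ⋆ f)))) n) (coeff-⋆ t f n)

  _∣1? : ∀ f → Dec (f ∣ 1ᴬ)
  f ∣1? with degree? f
  ... | inj₁ f≈0         = no λ { (s , sf≈1) → 1≉0 (trans (sym sf≈1) (trans (*-congˡ s f≈0) (trans (*-comm s []) (≈0⇒*≈0 s refl)))) }
  ... | inj₂ (zero , h)  = yes (degree0⇒∣1 h)
  ... | inj₂ (suc d , h) = no λ f∣1 → contradiction (HasDegree-∣1 f∣1 h) λ ()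

module Ideals {c ℓ q} (F : FiniteField c ℓ q) where
  open Polynomials F
  private
    module F = FiniteField F
    module A = CommutativeRing polynomialRing

  record Monic (d : ℕ) : Set (c ⊔ ℓ) where
    constructor monic
    field
      poly    : Poly
      isMonic : IsMonic d poly

  open Monic public

  monic≉0 : ∀ {d} (f : Monic d) → ¬ (poly f ≈ 0ᴬ)
  monic≉0 f = HasDegree⇒≉0 (IsMonic⇒HasDegree (isMonic f))

  -- A non-zero ideal of the principal ideal domain A, given by its unique
  -- monic generator; its degree is the degree of the generator.
  record Ideal : Set (c ⊔ ℓ) where
    constructor ⟨_⟩
    field
      {degree}  : ℕ
      generator : Monic degree

    gen : Poly
    gen = poly generator

  open Ideal public

  infix 4 _∣ᴵ_

  elementsOf : Ideal → Pred Poly (c ⊔ ℓ)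
  elementsOf 𝔫 = ⟪ gen 𝔫 ⟫

  _∣ᴵ_ : Ideal → Ideal → Set (c ⊔ ℓ)
  𝔮 ∣ᴵ 𝔫 = elementsOf 𝔫 ⊆ elementsOf 𝔮

  IsPrimeIdeal : Ideal → Set (c ⊔ ℓ)
  IsPrimeIdeal 𝔮 = SemiringPrimality.Prime A.semiring (gen 𝔮)

  comaximal? : ∀ a b → Dec (Comaximal a b)
  comaximal? a b = Dec.map′ (gcd∣1⇒comaximal β) (comaximal⇒gcd∣1 β) (Bézout.gcd β ∣1?)
    where
    β : Bézout a b
    β = bézout a b

  tuples : (d : ℕ) → List (Vec F.Carrier d)
  tuples zero    = [] ∷ []
  tuples (suc d) = concatMap (λ a → map (a ∷_) (tuples d)) F.elements

  -- All polynomials of degree less than d, each exactly once up to _≈_.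
  polysBelow : ℕ → List Poly
  polysBelow d = map Vec.toList (tuples d)

  monicPoly : ∀ {d} → Vec F.Carrier d → Poly
  monicPoly []       = 1ᴬ
  monicPoly (a ∷ as) = a ∷ monicPoly as

  monicPoly-isMonic : ∀ {d} (as : Vec F.Carrier d) → IsMonic d (monicPoly as)
  monicPoly-isMonic []       = record { leading≈1 = F.refl ; bounded = λ { (suc m) _ → F.refl } }
  monicPoly-isMonic (a ∷ as) = record
    { leading≈1 = IsMonic.leading≈1 (monicPoly-isMonic as)
    ; bounded   = λ { (suc m) (s≤s le) → IsMonic.bounded (monicPoly-isMonic as) m le }
    }

  monics : (d : ℕ) → List (Monic d)
  monics d = map (λ as → monic (monicPoly as) (monicPoly-isMonic as)) (tuples d)

  -- A₊ in degrees at most n; each element occurs exactly once up to _≈_ in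
  -- the list monics≤ n.
  Monic≤ : ℕ → Set (c ⊔ ℓ)
  Monic≤ n = Σ[ d ∈ Fin (suc n) ] Monic (Fin.toℕ d)

  monics≤ : (n : ℕ) → List (Monic≤ n)
  monics≤ n = concatMap (λ d → map (d ,_) (monics (Fin.toℕ d))) (allFin (suc n))

  comaximal-linear : (v : Monic≤ 1) (w : Monic 1) → ¬ (poly (proj₂ v) ≈ poly w) → Comaximal (poly w) (poly (proj₂ v))
  comaximal-linear (Fin.zero , monic v v-monic) (monic w _) _ = unit-comaximal v≈1
    where
    v≈1 : v ≈ 1ᴬ
    v≈1 = coeffs-≈ λ { zero → IsMonic.leading≈1 v-monic ; (suc n) → IsMonic.bounded v-monic (suc n) (s≤s z≤n) }
  comaximal-linear (Fin.suc Fin.zero , monic v v-monic) (monic w w-monic) v≉w with degree? (v + (- w))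
  ... | inj₁ v-w≈0 = contradiction (GroupProperties.x∙y⁻¹≈ε⇒x≈y A.+-group v w v-w≈0) v≉w
  ... | inj₂ (zero , h) = comaximal-difference v w (degree0⇒∣1 h)
  comaximal-linear (Fin.suc Fin.zero , monic v v-monic) (monic w w-monic) v≉w | inj₂ (suc d , h) =
    contradiction (F.trans (coeff-+ v (- w) (suc d)) (F.trans (F.+-congˡ (coeff-neg w (suc d))) (zero-coeff d))) (HasDegree.leading h)
    where
    zero-coeff : ∀ d → coeff v (suc d) F.- coeff w (suc d) F.≈ F.0#
    zero-coeff zero    = F.trans (F.+-cong (IsMonic.leading≈1 v-monic) (F.-‿cong (IsMonic.leading≈1 w-monic))) (F.-‿inverseʳ _)
    zero-coeff (suc d) = F.trans (F.+-cong (IsMonic.bounded v-monic _ (s≤s (s≤s z≤n))) (F.-‿cong (IsMonic.bounded w-monic _ (s≤s (s≤s z≤n))))) (F.-‿inverseʳ _)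

  split : ∀ u v → ¬ (v ≈ 0ᴬ) → Split u v
  split u v v≉0 = go (length v) u v v≉0 (DegreeBelow-length v)
    where
    go : ∀ b u v → ¬ (v ≈ 0ᴬ) → DegreeBelow b v → Split u v
    go zero    u v v≉0 v-below = contradiction (coeffs-≈ λ n → v-below n z≤n) v≉0
    go (suc b) u v v≉0 v-below with bézout u v
    ... | β with Bézout.gcd∣g β | degree? (Bézout.gcd β)
    ...   | (t , tg≈v) | inj₁ g≈0       = contradiction (A.trans (A.sym tg≈v) (A.trans (A.*-congˡ {t} g≈0) (A.zeroʳ t))) v≉0
    ...   | (t , tg≈v) | inj₂ (zero , h) = split-coprime (gcd∣1⇒comaximal β (degree0⇒∣1 h))
    ...   | (t , tg≈v) | inj₂ (suc e , h) = split-factor (Bézout.gcd∣f β) tg≈v (go b u t t≉0 t-below)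
      where
      g : Poly
      g = Bézout.gcd β
      t≉0 : ¬ (t ≈ 0ᴬ)
      t≉0 t≈0 = v≉0 (A.trans (A.sym tg≈v) (A.trans (A.*-congʳ {g} t≈0) (A.zeroˡ g)))
      t-below : DegreeBelow b t
      t-below with degree? t
      ... | inj₁ (coeffs-≈ t≈0) = λ m _ → t≈0 m
      ... | inj₂ (d , h′) = λ m b≤m → HasDegree.bounded h′ m (ℕ.≤-trans d<b b≤m)
        where
        d<b : d < b
        d<b = ℕ.≰⇒> λ b≤d → HasDegree.leading (*-HasDegree h′ h) (F.trans (coeff-≈ tg≈v _)
          (v-below _ (ℕ.≤-trans (s≤s (ℕ.≤-trans b≤d (ℕ.m≤m+n d e))) (ℕ.≤-reflexive (≡.sym (ℕ.+-suc d e))))))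

  lift : ∀ (𝔫 : Ideal) u v → Universal (⟪ u ⟫ ⊞ ⟪ v ⟫ ⊞ elementsOf 𝔫) →
         ∃[ s ] ∃[ t ] Comaximal (u + s * gen 𝔫) (v + t * gen 𝔫)
  lift 𝔫 u v = lift-comaximal _≟0 split u v (gen 𝔫) (monic≉0 (generator 𝔫))

module ModularSymbols {c ℓ q} (F : FiniteField c ℓ q) (𝔫 : Ideals.Ideal F) (p : ℕ) where
  open Polynomials F
  open Ideals F
  private
    module A = CommutativeRing polynomialRing
    module R = BottomRow polynomialRing

  A-isIntegralDomain : IsIntegralDomain polynomialRing
  A-isIntegralDomain = record { 1≉0 = 1≉0 ; *-≉0 = *-≉0 ; *-cancelˡ = *-cancelˡ }

  open CongruenceSubgroup polynomialRing A-isIntegralDomain (gen 𝔫) public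
  module GL₂A = Matrices polynomialRing

  open GL₂A using (GL₂; a₂₁; a₂₂; matrix)

  open Divisors ℙ¹-setoid public using (_⟶_)

  Div⁰ℙ¹ Div⁰Orbits : AbelianGroup (c ⊔ ℓ) (c ⊔ ℓ)
  Div⁰ℙ¹     = Divisors.divisor⁰Group ℙ¹-setoid
  Div⁰Orbits = Divisors.divisor⁰Group orbits

  act : GL₂K.GL₂ → AbelianGroup.Carrier Div⁰ℙ¹ → AbelianGroup.Carrier Div⁰ℙ¹
  act g = pushforward⁰ {X = ℙ¹-setoid} {Y = ℙ¹-setoid} (g ·_)

  ΓDifference : Pred (AbelianGroup.Carrier Div⁰ℙ¹) (c ⊔ ℓ)
  ΓDifference z = ∃[ γ ] ∃[ D ] z ≈ᴰ act (actsAs γ) D - D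
    where open AbelianGroup Div⁰ℙ¹ using (_-_) renaming (_≈_ to _≈ᴰ_)

  𝕄 𝕄/p Div⁰Orbits/p : AbelianGroup (c ⊔ ℓ) (c ⊔ ℓ)
  𝕄            = Div⁰ℙ¹ /⟨ ΓDifference ⟩
  𝕄/p          = 𝕄 /ℕ p
  Div⁰Orbits/p = Div⁰Orbits /ℕ p

  -- The boundary map tensored with 𝔽_p. A point and its orbit have the same
  -- underlying representative, so on divisors this is the identity.
  ∂ : AbelianGroup.Carrier 𝕄/p → AbelianGroup.Carrier Div⁰Orbits/p
  ∂ = pushforward⁰ {X = ℙ¹-setoid} {Y = orbits} id

  IsCuspidal : AbelianGroup.Carrier 𝕄/p → Set (c ⊔ ℓ)
  IsCuspidal m = ∂ m ≈₀ 0#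
    where open AbelianGroup Div⁰Orbits/p using () renaming (_≈_ to _≈₀_; ε to 0#)

  HeckePair : Ideal → Set (c ⊔ ℓ)
  HeckePair 𝔭 = Monic≤ (degree 𝔭) × Monic≤ (degree 𝔭)

  IsHeckePair : ∀ 𝔭 → Pred (HeckePair 𝔭) (c ⊔ ℓ)
  IsHeckePair 𝔭 ((_ , a) , (_ , d)) = (poly a * poly d ≈ gen 𝔭) × Comaximal (poly a) (gen 𝔫)

  isHeckePair? : ∀ 𝔭 → Decidable (IsHeckePair 𝔭)
  isHeckePair? 𝔭 ((_ , a) , (_ , d)) = ((poly a * poly d) ≟ gen 𝔭) ×-dec comaximal? (poly a) (gen 𝔫)

  heckePairs : ∀ 𝔭 → List (HeckePair 𝔭)
  heckePairs 𝔭 = filter (isHeckePair? 𝔭) (cartesianProduct (monics≤ (degree 𝔭)) (monics≤ (degree 𝔭)))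

  heckeMatrix : ∀ {m n} → Monic m → Monic n → Poly → GL₂K.GL₂
  heckeMatrix a d b = upperTriangular (poly a) b (poly d) (monic≉0 a) (monic≉0 d)

  S : Ideal → List GL₂K.GL₂
  S 𝔭 = concatMap (λ ((_ , a) , (deg-d , d)) → map (heckeMatrix a d) (polysBelow (Fin.toℕ deg-d))) (heckePairs 𝔭)

  -- T_𝔭 [r, s] = Σ_g [g r, g s], extended linearly: the formula is applied to
  -- the degree-0 divisor representing m.
  T : Ideal → AbelianGroup.Carrier 𝕄/p → AbelianGroup.Carrier 𝕄/p
  T 𝔭 m = ∑[ g ∈ S 𝔭 ] act g m in[ 𝕄/p ]

  infix 4 _∼_

  record ℙ¹A/𝔫 : Set (c ⊔ ℓ) where
    constructor _∶_[_]
    field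
      U V   : Poly
      whole : Universal (⟪ U ⟫ ⊞ ⟪ V ⟫ ⊞ elementsOf 𝔫)

  open ℙ¹A/𝔫 public

  _≡_mod𝔫 : Poly → Poly → Set (c ⊔ ℓ)
  f ≡ g mod𝔫 = elementsOf 𝔫 (f A.- g)

  record _∼_ (x y : ℙ¹A/𝔫) : Set (c ⊔ ℓ) where
    field
      w       : Poly
      w-unit  : Universal (⟪ w ⟫ ⊞ elementsOf 𝔫)
      U-cong  : U y ≡ w * U x mod𝔫
      V-cong  : V y ≡ w * V x mod𝔫

  bottomRow : GL₂ → ℙ¹A/𝔫
  bottomRow g = a₂₁ (matrix g) ∶ a₂₂ (matrix g) [ R.bottomRow-whole g (gen 𝔫) ]

  -- Γ₀(n)\GL₂(A) → ℙ¹(A/n) is surjective.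
  representative : (x : ℙ¹A/𝔫) → Σ[ g ∈ GL₂ ] bottomRow g ∼ x
  representative (u ∶ v [ uv-whole ]) = represent (lift 𝔫 u v uv-whole)
    where
    congruent-row : ∀ {s t} → Σ[ g ∈ GL₂ ] (a₂₁ (matrix g) ≡ u + s * gen 𝔫 × a₂₂ (matrix g) ≡ v + t * gen 𝔫) →
                    Σ[ g ∈ GL₂ ] bottomRow g ∼ (u ∶ v [ uv-whole ])
    congruent-row {s} {t} (g , U≡ , V≡) = g , record
      { w = 1ᴬ
      ; w-unit = R.1-comaximal (gen 𝔫)
      ; U-cong = ≡.subst (λ f → u ≡ 1ᴬ * f mod𝔫) (≡.sym U≡) (R.shift-congruent u s (gen 𝔫))
      ; V-cong = ≡.subst (λ f → v ≡ 1ᴬ * f mod𝔫) (≡.sym V≡) (R.shift-congruent v t (gen 𝔫))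
      }
    represent : (∃[ s ] ∃[ t ] Comaximal (u + s * gen 𝔫) (v + t * gen 𝔫)) → Σ[ g ∈ GL₂ ] bottomRow g ∼ (u ∶ v [ uv-whole ])
    represent (_ , _ , cm) = congruent-row (R.completeRow cm)

  -- ξ(u : v) = [g(0), g(∞)], and x(u : v) is its image modulo p.
  ξ : ℙ¹A/𝔫 → AbelianGroup.Carrier 𝕄
  ξ uv = (ιᴳ g · 𝟎) ⟶ (ιᴳ g · ∞)
    where
    g : GL₂
    g = proj₁ (representative uv)

  x : ℙ¹A/𝔫 → AbelianGroup.Carrier 𝕄/p
  x = ξ

  ideals≤ : ℕ → List Ideal
  ideals≤ n = map (λ (_ , f) → ⟨ f ⟩) (monics≤ n)

  [_∶1] : Poly → ℙ¹A/𝔫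
  [ u ∶1] = u ∶ 1ᴬ [ comaximal⇒whole₃ (gen 𝔫) (unit-comaximal A.refl) ]

  record Admissible (u P : Monic 1) : Set (c ⊔ ℓ) where
    field
      v   : Monic≤ 1
      v≢u : ¬ (poly (proj₂ v) ≈ poly u)
      v≢P : ¬ (poly (proj₂ v) ≈ poly P)

  admissible? : (u P : Monic 1) → Monic≤ 1 → Maybe (Admissible u P)
  admissible? u P v with poly (proj₂ v) ≟ poly u | poly (proj₂ v) ≟ poly P
  ... | no v≢u | no v≢P = just record { v = v ; v≢u = v≢u ; v≢P = v≢P }
  ... | no v≢u | yes _  = nothing
  ... | yes _  | _      = nothing

  admissible : (u P : Monic 1) → List (Admissible u P)
  admissible u P = mapMaybe (admissible? u P) (monics≤ 1)

  [Pu∶v] : {u P : Monic 1} → Admissible u P → ℙ¹A/𝔫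
  [Pu∶v] {u} {P} a = (poly P * poly u) ∶ poly (proj₂ v)
    [ comaximal⇒whole₃ (gen 𝔫) (comaximal-* (comaximal-linear v P v≢P) (comaximal-linear v u v≢u)) ]
    where open Admissible a

{-# OPTIONS --safe #-}
module Submission where

-- Write {r} for the symbol [∞, r]; it is unchanged by r ↦ αr + b with α ∈ 𝔽_q^× and b ∈ A, and [r, s] = {s} − {r}.
-- Put W_v = {1/v}, Z = {0} and E(P, v) = {(P + u − v)/(Pu)}. Then x(u : 1) = W_u − Z, x(Pu : v) = E(P, v) − W_v for
-- linear v ≠ u, P, and this difference is 0 for v = u and v = P. On the other side T_P x(u : 1) is the sum of
-- {P/u} − Z from (P 0; 0 1), x(Pu : 1) from (1 0; 0 P), and E(P, v) − W_P from (1 b; 0 P) with b = 1/(P − v).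
-- Since q = 0 in 𝔽_p, sums over 𝔽_q of terms not depending on the index vanish: this removes the W_v and W_P, and
-- also x(u : 1) + ∑_P ({P/u} − Z), which is q (W_u − Z) because only the term P = u is zero.

open import Defs
open import Algebra.Bundles using (AbelianGroup; CommutativeRing)
import Algebra.Properties.AbelianGroup as AbelianGroupProperties
import Algebra.Properties.CommutativeSemigroup as CommutativeSemigroupProperties
import Algebra.Properties.Group as GroupProperties
import Algebra.Properties.Monoid.Mult as MonoidMult
import Algebra.Properties.Semiring.Divisibility as SemiringDivisibility
import Algebra.Properties.Semiring.Primality as SemiringPrimality
open import Data.Bool.Base using (true; false; if_then_else_)
open import Data.Fin.Base as Fin using (Fin)
import Data.Fin.Properties as Fin
open import Data.List.Base using (List; []; _∷_; _++_; map; concatMap; filter; mapMaybe; allFin; cartesianProduct; length; tabulate)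
import Data.List.Properties as List
import Data.List.Relation.Binary.Permutation.Setoid as Permutation
open import Data.Maybe.Base using (Maybe; just; nothing; maybe)
open import Data.Nat.Base as ℕ using (ℕ; zero; suc; _≤_; _^_; z≤n; s≤s)
import Data.Nat.Properties as ℕ
open import Data.Nat.Primality using (Prime)
open import Data.Product.Base using (_×_; _,_; proj₁; proj₂; Σ-syntax; ∃-syntax)
open import Data.Sum.Base using (_⊎_; inj₁; inj₂)
open import Data.Vec.Base as Vec using ([]; _∷_)
open import Function.Base using (_∘_; id)
open import Function.Bundles using (Inverse)
open import Level using (_⊔_)
open import Relation.Binary.Bundles using (Setoid)
open import Relation.Binary.PropositionalEquality as ≡ using (_≡_; _≢_)
import Relation.Binary.Reasoning.Setoid as SetoidReasoning
open import Relation.Binary.Structures using (IsEquivalence)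
open import Relation.Nullary using (¬_; Dec; yes; no; does; contradiction)
open import Relation.Unary using (Pred; Decidable)

-- The symbol {r} is invariant because (α b; 0 1) lies in Γ₀(𝔫) and fixes ∞. Hence {P/u} = {(P -
-- u)/u + 1} = {1/u} for P ≠ u, while {u/u} = {1} = {0}. The obstacle is the choice of
-- representative: T_𝔭 is applied to the divisor of [g(0), g(∞)] for one particular g found by
-- Bézout, whereas the computation above uses g = (1 0; u 1). The chosen g equals (1 b; 0 1)(1 0; m
-- 1)(1 0; u 1) with m ∈ 𝔫, so it suffices that T_P does not change when its argument is moved by an
-- upper unipotent matrix, or by a lower unipotent one with entry in 𝔫. The former translate b. The
-- latter become translations of t = 1/b once the diagonal matrix is placed at t = 0 and b = 0 at t
-- = ∞. The same t, read as P - v, later matches cosets with the symbols x(Pu : v). The hypothesis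
-- on 𝔫 says that no linear P divides it. So the diagonal matrix belongs to S_P, a factor P can be
-- cancelled modulo 𝔫, and u is invertible modulo 𝔫, which makes the cusps 0 and 1/u equivalent.

-- Finite sums in an abelian group.

module Sums {a ℓ} (G : AbelianGroup a ℓ) where
  open AbelianGroup G
  open AbelianGroups G using (∑)
  open AbelianGroupProperties G using (⁻¹-∙-comm; ε⁻¹≈ε)
  open CommutativeSemigroupProperties commutativeSemigroup using (interchange)
  open MonoidMult monoid using () renaming (_×_ to _·ℕ_)
  open SetoidReasoning setoid

  if-yes : ∀ {p} {P : Set p} (P? : Dec P) x y → P → (if does P? then x else y) ≈ x
  if-yes (yes _) x y p = refl
  if-yes (no ¬p) x y p = contradiction p ¬p

  if-no : ∀ {p} {P : Set p} (P? : Dec P) x y → ¬ P → (if does P? then x else y) ≈ y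
  if-no (yes p) x y ¬p = contradiction p ¬p
  if-no (no _)  x y ¬p = refl

  module _ {i} {I : Set i} where

    ∑-cong : ∀ (is : List I) {f g} → (∀ j → f j ≈ g j) → ∑ is f ≈ ∑ is g
    ∑-cong []       e = refl
    ∑-cong (j ∷ is) e = ∙-cong (e j) (∑-cong is e)

    ∑-ε : ∀ (is : List I) {f} → (∀ j → f j ≈ ε) → ∑ is f ≈ ε
    ∑-ε []       e = refl
    ∑-ε (j ∷ is) e = trans (∙-cong (e j) (∑-ε is e)) (identityˡ ε)

    ∑-++ : ∀ (is js : List I) f → ∑ (is ++ js) f ≈ ∑ is f ∙ ∑ js f
    ∑-++ []       js f = sym (identityˡ _)
    ∑-++ (i ∷ is) js f = trans (∙-congˡ (∑-++ is js f)) (sym (assoc _ _ _))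

    ∑-∙ : ∀ (is : List I) f g → ∑ is (λ j → f j ∙ g j) ≈ ∑ is f ∙ ∑ is g
    ∑-∙ []       f g = sym (identityˡ ε)
    ∑-∙ (i ∷ is) f g = trans (∙-congˡ (∑-∙ is f g)) (interchange _ _ _ _)

    ∑-⁻¹ : ∀ (is : List I) f → ∑ is (λ j → f j ⁻¹) ≈ ∑ is f ⁻¹
    ∑-⁻¹ []       f = sym ε⁻¹≈ε
    ∑-⁻¹ (i ∷ is) f = trans (∙-congˡ (∑-⁻¹ is f)) (⁻¹-∙-comm _ _)

    ∑-const : ∀ (is : List I) x → ∑ is (λ _ → x) ≈ length is ·ℕ x
    ∑-const []       x = refl
    ∑-const (_ ∷ is) x = ∙-congˡ (∑-const is x)

    ∑-filter : ∀ {ℓ′} {P : Pred I ℓ′} (P? : Decidable P) is f →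
               ∑ (filter P? is) f ≈ ∑ is (λ j → if does (P? j) then f j else ε)
    ∑-filter P? []       f = refl
    ∑-filter P? (i ∷ is) f with does (P? i)
    ... | true  = ∙-congˡ (∑-filter P? is f)
    ... | false = trans (∑-filter P? is f) (sym (identityˡ _))

  module _ {i j} {I : Set i} {J : Set j} where

    ∑-map : ∀ (h : I → J) is f → ∑ (map h is) f ≈ ∑ is (f ∘ h)
    ∑-map h []       f = refl
    ∑-map h (i ∷ is) f = ∙-congˡ (∑-map h is f)

    ∑-concatMap : ∀ (h : I → List J) is f → ∑ (concatMap h is) f ≈ ∑ is (λ i → ∑ (h i) f)
    ∑-concatMap h []       f = refl
    ∑-concatMap h (i ∷ is) f = trans (∑-++ (h i) (concatMap h is) f) (∙-congˡ (∑-concatMap h is f))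

    ∑-mapMaybe : ∀ (h : I → Maybe J) is f → ∑ (mapMaybe h is) f ≈ ∑ is (λ i → maybe f ε (h i))
    ∑-mapMaybe h []       f = refl
    ∑-mapMaybe h (i ∷ is) f with h i
    ... | just _  = ∙-congˡ (∑-mapMaybe h is f)
    ... | nothing = trans (∑-mapMaybe h is f) (sym (identityˡ _))

    ∑-swap : ∀ (is : List I) (js : List J) (f : I → J → Carrier) → ∑ is (λ i → ∑ js (f i)) ≈ ∑ js (λ j → ∑ is (λ i → f i j))
    ∑-swap []       js f = sym (∑-ε js (λ _ → refl))
    ∑-swap (i ∷ is) js f = trans (∙-congˡ (∑-swap is js f)) (sym (∑-∙ js (f i) _))

  ∑-cartesianProduct : ∀ {i j} {I : Set i} {J : Set j} (is : List I) (js : List J) f → ∑ (cartesianProduct is js) f ≈ ∑ is (λ i → ∑ js (λ j → f (i , j)))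
  ∑-cartesianProduct []       js f = refl
  ∑-cartesianProduct (i ∷ is) js f = trans (∑-++ (map (i ,_) js) _ f) (∙-cong (∑-map (i ,_) js f) (∑-cartesianProduct is js f))

  ∑-concatMap-filter-cartesianProduct : ∀ {i j k ℓ′} {I : Set i} {J : Set j} {K : Set k} {P : Pred (I × J) ℓ′} (P? : Decidable P)
    (h : I × J → List K) is js f → ∑ (concatMap h (filter P? (cartesianProduct is js))) f ≈
    ∑ is (λ i → ∑ js (λ j → if does (P? (i , j)) then ∑ (h (i , j)) f else ε))
  ∑-concatMap-filter-cartesianProduct P? h is js f = begin
    ∑ (concatMap h (filter P? (cartesianProduct is js))) f
      ≈⟨ ∑-concatMap h (filter P? (cartesianProduct is js)) f ⟩
    ∑ (filter P? (cartesianProduct is js)) (λ k → ∑ (h k) f)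
      ≈⟨ ∑-filter P? (cartesianProduct is js) _ ⟩
    ∑ (cartesianProduct is js) (λ k → if does (P? k) then ∑ (h k) f else ε)
      ≈⟨ ∑-cartesianProduct is js _ ⟩
    ∑ is (λ i → ∑ js (λ j → if does (P? (i , j)) then ∑ (h (i , j)) f else ε)) ∎

  ∑-single : ∀ {n} (j : Fin n) {f} → (∀ i → i ≢ j → f i ≈ ε) → ∑ (allFin n) f ≈ f j
  ∑-single {suc n} j {f} vanish = trans (∙-congˡ tail) (split j vanish)
    where
    tail : ∑ (tabulate Fin.suc) f ≈ ∑ (allFin n) (f ∘ Fin.suc)
    tail = trans (reflexive (≡.cong (λ is → ∑ is f) (≡.sym (List.map-tabulate id Fin.suc)))) (∑-map Fin.suc (allFin n) f)
    split : ∀ j → (∀ i → i ≢ j → f i ≈ ε) → f Fin.zero ∙ ∑ (allFin n) (f ∘ Fin.suc) ≈ f j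
    split Fin.zero    v = trans (∙-congˡ (∑-ε (allFin n) λ i → v (Fin.suc i) λ ())) (identityʳ _)
    split (Fin.suc j) v = trans (∙-cong (v Fin.zero λ ()) (∑-single j λ i i≢j → v (Fin.suc i) (i≢j ∘ Fin.suc-injective))) (identityˡ _)

-- `p ·ℕ (n ·ℕ z)` is one of the generators divided out. The multiple has the form `p * n` because q
-- = p · p^(k - 1) will be used in that form.
/ℕ-multiple≈ε : ∀ {a ℓ} (G : AbelianGroup a ℓ) p n z →
  AbelianGroup._≈_ (G /ℕ p) (MonoidMult._×_ (AbelianGroup.monoid (G /ℕ p)) (p ℕ.* n) z) (AbelianGroup.ε (G /ℕ p))
/ℕ-multiple≈ε G p n z = AbelianGroups.congruent (AbelianGroups.gen (n ·ℕ z , (begin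
  MonoidMult._×_ (AbelianGroup.monoid (G /ℕ p)) (p ℕ.* n) z ∙ ε ⁻¹  ≡⟨ ≡.cong (_∙ (ε ⁻¹)) (×-quotient (p ℕ.* n)) ⟩
  (p ℕ.* n) ·ℕ z ∙ ε ⁻¹                                             ≈⟨ ∙-congˡ ε⁻¹≈ε ⟩
  (p ℕ.* n) ·ℕ z ∙ ε                                                ≈⟨ identityʳ _ ⟩
  (p ℕ.* n) ·ℕ z                                                    ≈⟨ ×-assocˡ z p n ⟨
  p ·ℕ (n ·ℕ z)                                                     ∎)))
  where
  open AbelianGroup G
  open MonoidMult monoid using (×-assocˡ) renaming (_×_ to _·ℕ_)
  open AbelianGroupProperties G using (ε⁻¹≈ε)
  open SetoidReasoning setoid
  ×-quotient : ∀ m → MonoidMult._×_ (AbelianGroup.monoid (G /ℕ p)) m z ≡ m ·ℕ z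
  ×-quotient zero    = ≡.refl
  ×-quotient (suc m) = ≡.cong (z ∙_) (×-quotient m)

-- Sums indexed by the finite field.

module FieldSums {c ℓ q a ℓ′} (F : FiniteField c ℓ q) (G : AbelianGroup a ℓ′) where
  open AbelianGroup G
  open AbelianGroups G using (∑)
  open Sums G
  open MonoidMult monoid using () renaming (_×_ to _·ℕ_)
  open SetoidReasoning setoid
  private
    module F = FiniteField F
    open Inverse F.enumeration using (to; from; to-cong; from-cong; strictlyInverseˡ)

  ∑-delta : ∀ e {f} g → (∀ d → d F.≈ e → f d ≈ g) → (∀ d → ¬ (d F.≈ e) → f d ≈ ε) → ∑ F.elements f ≈ g
  ∑-delta e {f} g at off = begin
    ∑ F.elements f            ≈⟨ ∑-map to (allFin q) f ⟩
    ∑ (allFin q) (f ∘ to)     ≈⟨ ∑-single (from e) (λ i i≢ → off (to i) λ eq → i≢ (≡.trans (≡.sym (Inverse.strictlyInverseʳ F.enumeration i)) (from-cong eq))) ⟩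
    f (to (from e))           ≈⟨ at _ (strictlyInverseˡ e) ⟩
    g                         ∎

  _when_≡_ : Carrier → F.Carrier → F.Carrier → Carrier
  x when d ≡ e = if does (d F.≟ e) then x else ε

  when-yes : ∀ {d e} x → d F.≈ e → x when d ≡ e ≈ x
  when-yes {d} {e} x = if-yes (d F.≟ e) x ε

  when-no : ∀ {d e} x → ¬ (d F.≈ e) → x when d ≡ e ≈ ε
  when-no {d} {e} x = if-no (d F.≟ e) x ε

  ∑-when : ∀ e x → ∑ F.elements (λ d → x when d ≡ e) ≈ x
  ∑-when e x = ∑-delta e x (λ d → when-yes x) (λ d → when-no x)

  -- Each side is completed by a delta sum carrying the value that the other side has at `e`; the
  -- two then agree term by term. This replaces a single value of a summand, in particular at the
  -- point t = 0, where the coset parametrisation is exceptional.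
  ∑-exchange : ∀ e {f g} x y → (∀ d → d F.≈ e → f d ≈ x × g d ≈ y) → (∀ d → ¬ (d F.≈ e) → f d ≈ g d) →
               ∑ F.elements f ∙ y ≈ ∑ F.elements g ∙ x
  ∑-exchange e {f} {g} x y at off = begin
    ∑ F.elements f ∙ y                                          ≈⟨ ∙-congˡ (∑-when e y) ⟨
    ∑ F.elements f ∙ ∑ F.elements (λ d → y when d ≡ e)          ≈⟨ ∑-∙ F.elements f (λ d → y when d ≡ e) ⟨
    ∑ F.elements (λ d → f d ∙ (y when d ≡ e))                   ≈⟨ ∑-cong F.elements (λ d → pointwise d (d F.≟ e)) ⟩
    ∑ F.elements (λ d → g d ∙ (x when d ≡ e))                   ≈⟨ ∑-∙ F.elements g (λ d → x when d ≡ e) ⟩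
    ∑ F.elements g ∙ ∑ F.elements (λ d → x when d ≡ e)          ≈⟨ ∙-congˡ (∑-when e x) ⟩
    ∑ F.elements g ∙ x                                          ∎
    where
    pointwise : ∀ d → Dec (d F.≈ e) → f d ∙ (y when d ≡ e) ≈ g d ∙ (x when d ≡ e)
    pointwise d (yes d≈e) = trans (∙-cong (proj₁ (at d d≈e)) (when-yes y d≈e))
      (trans (comm x y) (∙-cong (sym (proj₂ (at d d≈e))) (sym (when-yes x d≈e))))
    pointwise d (no d≉e)  = ∙-cong (off d d≉e) (trans (when-no y d≉e) (sym (when-no x d≉e)))

  -- Writing `f (σ d)` as a sum over e of `f e` supported at e = σ d and swapping the two sums
  -- leaves, for each e, the single index d = σ⁻¹ e. No permutation of the list of elements has to
  -- be constructed.
  ∑-reindex : ∀ {f} → (∀ {d e} → d F.≈ e → f d ≈ f e) →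
              ∀ (σ σ⁻¹ : F.Carrier → F.Carrier) → (∀ d e → σ d F.≈ e → d F.≈ σ⁻¹ e) → (∀ d e → d F.≈ σ⁻¹ e → σ d F.≈ e) →
              ∑ F.elements (f ∘ σ) ≈ ∑ F.elements f
  ∑-reindex {f} f-cong σ σ⁻¹ left right = begin
    ∑ F.elements (f ∘ σ)
      ≈⟨ ∑-cong F.elements (λ d → ∑-delta (σ d) (f (σ d))
           (λ e e≈σd → trans (when-yes (f e) (F.sym e≈σd)) (f-cong e≈σd)) (λ e e≉σd → when-no (f e) (e≉σd ∘ F.sym))) ⟨
    ∑ F.elements (λ d → ∑ F.elements (λ e → f e when σ d ≡ e))
      ≈⟨ ∑-swap F.elements F.elements _ ⟩
    ∑ F.elements (λ e → ∑ F.elements (λ d → f e when σ d ≡ e))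
      ≈⟨ ∑-cong F.elements (λ e → ∑-delta (σ⁻¹ e) (f e)
           (λ d d≈ → when-yes (f e) (right d e d≈)) (λ d d≉ → when-no (f e) (d≉ ∘ left d e))) ⟩
    ∑ F.elements f ∎

  ∑-elements-const : ∀ x → ∑ F.elements (λ _ → x) ≈ q ·ℕ x
  ∑-elements-const x = trans (∑-const F.elements x)
    (reflexive (≡.cong (λ n → n ·ℕ x) (≡.trans (List.length-map to (allFin q)) (List.length-tabulate {n = q} (λ i → i)))))

-- Reciprocals in the finite field.

module Reciprocals {c ℓ q} (F : FiniteField c ℓ q) where
  open FiniteField F
  open import Algebra.Properties.Semiring.Divisibility semiring using (_∣_; _,_)
  open SetoidReasoning setoid

  private
    cofactor : ∀ {t} → t ∣ 1# → Carrier
    cofactor (s , _) = s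

    cofactor-inverse : ∀ {t} (t∣1 : t ∣ 1#) → cofactor t∣1 * t ≈ 1#
    cofactor-inverse (_ , st≈1) = st≈1

    quotient : ∀ {t} → Dec (t ≈ 0#) → Carrier
    quotient         (yes _)  = 0#
    quotient {t = t} (no t≉0) = cofactor (invertible t t≉0)

    quotient-inverse : ∀ {t} (t? : Dec (t ≈ 0#)) → ¬ (t ≈ 0#) → quotient t? * t ≈ 1#
    quotient-inverse         (yes t≈0) t≉0 = contradiction t≈0 t≉0
    quotient-inverse {t = t} (no t≉0)  _   = cofactor-inverse (invertible t t≉0)

    quotient-zero : ∀ {t} (t? : Dec (t ≈ 0#)) → t ≈ 0# → quotient t? ≈ 0#
    quotient-zero (yes _)  _   = refl
    quotient-zero (no t≉0) t≈0 = contradiction t≈0 t≉0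

  difference≉0 : ∀ {x y} → ¬ (x ≈ y) → ¬ (x - y ≈ 0#)
  difference≉0 {x} {y} x≉y x-y≈0 = x≉y (GroupProperties.x∙y⁻¹≈ε⇒x≈y +-group x y x-y≈0)

  -- The default value 0 at 0 makes this an involution of the whole field, so that a sum over all b
  -- can be reindexed by t with b = `recip t`.
  recip : Carrier → Carrier
  recip t = quotient (t ≟ 0#)

  recip-inverse : ∀ {t} → ¬ (t ≈ 0#) → recip t * t ≈ 1#
  recip-inverse {t} = quotient-inverse (t ≟ 0#)

  recip-zero : ∀ {t} → t ≈ 0# → recip t ≈ 0#
  recip-zero {t} = quotient-zero (t ≟ 0#)

  inverse-unique : ∀ {t x y} → x * t ≈ 1# → y * t ≈ 1# → x ≈ y
  inverse-unique {t} {x} {y} xt≈1 yt≈1 = begin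
    x             ≈⟨ *-identityʳ x ⟨
    x * 1#        ≈⟨ *-congˡ (trans (*-comm t y) yt≈1) ⟨
    x * (t * y)   ≈⟨ *-assoc x t y ⟨
    x * t * y     ≈⟨ *-congʳ xt≈1 ⟩
    1# * y        ≈⟨ *-identityˡ y ⟩
    y             ∎

  recip-≉0 : ∀ {t} → ¬ (t ≈ 0#) → ¬ (recip t ≈ 0#)
  recip-≉0 {t} t≉0 e = 1≉0 (trans (sym (recip-inverse t≉0)) (trans (*-congʳ e) (zeroˡ t)))

  recip-cong : ∀ {t t′} → t ≈ t′ → recip t ≈ recip t′
  recip-cong {t} {t′} t≈t′ = compare (t ≟ 0#)
    where
    compare : Dec (t ≈ 0#) → recip t ≈ recip t′
    compare (yes t≈0) = trans (recip-zero t≈0) (sym (recip-zero (trans (sym t≈t′) t≈0)))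
    compare (no  t≉0) = inverse-unique (recip-inverse t≉0) (trans (*-congˡ t≈t′) (recip-inverse (λ t′≈0 → t≉0 (trans t≈t′ t′≈0))))

  recip-involutive : ∀ t → recip (recip t) ≈ t
  recip-involutive t = compare (t ≟ 0#)
    where
    compare : Dec (t ≈ 0#) → recip (recip t) ≈ t
    compare (yes t≈0) = trans (recip-zero (recip-zero t≈0)) (sym t≈0)
    compare (no  t≉0) = inverse-unique (recip-inverse (recip-≉0 t≉0)) (trans (*-comm t _) (recip-inverse t≉0))

-- Linear polynomials and residues modulo them.

module LinearPolynomials {c ℓ q} (F : FiniteField c ℓ q) where
  open Polynomials F
  open Ideals F
  private
    module F = FiniteField F
    module A = CommutativeRing polynomialRing
  open CommutativeRingSolver polynomialRing

  const : F.Carrier → Poly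
  const a = a ∷ []

  const-cong : ∀ {a b} → a F.≈ b → const a ≈ const b
  const-cong a≈b = ∷-cong a≈b A.refl

  const-0 : ∀ {a} → a F.≈ F.0# → const a ≈ 0ᴬ
  const-0 a≈0 = coeffs-≈ λ { zero → a≈0 ; (suc n) → F.refl }

  const-≉0 : ∀ {a} → ¬ (a F.≈ F.0#) → ¬ (const a ≈ 0ᴬ)
  const-≉0 a≉0 (coeffs-≈ e) = a≉0 (e 0)

  const-+ : ∀ a b → const (a F.+ b) ≈ const a + const b
  const-+ a b = A.sym (A.trans (∷-+-∷ a b [] []) (∷-cong F.refl (A.+-identityˡ [])))

  const-* : ∀ a b → const (a F.* b) ≈ const a * const b
  const-* a b = A.sym (A.trans (*-∷ˡ a [] (const b))
    (A.trans (A.+-congˡ {const (a F.* b)} (A.trans (∷-cong F.refl (A.zeroˡ (const b))) (const-0 F.refl))) (A.+-identityʳ _)))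

  const-unit : ∀ {a b} → b F.* a F.≈ F.1# → const b * const a ≈ 1ᴬ
  const-unit {a} {b} e = A.trans (A.sym (const-* b a)) (const-cong e)

  linear-difference : ∀ a b → (a ∷ 1ᴬ) ≈ const (a F.- b) + (b ∷ 1ᴬ)
  linear-difference a b = A.sym (A.trans (∷-+-∷ (a F.- b) b [] 1ᴬ)
    (∷-cong (F.trans (F.+-assoc a _ _) (F.trans (F.+-congˡ (F.-‿inverseˡ b)) (F.+-identityʳ a))) (A.+-identityˡ 1ᴬ)))

  linear-cong : ∀ {a b} → a F.≈ b → (a ∷ 1ᴬ) ≈ (b ∷ 1ᴬ)
  linear-cong a≈b = ∷-cong a≈b A.refl

  linear-injective : ∀ {a b} → (a ∷ 1ᴬ) ≈ (b ∷ 1ᴬ) → a F.≈ b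
  linear-injective (coeffs-≈ e) = e 0

  monic1≈linear : (f : Monic 1) → poly f ≈ (coeff (poly f) 0 ∷ 1ᴬ)
  monic1≈linear (monic f m) = coeffs-≈ λ
    { zero → F.refl ; (suc zero) → IsMonic.leading≈1 m ; (suc (suc n)) → IsMonic.bounded m (suc (suc n)) (s≤s (s≤s z≤n)) }

  constant : ∀ {f} → DegreeBelow 1 f → f ≈ const (coeff f 0)
  constant b = coeffs-≈ λ { zero → F.refl ; (suc n) → b (suc n) (s≤s z≤n) }

  -- The constant r is the value of f at the zero of P.
  residue : (P : Monic 1) → ∀ f → ∃[ m ] ∃[ r ] f ≈ m * poly P + const r
  residue P f = quo , coeff rem 0 , A.trans division (A.+-congˡ {quo * poly P} (constant rem-bound))
    where open DivMod (divMod f (poly P) (IsMonic⇒HasDegree (isMonic P)))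

  -- A multiple of a linear polynomial is zero or has degree at least 1.
  monic1∤const : (P : Monic 1) → ∀ {r} → ¬ (r F.≈ F.0#) → ¬ (poly P ∣ const r)
  monic1∤const P {r} r≉0 (s , sP≈r) with degree? s
  ... | inj₁ s≈0 = const-≉0 r≉0 (A.trans (A.sym sP≈r) (A.trans (A.*-congʳ {poly P} s≈0) (A.zeroˡ (poly P))))
  ... | inj₂ (d , h) with HasDegree-unique {e = 0} sP≈r (*-HasDegree h (IsMonic⇒HasDegree (isMonic P)))
                            (record { leading = r≉0 ; bounded = λ { (suc m) _ → F.refl } })
  ... | d+1≡0 = contradiction (≡.trans (ℕ.+-comm 1 d) d+1≡0) λ ()

  residue-0 : (P : Monic 1) → ∀ {f m r} → f ≈ m * poly P + const r → r F.≈ F.0# → poly P ∣ f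
  residue-0 P {f} {m} {r} f≈ r≈0 = m , A.sym (A.trans f≈ (A.trans (A.+-congˡ {m * poly P} (const-0 r≈0)) (A.+-identityʳ _)))

  -- Residues modulo P are constants and multiply as such, and the field has no zero divisors. This
  -- lets the hypothesis on prime ideals be applied to linear P.
  monic1-prime : (P : Monic 1) → IsPrimeIdeal ⟨ P ⟩
  monic1-prime P = record { p≉0 = monic≉0 P ; p∤1 = monic1∤const P F.1≉0 ; split-∣ = λ {x} {y} → split-∣ {x} {y} }
    where
    p : Poly
    p = poly P
    split-∣ : ∀ {x y} → p ∣ x * y → p ∣ x ⊎ p ∣ y
    split-∣ {x} {y} (s , sp≈xy) with residue P x | residue P y
    ... | m , r , x≈ | n , t , y≈ with r F.≟ F.0# | t F.≟ F.0#
    ... | yes r≈0 | _       = inj₁ (residue-0 P {m = m} x≈ r≈0)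
    ... | no _    | yes t≈0 = inj₂ (residue-0 P {m = n} y≈ t≈0)
    ... | no r≉0  | no t≉0  = contradiction
      -- Expanding s p = (m p + r)(n p + t) and solving for r t gives this cofactor of p.
      (s A.- (m * n * p + m * const t + n * const r) , A.trans
        (solve 6 (λ s m n p r t → (s :- (m :* n :* p :+ m :* t :+ n :* r)) :* p
            := s :* p :- (m :* p :+ r) :* (n :* p :+ t) :+ r :* t) A.refl s m n p (const r) (const t))
        (A.trans (A.+-cong (A.+-cong sp≈xy (A.-‿cong (A.sym (A.*-cong x≈ y≈)))) (A.sym (const-* r t)))
          (solve 2 (λ x y → x :- x :+ y := y) A.refl (x * y) (const (r F.* t)))))
      (monic1∤const P (F.x≉0∧y≉0⇒xy≉0 r≉0 t≉0))

  -- The residue r is a non-zero constant, hence a unit, and f = m P + r divided by r is a Bézout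
  -- identity.
  monic1∤⇒comaximal : (P : Monic 1) → ∀ {f} → ¬ (poly P ∣ f) → Comaximal (poly P) f
  monic1∤⇒comaximal P {f} P∤f with residue P f
  ... | m , r , f≈ with r F.≟ F.0#
  ... | yes r≈0 = contradiction (residue-0 P {m = m} f≈ r≈0) P∤f
  ... | no  r≉0 with F.invertible r r≉0
  ... | r⁻¹ , r⁻¹r≈1 = whole₂ (- (const r⁻¹ * m) , const r⁻¹ , A.trans (A.+-congˡ {(- (const r⁻¹ * m)) * poly P} (A.*-congˡ {const r⁻¹} f≈))
    (A.trans (solve 4 (λ u m p r → (:- (u :* m)) :* p :+ u :* (m :* p :+ r) := u :* r) A.refl (const r⁻¹) m (poly P) (const r)) (const-unit r⁻¹r≈1)))

-- Points of the projective line, cosets of Γ₀(𝔫) and cuspidality.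

module Points {c ℓ q} (F : FiniteField c ℓ q) (𝔫 : Ideals.Ideal F) (p : ℕ) where
  open Polynomials F
  open Ideals F
  open ModularSymbols F 𝔫 p
  open GL₂A using (mat; gl; GL₂; _*ᴹ_; _≈ᴹ_; mat-≈; det; matrix; isUnit; a₁₁; a₁₂; a₂₁; a₂₂; _*ᴳ_; _⁻¹ᴳ)
  open CommutativeRingSolver polynomialRing
  private
    module A = CommutativeRing polynomialRing
    module P = IsEquivalence ≈ᴾ-isEquivalence

  frac : ∀ X Y → ¬ (Y ≈ 0ᴬ) → ℙ¹
  frac X Y Y≉0 = ι X ∶ ι Y [ (λ { (_ , cross e) → Y≉0 (A.trans (A.sym (A.*-identityʳ Y)) (A.trans e (A.*-identityʳ 0ᴬ))) }) ]

  ι-isUnit : ∀ {t} → ¬ (t ≈ 0ᴬ) → GL₂K.IsUnit (ι t)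
  ι-isUnit {t} t≉0 = GL₂K.isUnit (1ᴬ / t [ t≉0 ])
    (cross (solve 1 (λ t → (:1 :* t) :* :1 := :1 :* (t :* :1)) A.refl t))

  frac-cancel : ∀ {X Y X′ Y′} Y≉0 Y′≉0 t → ¬ (t ≈ 0ᴬ) → X′ ≈ t * X → Y′ ≈ t * Y → frac X Y Y≉0 ≈ᴾ frac X′ Y′ Y′≉0
  frac-cancel {X} {Y} {X′} {Y′} _ _ t t≉0 eX eY = scaled (ι t) (ι-isUnit t≉0) (lift-eq eX) (lift-eq eY)
    where
    lift-eq : ∀ {x y} → y ≈ t * x → ι y ≈ᶠ ι t *ᶠ ι x
    lift-eq {x} {y} e = cross (A.trans (A.*-congʳ {1ᴬ * 1ᴬ} e)
      (solve 2 (λ t x → (t :* x) :* (:1 :* :1) := (t :* x) :* :1) A.refl t x))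

  private
    row-on : ∀ {a b x y z t} → t * z ≈ a * x + b * y → (ι a *ᶠ ι x) +ᶠ (ι b *ᶠ ι y) ≈ᶠ ι t *ᶠ ι z
    row-on {a} {b} {x} {y} {z} {t} e = cross (A.trans
      (solve 4 (λ a b x y → ((a :* x) :* (:1 :* :1) :+ (b :* y) :* (:1 :* :1)) :* (:1 :* :1) := a :* x :+ b :* y) A.refl a b x y)
      (A.trans (A.sym e) (solve 2 (λ t z → t :* z := (t :* z) :* ((:1 :* :1) :* (:1 :* :1))) A.refl t z)))

  ·-point : ∀ M inv {x y X Y} nz Y≉0 t → ¬ (t ≈ 0ᴬ) →
            t * X ≈ a₁₁ M * x + a₁₂ M * y → t * Y ≈ a₂₁ M * x + a₂₂ M * y →
            GL₂K.gl (ιᴹ M) inv · (ι x ∶ ι y [ nz ]) ≈ᴾ frac X Y Y≉0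
  ·-point M inv {x} {y} _ _ t t≉0 eX eY = P.sym (scaled (ι t) (ι-isUnit t≉0)
    (row-on eX) (row-on eY))

  ·-∞ : ∀ M inv {X Y} Y≉0 → X ≈ a₁₁ M → Y ≈ a₂₁ M → GL₂K.gl (ιᴹ M) inv · ∞ ≈ᴾ frac X Y Y≉0
  ·-∞ M inv Y≉0 eX eY = ·-point M inv (nonzero ∞) Y≉0 1ᴬ 1≉0 (first eX) (first eY)
    where
    first : ∀ {x a b} → x ≈ a → 1ᴬ * x ≈ a * 1ᴬ + b * 0ᴬ
    first {x} {a} {b} e = A.trans (A.*-congˡ {1ᴬ} e) (solve 2 (λ a b → :1 :* a := a :* :1 :+ b :* :0) A.refl a b)

  ·-𝟎 : ∀ M inv {X Y} Y≉0 → X ≈ a₁₂ M → Y ≈ a₂₂ M → GL₂K.gl (ιᴹ M) inv · 𝟎 ≈ᴾ frac X Y Y≉0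
  ·-𝟎 M inv Y≉0 eX eY = ·-point M inv (nonzero 𝟎) Y≉0 1ᴬ 1≉0 (second eX) (second eY)
    where
    second : ∀ {x a b} → x ≈ b → 1ᴬ * x ≈ a * 0ᴬ + b * 1ᴬ
    second {x} {a} {b} e = A.trans (A.*-congˡ {1ᴬ} e) (solve 2 (λ a b → :1 :* b := a :* :0 :+ b :* :1) A.refl a b)

  ιᴹ-* : ∀ M N → ιᴹ (M *ᴹ N) GL₂K.≈ᴹ ιᴹ M GL₂K.*ᴹ ιᴹ N
  ιᴹ-* (mat a b c d) (mat a′ b′ c′ d′) = GL₂K.mat-≈ (entry a a′ b c′) (entry a b′ b d′) (entry c a′ d c′) (entry c b′ d d′)
    where
    entry : ∀ x y z w → ι (x * y + z * w) ≈ᶠ (ι x *ᶠ ι y) +ᶠ (ι z *ᶠ ι w)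
    entry x y z w = cross (solve 4 (λ x y z w → (x :* y :+ z :* w) :* ((:1 :* :1) :* (:1 :* :1))
      := ((x :* y) :* (:1 :* :1) :+ (z :* w) :* (:1 :* :1)) :* :1) A.refl x y z w)

  -- Hecke matrices are invertible over K but not over A. The relations between them are polynomial
  -- identities over A, which this transfers to the action on points.
  ·-intertwine : ∀ {M N M′ N′ i j i′ j′} → M *ᴹ N ≈ᴹ M′ *ᴹ N′ → ∀ r →
                 GL₂K.gl (ιᴹ M) i · GL₂K.gl (ιᴹ N) j · r ≈ᴾ GL₂K.gl (ιᴹ M′) i′ · GL₂K.gl (ιᴹ N′) j′ · r
  ·-intertwine {M} {N} {M′} {N′} {i} {j} {i′} {j′} e r = P.trans (P.sym (·-assoc g h r))
    (P.trans (·-cong {g GL₂K.*ᴳ h} {g′ GL₂K.*ᴳ h′} products (P.refl {r})) (·-assoc g′ h′ r))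
    where
    module K = CommutativeRing K
    g = GL₂K.gl (ιᴹ M) i
    h = GL₂K.gl (ιᴹ N) j
    g′ = GL₂K.gl (ιᴹ M′) i′
    h′ = GL₂K.gl (ιᴹ N′) j′
    products : ιᴹ M GL₂K.*ᴹ ιᴹ N GL₂K.≈ᴹ ιᴹ M′ GL₂K.*ᴹ ιᴹ N′
    products = GL₂K.mat-≈
      (K.trans (K.sym (GL₂K.≈₁₁ (ιᴹ-* M N))) (K.trans (GL₂K.≈₁₁ (ιᴹ-cong e)) (GL₂K.≈₁₁ (ιᴹ-* M′ N′))))
      (K.trans (K.sym (GL₂K.≈₁₂ (ιᴹ-* M N))) (K.trans (GL₂K.≈₁₂ (ιᴹ-cong e)) (GL₂K.≈₁₂ (ιᴹ-* M′ N′))))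
      (K.trans (K.sym (GL₂K.≈₂₁ (ιᴹ-* M N))) (K.trans (GL₂K.≈₂₁ (ιᴹ-cong e)) (GL₂K.≈₂₁ (ιᴹ-* M′ N′))))
      (K.trans (K.sym (GL₂K.≈₂₂ (ιᴹ-* M N))) (K.trans (GL₂K.≈₂₂ (ιᴹ-cong e)) (GL₂K.≈₂₂ (ιᴹ-* M′ N′))))

  -- γ = g′ g⁻¹, whose lower-left entry is the minor formed by the two bottom rows, divided by the
  -- determinant of g.
  coset-Γ₀ : ∀ g g′ → ⟪ gen 𝔫 ⟫ (a₂₁ (matrix g′) * a₂₂ (matrix g) + (- (a₂₂ (matrix g′) * a₂₁ (matrix g)))) →
             Σ[ γ ∈ Γ₀ ] ∀ r → actsAs γ · ιᴳ g · r ≈ᴾ ιᴳ g′ · r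
  coset-Γ₀ g@(gl (mat a b c d) (e , _)) g′@(gl (mat _ _ c′ d′) _) (t , tn≈) =
    γ₀ (g′ *ᴳ g ⁻¹ᴳ) (e * t , A.trans (A.*-assoc e t (gen 𝔫)) (A.trans (A.*-congˡ {e} tn≈)
      (solve 5 (λ e c d c′ d′ → e :* (c′ :* d :- d′ :* c) := c′ :* (e :* d) :+ d′ :* (:- (e :* c))) A.refl e c d c′ d′))) ,
    λ r → P.trans (compose g′ (g ⁻¹ᴳ) (ιᴳ g · r)) (·-congʳ (ιᴳ g′) (back g {r} {ιᴳ g · r} P.refl))

  -- The minor of two rows kills the component `w` · (u′, v′) of the second row, so only the two
  -- congruence errors, both in 𝔫, contribute.
  ∼-Γ₀ : ∀ g′ y g → bottomRow g′ ∼ y → U y ≈ a₂₁ (matrix g) → V y ≈ a₂₂ (matrix g) →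
         Σ[ γ ∈ Γ₀ ] ∀ r → actsAs γ · ιᴳ g · r ≈ᴾ ιᴳ g′ · r
  ∼-Γ₀ g′ y g record { w = w ; U-cong = s , sn≈ ; V-cong = t , tn≈ } eU eV = coset-Γ₀ g g′ (u′ * t + (- (v′ * s)) , (begin
    (u′ * t + (- (v′ * s))) * gen 𝔫
      ≈⟨ solve 5 (λ u′ v′ s t n → (u′ :* t :- v′ :* s) :* n := u′ :* (t :* n) :- v′ :* (s :* n)) A.refl u′ v′ s t (gen 𝔫) ⟩
    u′ * (t * gen 𝔫) + (- (v′ * (s * gen 𝔫)))
      ≈⟨ A.+-cong (A.*-congˡ {u′} tn≈) (A.-‿cong (A.*-congˡ {v′} sn≈)) ⟩
    u′ * (V y A.- w * v′) + (- (v′ * (U y A.- w * u′)))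
      ≈⟨ solve 5 (λ u′ v′ u v w → u′ :* (v :- w :* v′) :- v′ :* (u :- w :* u′) := u′ :* v :- v′ :* u) A.refl u′ v′ (U y) (V y) w ⟩
    u′ * V y + (- (v′ * U y))
      ≈⟨ A.+-cong (A.*-congˡ {u′} eV) (A.-‿cong (A.*-congˡ {v′} eU)) ⟩
    u′ * a₂₂ (matrix g) + (- (v′ * a₂₁ (matrix g))) ∎))
    where
    open SetoidReasoning A.setoid
    u′ v′ : Poly
    u′ = a₂₁ (matrix g′)
    v′ = a₂₂ (matrix g′)

  representative-Γ₀ : ∀ y g → U y ≈ a₂₁ (matrix g) → V y ≈ a₂₂ (matrix g) →
                      Σ[ γ ∈ Γ₀ ] ∀ r → actsAs γ · ιᴳ g · r ≈ᴾ ιᴳ (proj₁ (representative y)) · r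
  representative-Γ₀ y g = ∼-Γ₀ (proj₁ (representative y)) y g (proj₂ (representative y))

  lowerUnipotent : Poly → GL₂
  lowerUnipotent c = gl (mat 1ᴬ 0ᴬ c 1ᴬ) (isUnit 1ᴬ (solve 1 (λ c → :1 :* (:1 :* :1 :- :0 :* c) := :1) A.refl c))

  upperUnipotent : Poly → GL₂
  upperUnipotent b = gl (mat 1ᴬ b 0ᴬ 1ᴬ) (isUnit 1ᴬ (solve 1 (λ b → :1 :* (:1 :* :1 :- b :* :0) := :1) A.refl b))

  -- The end points are Γ₀(𝔫)-equivalent to 0 and 1/u, and these are equivalent to each other
  -- because u is invertible modulo 𝔫.
  x[u∶1]-cuspidal : ∀ u → Comaximal u (gen 𝔫) → ¬ (u ≈ 0ᴬ) → IsCuspidal (x [ u ∶1])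
  x[u∶1]-cuspidal u u⊥n u≉0 = AbelianGroups.≈⇒≈[S] Div⁰Orbits _
    (Divisors.div⁰-≈ (Divisors.div-≈ (prep (O.trans (O.sym to-∞) (O.trans (O.sym 𝟎~∞) to-𝟎)) ↭-refl)))
    where
    open Permutation orbits
    module O = Setoid orbits
    g : GL₂
    g = lowerUnipotent u
    same : Σ[ γ ∈ Γ₀ ] ∀ r → actsAs γ · ιᴳ g · r ≈ᴾ ιᴳ (proj₁ (representative [ u ∶1])) · r
    same = representative-Γ₀ [ u ∶1] g A.refl A.refl
    γ : Γ₀
    γ = proj₁ same
    moves : ∀ r → actsAs γ · ιᴳ g · r ≈ᴾ ιᴳ (proj₁ (representative [ u ∶1])) · r
    moves = proj₂ same
    α β : Poly
    α = proj₁ (combination₂ u⊥n)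
    β = proj₁ (proj₂ (combination₂ u⊥n))
    αu+βn≈1 : α * u + β * gen 𝔫 ≈ 1ᴬ
    αu+βn≈1 = proj₂ (proj₂ (combination₂ u⊥n))
    to-𝟎 : (ιᴳ g · 𝟎) ~ (ιᴳ (proj₁ (representative [ u ∶1])) · 𝟎)
    to-𝟎 = orbit γ (moves 𝟎)
    to-∞ : (ιᴳ g · ∞) ~ (ιᴳ (proj₁ (representative [ u ∶1])) · ∞)
    to-∞ = orbit γ (moves ∞)
    -- The second column (1, u) sends 0 to 1/u. The first column comes from αu + βn = 1: it makes
    -- the determinant 1 and keeps the lower-left entry in 𝔫.
    δ : Γ₀
    δ = γ₀ (gl (mat α 1ᴬ (- (β * gen 𝔫)) u) (isUnit 1ᴬ (A.trans
        (solve 4 (λ α β n u → :1 :* (α :* u :- :1 :* (:- (β :* n))) := α :* u :+ β :* n) A.refl α β (gen 𝔫) u) αu+βn≈1)))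
      (- β , solve 2 (λ β n → (:- β) :* n := :- (β :* n)) A.refl β (gen 𝔫))
    𝟎~∞ : (ιᴳ g · 𝟎) ~ (ιᴳ g · ∞)
    𝟎~∞ = orbit δ (P.trans (·-congʳ (actsAs δ) (·-𝟎 (matrix g) (ιᴹ-invertible _ (GL₂.invertible g)) 1≉0 A.refl A.refl))
      (P.trans (·-point (matrix (element δ)) (ιᴹ-invertible _ (GL₂.invertible (element δ))) (nonzero (frac 0ᴬ 1ᴬ 1≉0)) u≉0 1ᴬ 1≉0
        (solve 1 (λ α → :1 :* :1 := α :* :0 :+ :1 :* :1) A.refl α)
        (solve 2 (λ w u → :1 :* u := w :* :0 :+ u :* :1) A.refl (- (β * gen 𝔫)) u))
      (P.sym (·-∞ (matrix g) (ιᴹ-invertible _ (GL₂.invertible g)) u≉0 A.refl A.refl))))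

  private
    module R = BottomRow polynomialRing

  completeRow-det : ∀ {u v} (w : Comaximal u v) → det (matrix (proj₁ (R.completeRow w))) ≈ 1ᴬ
  completeRow-det {u} {v} w = A.trans (solve 4 (λ u v x y → y :* v :- (:- x) :* u := x :* u :+ y :* v) A.refl u v
      (proj₁ (combination₂ w)) (proj₁ (proj₂ (combination₂ w)))) (proj₂ (proj₂ (combination₂ w)))

  -- Lifting changes the second coordinate only when it is zero. So the matrix representing (u : 1)
  -- has bottom row (u + s n, 1), with an exact 1.
  lift-comaximal-unshifted : ∀ u v n n≉0 w → ¬ (v ≈ 0ᴬ) → proj₁ (proj₂ (lift-comaximal _≟0 split u v n n≉0 w)) ≡ 0ᴬ
  lift-comaximal-unshifted u v n n≉0 w v≉0 with v ≟0
  ... | no _    = ≡.refl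
  ... | yes v≈0 = contradiction v≈0 v≉0

  -- T is defined on divisors, and Defs fixes the one representing x(u : 1) by an arbitrary choice of g; this
  -- factorisation reduces the independence of that choice to invariance of T under unipotent matrices.
  record UnipotentFactorisation (u : Poly) (g : GL₂) : Set (c ⊔ ℓ) where
    field
      b m     : Poly
      m∈𝔫     : ⟪ gen 𝔫 ⟫ m
      factors : ∀ r → ιᴳ (upperUnipotent b) · ιᴳ (lowerUnipotent m) · ιᴳ (lowerUnipotent u) · r ≈ᴾ ιᴳ g · r

  -- With k = u + m and lower-right entry 1, determinant 1 forces a = 1 + b k, so g is determined by
  -- b and k, and equals (1 b; 0 1)(1 0; k 1).
  unipotentFactorisation : ∀ u g m → ⟪ gen 𝔫 ⟫ m → a₂₁ (matrix g) ≈ u + m → a₂₂ (matrix g) ≈ 1ᴬ → det (matrix g) ≈ 1ᴬ →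
                           UnipotentFactorisation u g
  unipotentFactorisation u g@(gl (mat a b k v) _) m m∈𝔫 k≈ v≈1 det≈1 = record
    { b = b ; m = m ; m∈𝔫 = m∈𝔫
    ; factors = λ r → P.trans (·-congʳ (ιᴳ (upperUnipotent b)) (P.sym (compose (lowerUnipotent m) (lowerUnipotent u) r)))
        (P.trans (P.sym (compose (upperUnipotent b) (lowerUnipotent m *ᴳ lowerUnipotent u) r))
          (·-cong {ιᴳ (upperUnipotent b *ᴳ (lowerUnipotent m *ᴳ lowerUnipotent u))} {ιᴳ g} (ιᴹ-cong product) (P.refl {r}))) }
    where
    m+u≈k : m + u ≈ k
    m+u≈k = A.trans (A.+-comm m u) (A.sym k≈)
    1+bk≈a : 1ᴬ + b * k ≈ a
    1+bk≈a = A.trans (A.+-congʳ {b * k} (A.sym det≈1)) (A.trans (solve 3 (λ a v w → (a :* v :- w) :+ w := a :* v) A.refl a v (b * k))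
      (A.trans (A.*-congˡ {a} v≈1) (A.*-identityʳ a)))
    product : matrix (upperUnipotent b *ᴳ (lowerUnipotent m *ᴳ lowerUnipotent u)) ≈ᴹ matrix g
    product = mat-≈
      (A.trans (solve 3 (λ b m u → :1 :* (:1 :* :1 :+ :0 :* u) :+ b :* (m :* :1 :+ :1 :* u) := :1 :+ b :* (m :+ u)) A.refl b m u)
        (A.trans (A.+-congˡ {1ᴬ} (A.*-congˡ {b} m+u≈k)) 1+bk≈a))
      (solve 2 (λ b m → :1 :* (:1 :* :0 :+ :0 :* :1) :+ b :* (m :* :0 :+ :1 :* :1) := b) A.refl b m)
      (A.trans (solve 2 (λ m u → :0 :* (:1 :* :1 :+ :0 :* u) :+ :1 :* (m :* :1 :+ :1 :* u) := m :+ u) A.refl m u) m+u≈k)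
      (A.trans (solve 1 (λ m → :0 :* (:1 :* :0 :+ :0 :* :1) :+ :1 :* (m :* :0 :+ :1 :* :1) := :1) A.refl m) (A.sym v≈1))

  completeRow-factorisation : ∀ u v (lifting : ∃[ s ] ∃[ t ] Comaximal (u + s * gen 𝔫) (v + t * gen 𝔫)) → v ≈ 1ᴬ → proj₁ (proj₂ lifting) ≡ 0ᴬ →
                              UnipotentFactorisation u (proj₁ (R.completeRow (proj₂ (proj₂ lifting))))
  completeRow-factorisation u v (s , t , w) v≈1 t≡0 = unipotentFactorisation u (proj₁ (R.completeRow w)) (s * gen 𝔫) (s , A.refl)
    (A.reflexive (proj₁ (proj₂ (R.completeRow w))))
    (A.trans (A.reflexive (proj₂ (proj₂ (R.completeRow w))))
      (A.trans (A.+-cong v≈1 (A.trans (A.*-congʳ {gen 𝔫} (A.reflexive t≡0)) (A.zeroˡ (gen 𝔫)))) (A.+-identityʳ 1ᴬ)))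
    (completeRow-det w)

  representative-factorisation : ∀ y → V y ≈ 1ᴬ → UnipotentFactorisation (U y) (proj₁ (representative y))
  representative-factorisation y v≈1 = completeRow-factorisation (U y) (V y) (lift 𝔫 (U y) (V y) (whole y)) v≈1
    (lift-comaximal-unshifted (U y) (V y) (gen 𝔫) (monic≉0 (generator 𝔫)) (whole y) (λ v≈0 → 1≉0 (A.trans (A.sym v≈1) v≈0)))

-- Sums over monic polynomials of degree at most 1.

module MonicSums {c ℓ q} (F : FiniteField c ℓ q) where
  open Polynomials F
  open Ideals F
  private
    module F = FiniteField F

  linear : F.Carrier → Monic 1
  linear a = monic (a ∷ 1ᴬ) (monicPoly-isMonic (a ∷ []))

  one≤ : ∀ {n} → Monic≤ n
  one≤ = Fin.zero , monic 1ᴬ (monicPoly-isMonic [])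

  linear≤ : F.Carrier → Monic≤ 1
  linear≤ a = Fin.suc Fin.zero , linear a

  module _ {a ℓ′} (H : AbelianGroup a ℓ′) where
    private
      module H = AbelianGroup H
      module SH = Sums H

    ∑-tuples₁ : ∀ f → AbelianGroups.∑ H (tuples 1) f H.≈ AbelianGroups.∑ H F.elements (λ a → f (a ∷ []))
    ∑-tuples₁ f = H.trans (SH.∑-concatMap (λ a → map (a ∷_) (tuples 0)) F.elements f)
      (SH.∑-cong F.elements (λ a → H.identityʳ _))

    ∑-monics₁ : ∀ f → AbelianGroups.∑ H (monics 1) f H.≈ AbelianGroups.∑ H F.elements (λ a → f (linear a))
    ∑-monics₁ f = H.trans (SH.∑-map _ (tuples 1) f) (∑-tuples₁ _)

    ∑-monics≤₁ : ∀ f → AbelianGroups.∑ H (monics≤ 1) f H.≈ f one≤ H.∙ AbelianGroups.∑ H F.elements (λ a → f (linear≤ a))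
    ∑-monics≤₁ f = H.trans (SH.∑-concatMap (λ d → map (d ,_) (monics (Fin.toℕ d))) (allFin 2) f)
      (H.∙-cong (H.identityʳ _) (H.trans (H.identityʳ _) (H.trans (SH.∑-map (Fin.suc Fin.zero ,_) (monics 1) f) (∑-monics₁ _))))

    -- Shaped after the factorisations of a linear P into two monic factors of degree at most 1: by
    -- degrees only (P, 1) and (1, P) contribute, giving x and y.
    ∑∑-linear : ∀ a (term : Monic≤ 1 → Monic≤ 1 → H.Carrier) x y →
      term one≤ one≤ H.≈ H.ε → (∀ v w → term (linear≤ v) (linear≤ w) H.≈ H.ε) →
      (∀ v → v F.≈ a → term (linear≤ v) one≤ H.≈ x) → (∀ v → ¬ (v F.≈ a) → term (linear≤ v) one≤ H.≈ H.ε) →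
      (∀ v → v F.≈ a → term one≤ (linear≤ v) H.≈ y) → (∀ v → ¬ (v F.≈ a) → term one≤ (linear≤ v) H.≈ H.ε) →
      AbelianGroups.∑ H (monics≤ 1) (λ d → AbelianGroups.∑ H (monics≤ 1) (term d)) H.≈ x H.∙ y
    ∑∑-linear a term x y one-one linear-linear linear-one linear-one′ one-linear one-linear′ =
      H.trans (∑-monics≤₁ (λ d → AbelianGroups.∑ H (monics≤ 1) (term d)))
        (H.trans (H.∙-cong first-row (FieldSums.∑-delta F H a x
            (λ v v≈a → row v (linear-one v v≈a)) (λ v v≉a → row v (linear-one′ v v≉a))))
          (H.comm y x))
      where
      row : ∀ v {z} → term (linear≤ v) one≤ H.≈ z → AbelianGroups.∑ H (monics≤ 1) (term (linear≤ v)) H.≈ z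
      row v e = H.trans (∑-monics≤₁ (term (linear≤ v))) (H.trans (H.∙-cong e (SH.∑-ε F.elements (linear-linear v))) (H.identityʳ _))
      first-row : AbelianGroups.∑ H (monics≤ 1) (term one≤) H.≈ y
      first-row = H.trans (∑-monics≤₁ (term one≤))
        (H.trans (H.∙-cong one-one (FieldSums.∑-delta F H a y one-linear one-linear′)) (H.identityˡ y))

-- Abstract modular symbols.

module Symbols {c ℓ q} (F : FiniteField c ℓ q) (𝔫 : Ideals.Ideal F) (p : ℕ) where
  open Polynomials F
  open Ideals F
  open LinearPolynomials F
  open Reciprocals F
  open MonicSums F
  open ModularSymbols F 𝔫 p
  open Points F 𝔫 p
  open GL₂A using (mat; gl; GL₂; _*ᴹ_; _≈ᴹ_; mat-≈; matrix; isUnit; a₁₁; a₁₂; a₂₁; a₂₂)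
  open CommutativeRingSolver polynomialRing
  private
    module F = FiniteField F
    module A = CommutativeRing polynomialRing
    module P = IsEquivalence ≈ᴾ-isEquivalence

  admissible?-elim : ∀ (u P : Monic 1) v {ℓ′} (Q : Maybe (Admissible u P) → Set ℓ′) →
    (poly (proj₂ v) ≈ poly u → Q nothing) → (poly (proj₂ v) ≈ poly P → Q nothing) →
    (∀ a → Admissible.v a ≡ v → Q (just a)) → Q (admissible? u P v)
  admissible?-elim u P v Q at-u at-P else with poly (proj₂ v) ≟ poly u | poly (proj₂ v) ≟ poly P
  ... | no v≢u  | no v≢P  = else (record { v = v ; v≢u = v≢u ; v≢P = v≢P }) ≡.refl
  ... | no _    | yes v≈P = at-P v≈P
  ... | yes v≈u | _       = at-u v≈u

  -- The universal such map sends (r , s) to the modular symbol [r, s].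
  record SymbolMap {a ℓ′} (G : AbelianGroup a ℓ′) : Set (c ⊔ ℓ ⊔ a ⊔ ℓ′) where
    open AbelianGroup G using (Carrier; _-_) renaming (_≈_ to _≈ˢ_)
    infix 7 _⇒_
    field
      _⇒_       : ℙ¹ → ℙ¹ → Carrier
      ⇒-cong    : ∀ {r r′ s s′} → r ≈ᴾ r′ → s ≈ᴾ s′ → r ⇒ s ≈ˢ r′ ⇒ s′
      ⇒-from    : ∀ t r s → r ⇒ s ≈ˢ (t ⇒ s) - (t ⇒ r)
      invariant : ∀ γ r s → (actsAs γ · r) ⇒ (actsAs γ · s) ≈ˢ r ⇒ s

  module Symbol {a ℓ′} {G : AbelianGroup a ℓ′} (φ : SymbolMap G) where
    open AbelianGroup G using (_∙_; ε; _⁻¹; _-_) renaming (Carrier to Symbol; _≈_ to _≈ˢ_)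
    open AbelianGroups G using (∑)
    open Sums G
    open FieldSums F G
    open SymbolMap φ
    private
      module G = AbelianGroup G

    ⇒-Γ₀ : ∀ γ {r r′ s s′} → actsAs γ · r ≈ᴾ r′ → actsAs γ · s ≈ᴾ s′ → r′ ⇒ s′ ≈ˢ r ⇒ s
    ⇒-Γ₀ γ {r} {r′} {s} {s′} γr≈r′ γs≈s′ = G.trans (⇒-cong (P.sym γr≈r′) (P.sym γs≈s′)) (invariant γ r s)

    ⟦_⟧ : ℙ¹ → Symbol
    ⟦ r ⟧ = ∞ ⇒ r

    ⟦⟧-cong : ∀ {r s} → r ≈ᴾ s → ⟦ r ⟧ ≈ˢ ⟦ s ⟧
    ⟦⟧-cong = ⇒-cong (P.refl {∞})

    -- The matrix (α β; 0 1) lies in Γ₀(𝔫), fixes ∞ and sends X/Y to (αX + βY)/Y.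
    ⟦⟧-upper : ∀ {X X′ Y} Y≉0 α α⁻¹ β → α⁻¹ * α ≈ 1ᴬ → X′ ≈ α * X + β * Y → ⟦ frac X Y Y≉0 ⟧ ≈ˢ ⟦ frac X′ Y Y≉0 ⟧
    ⟦⟧-upper {X} {X′} {Y} Y≉0 α α⁻¹ β α⁻¹α≈1 e = G.sym (⇒-Γ₀ γ
      -- ∞ is sent to (α : 0), which the factor α⁻¹ brings back to (1 : 0).
      (scaled (ι α⁻¹) (ι-isUnit α⁻¹≉0) (cross (A.trans (A.sym (A.trans (A.*-congʳ α⁻¹α≈1) (A.*-identityˡ _)))
          (solve 3 (λ i α β → (i :* α) :* (:1 :* ((:1 :* ((:1 :* :1) :* (:1 :* :1))))) := (i :* ((α :* :1) :* (:1 :* :1) :+ (β :* :0) :* (:1 :* :1))) :* :1) A.refl α⁻¹ α β)))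
        (cross (solve 1 (λ i → :0 :* (:1 :* ((:1 :* :1) :* (:1 :* :1))) := (i :* ((:0 :* :1) :* (:1 :* :1) :+ (:1 :* :0) :* (:1 :* :1))) :* :1) A.refl α⁻¹)))
      (·-point (mat α β 0ᴬ 1ᴬ) (ιᴹ-invertible _ (GL₂.invertible (element γ))) (nonzero (frac X Y Y≉0)) Y≉0 1ᴬ 1≉0 (A.trans (A.*-identityˡ X′) e)
        (solve 2 (λ X Y → :1 :* Y := :0 :* X :+ :1 :* Y) A.refl X Y)))
      where
      γ : Γ₀
      γ = γ₀ (gl (mat α β 0ᴬ 1ᴬ) (isUnit α⁻¹ (A.trans (solve 3 (λ i α β → i :* (α :* :1 :- β :* :0) := i :* α) A.refl α⁻¹ α β) α⁻¹α≈1)))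
        (0ᴬ , A.zeroˡ (gen 𝔫))
      α⁻¹≉0 : ¬ (α⁻¹ ≈ 0ᴬ)
      α⁻¹≉0 z = 1≉0 (A.trans (A.sym α⁻¹α≈1) (A.trans (A.*-congʳ {α} z) (A.zeroˡ α)))

    opaque
      Ξ : ℙ¹A/𝔫 → Symbol
      Ξ y = (ιᴳ (proj₁ (representative y)) · 𝟎) ⇒ (ιᴳ (proj₁ (representative y)) · ∞)

      Ξ-unfold : ∀ y → Ξ y ≈ˢ (ιᴳ (proj₁ (representative y)) · 𝟎) ⇒ (ιᴳ (proj₁ (representative y)) · ∞)
      Ξ-unfold y = G.refl

      -- Frees the symbol from the chosen representative: any matrix over A with this bottom row
      -- differs from the chosen one by an element of Γ₀(𝔫) on the left.
      Ξ-matrix : ∀ y g → U y ≈ a₂₁ (matrix g) → V y ≈ a₂₂ (matrix g) → Ξ y ≈ˢ (ιᴳ g · 𝟎) ⇒ (ιᴳ g · ∞)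
      Ξ-matrix y g eU eV = ⇒-Γ₀ (proj₁ same) (proj₂ same 𝟎) (proj₂ same ∞)
        where
        same : Σ[ γ ∈ Γ₀ ] ∀ r → actsAs γ · ιᴳ g · r ≈ᴾ ιᴳ (proj₁ (representative y)) · r
        same = representative-Γ₀ y g eU eV

    matrix-fractions : ∀ M i {X₀ Y₀ X∞ Y∞} Y₀≉0 Y∞≉0 → X₀ ≈ a₁₂ M → Y₀ ≈ a₂₂ M → X∞ ≈ a₁₁ M → Y∞ ≈ a₂₁ M →
                       (GL₂K.gl (ιᴹ M) i · 𝟎) ⇒ (GL₂K.gl (ιᴹ M) i · ∞) ≈ˢ ⟦ frac X∞ Y∞ Y∞≉0 ⟧ - ⟦ frac X₀ Y₀ Y₀≉0 ⟧
    matrix-fractions M i Y₀≉0 Y∞≉0 eX₀ eY₀ eX∞ eY∞ = G.trans (⇒-cong (·-𝟎 M i Y₀≉0 eX₀ eY₀) (·-∞ M i Y∞≉0 eX∞ eY∞)) (⇒-from ∞ _ _)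

    Ξ-fractions : ∀ y g {X₀ Y₀ X∞ Y∞} Y₀≉0 Y∞≉0 → U y ≈ a₂₁ (matrix g) → V y ≈ a₂₂ (matrix g) →
                  X₀ ≈ a₁₂ (matrix g) → Y₀ ≈ a₂₂ (matrix g) → X∞ ≈ a₁₁ (matrix g) → Y∞ ≈ a₂₁ (matrix g) →
                  Ξ y ≈ˢ ⟦ frac X∞ Y∞ Y∞≉0 ⟧ - ⟦ frac X₀ Y₀ Y₀≉0 ⟧
    Ξ-fractions y g Y₀≉0 Y∞≉0 eU eV eX₀ eY₀ eX∞ eY∞ = G.trans (Ξ-matrix y g eU eV)
      (matrix-fractions (matrix g) (ιᴹ-invertible _ (GL₂.invertible g)) Y₀≉0 Y∞≉0 eX₀ eY₀ eX∞ eY∞)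

    opaque
      Ξ₁ : Poly → Symbol
      Ξ₁ u = Ξ [ u ∶1]

      Ξ₁-unfold : ∀ u → Ξ₁ u ≈ˢ Ξ [ u ∶1]
      Ξ₁-unfold u = G.refl

      Ξ₁-fractions : ∀ u g {X₀ Y₀ X∞ Y∞} Y₀≉0 Y∞≉0 → u ≈ a₂₁ (matrix g) → 1ᴬ ≈ a₂₂ (matrix g) →
                     X₀ ≈ a₁₂ (matrix g) → Y₀ ≈ a₂₂ (matrix g) → X∞ ≈ a₁₁ (matrix g) → Y∞ ≈ a₂₁ (matrix g) →
                     Ξ₁ u ≈ˢ ⟦ frac X∞ Y∞ Y∞≉0 ⟧ - ⟦ frac X₀ Y₀ Y₀≉0 ⟧
      Ξ₁-fractions u = Ξ-fractions [ u ∶1]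

      Ξᴬ : ∀ u P → Admissible u P → Symbol
      Ξᴬ u P v = Ξ ([Pu∶v] {u} {P} v)

      Ξᴬ-unfold : ∀ u P v → Ξᴬ u P v ≈ˢ Ξ ([Pu∶v] {u} {P} v)
      Ξᴬ-unfold u P v = G.refl

      Ξᴬ-fractions : ∀ u P v g {X₀ Y₀ X∞ Y∞} Y₀≉0 Y∞≉0 → poly P * poly u ≈ a₂₁ (matrix g) → poly (proj₂ (Admissible.v v)) ≈ a₂₂ (matrix g) →
                     X₀ ≈ a₁₂ (matrix g) → Y₀ ≈ a₂₂ (matrix g) → X∞ ≈ a₁₁ (matrix g) → Y∞ ≈ a₂₁ (matrix g) →
                     Ξᴬ u P v ≈ˢ ⟦ frac X∞ Y∞ Y∞≉0 ⟧ - ⟦ frac X₀ Y₀ Y₀≉0 ⟧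
      Ξᴬ-fractions u P v = Ξ-fractions ([Pu∶v] {u} {P} v)

    image : GL₂K.GL₂ → ℙ¹ → ℙ¹ → Symbol
    image h r s = (h · r) ⇒ (h · s)

    image-cong : ∀ {M N} i j r s → M ≈ᴹ N → image (GL₂K.gl (ιᴹ M) i) r s ≈ˢ image (GL₂K.gl (ιᴹ N) j) r s
    image-cong {M} {N} i j r s e = ⇒-cong (·-cong {GL₂K.gl (ιᴹ M) i} {GL₂K.gl (ιᴹ N) j} (ιᴹ-cong e) (P.refl {r}))
      (·-cong {GL₂K.gl (ιᴹ M) i} {GL₂K.gl (ιᴹ N) j} (ιᴹ-cong e) (P.refl {s}))

    image-congʳ : ∀ h {r r′ s s′} → r ≈ᴾ r′ → s ≈ᴾ s′ → image h r s ≈ˢ image h r′ s′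
    image-congʳ h {r} {r′} {s} {s′} r≈r′ s≈s′ = ⇒-cong {h · r} {h · r′} {h · s} {h · s′} (·-congʳ h r≈r′) (·-congʳ h s≈s′)

    -- From M δ = γ M′, moving the argument by δ turns the coset of M into that of M′, and γ is
    -- absorbed by invariance. All instances below take γ = M δ M′⁻¹, so what must be checked is
    -- that γ is integral, invertible and in Γ₀(𝔫).
    image-coset : ∀ M i M′ i′ δ γ → M *ᴹ matrix δ ≈ᴹ matrix (element γ) *ᴹ M′ → ∀ r s →
                  image (GL₂K.gl (ιᴹ M) i) (ιᴳ δ · r) (ιᴳ δ · s) ≈ˢ image (GL₂K.gl (ιᴹ M′) i′) r s
    image-coset M i M′ i′ δ γ e r s = ⇒-Γ₀ γ (P.sym (commute r)) (P.sym (commute s))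
      where
      commute : ∀ r → GL₂K.gl (ιᴹ M) i · ιᴳ δ · r ≈ᴾ actsAs γ · GL₂K.gl (ιᴹ M′) i′ · r
      commute = ·-intertwine {M} {matrix δ} {matrix (element γ)} {M′} {i} {ιᴹ-invertible _ (GL₂.invertible δ)}
        {ιᴹ-invertible _ (GL₂.invertible (element γ))} {i′} e

    -- The Hecke operator at a linear prime and its invariance.

    module Linear (a : F.Carrier) (P∤𝔫 : ¬ ((a ∷ 1ᴬ) ∣ gen 𝔫)) where

      Π : Poly
      Π = a ∷ 1ᴬ

      Π≉0 : ¬ (Π ≈ 0ᴬ)
      Π≉0 = monic≉0 (linear a)

      diagonal : GL₂K.GL₂
      diagonal = upperTriangular Π 0ᴬ 1ᴬ Π≉0 1≉0

      triangular : Poly → GL₂K.GL₂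
      triangular b = upperTriangular 1ᴬ b Π 1≉0 Π≉0

      -- The value of T_P on [r, s]. As P does not divide 𝔫, all q + 1 matrices occur.
      H : ℙ¹ → ℙ¹ → Symbol
      H r s = image diagonal r s ∙ ∑ F.elements (λ b → image (triangular (const b)) r s)

      tri : F.Carrier → ℙ¹ → ℙ¹ → Symbol
      tri b = image (triangular (const b))

      private
        diagonal-invertible : GL₂K.IsUnit (GL₂K.det (ιᴹ (mat Π 0ᴬ 0ᴬ 1ᴬ)))
        diagonal-invertible = upperTriangular-invertible 0ᴬ Π≉0 1≉0
        triangular-invertible : ∀ b → GL₂K.IsUnit (GL₂K.det (ιᴹ (mat 1ᴬ b 0ᴬ Π)))
        triangular-invertible b = upperTriangular-invertible b 1≉0 Π≉0

        Γ-upper : Poly → Γ₀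
        Γ-upper b = γ₀ (upperUnipotent b) (0ᴬ , A.zeroˡ (gen 𝔫))

        diagonal→diagonal : ∀ δ γ → mat Π 0ᴬ 0ᴬ 1ᴬ *ᴹ matrix δ ≈ᴹ matrix (element γ) *ᴹ mat Π 0ᴬ 0ᴬ 1ᴬ → ∀ r s →
          image diagonal (ιᴳ δ · r) (ιᴳ δ · s) ≈ˢ image diagonal r s
        diagonal→diagonal δ γ = image-coset (mat Π 0ᴬ 0ᴬ 1ᴬ) (diagonal-invertible) (mat Π 0ᴬ 0ᴬ 1ᴬ) (diagonal-invertible) δ γ

        diagonal→triangular : ∀ δ γ b′ → mat Π 0ᴬ 0ᴬ 1ᴬ *ᴹ matrix δ ≈ᴹ matrix (element γ) *ᴹ mat 1ᴬ b′ 0ᴬ Π → ∀ r s →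
          image diagonal (ιᴳ δ · r) (ιᴳ δ · s) ≈ˢ image (triangular b′) r s
        diagonal→triangular δ γ b′ = image-coset (mat Π 0ᴬ 0ᴬ 1ᴬ) (diagonal-invertible) (mat 1ᴬ b′ 0ᴬ Π) (triangular-invertible b′) δ γ

        triangular→diagonal : ∀ δ γ b → mat 1ᴬ b 0ᴬ Π *ᴹ matrix δ ≈ᴹ matrix (element γ) *ᴹ mat Π 0ᴬ 0ᴬ 1ᴬ → ∀ r s →
          image (triangular b) (ιᴳ δ · r) (ιᴳ δ · s) ≈ˢ image diagonal r s
        triangular→diagonal δ γ b = image-coset (mat 1ᴬ b 0ᴬ Π) (triangular-invertible b) (mat Π 0ᴬ 0ᴬ 1ᴬ) (diagonal-invertible) δ γ

        triangular→triangular : ∀ δ γ b b′ → mat 1ᴬ b 0ᴬ Π *ᴹ matrix δ ≈ᴹ matrix (element γ) *ᴹ mat 1ᴬ b′ 0ᴬ Π → ∀ r s →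
          image (triangular b) (ιᴳ δ · r) (ιᴳ δ · s) ≈ˢ image (triangular b′) r s
        triangular→triangular δ γ b b′ = image-coset (mat 1ᴬ b 0ᴬ Π) (triangular-invertible b) (mat 1ᴬ b′ 0ᴬ Π) (triangular-invertible b′) δ γ

      tri-cong : ∀ {b b′} → b F.≈ b′ → ∀ r s → tri b r s ≈ˢ tri b′ r s
      tri-cong {b} {b′} b≈b′ r s = image-cong (triangular-invertible (const b)) (triangular-invertible (const b′)) r s
        (mat-≈ A.refl (const-cong b≈b′) A.refl A.refl)

      H-cong : ∀ {r r′ s s′} → r ≈ᴾ r′ → s ≈ᴾ s′ → H r s ≈ˢ H r′ s′
      H-cong r≈r′ s≈s′ = G.∙-cong (image-congʳ diagonal r≈r′ s≈s′) (∑-cong F.elements (λ b → image-congʳ (triangular (const b)) r≈r′ s≈s′))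

      -- With β = mΠ + β₀, moving by (1 β; 0 1) turns the coset of b into that of b + β₀, where γ =
      -- (1 m; 0 1). The diagonal coset is fixed, with γ = (1 Πβ; 0 1).
      H-upper : ∀ β r s → H (ιᴳ (upperUnipotent β) · r) (ιᴳ (upperUnipotent β) · s) ≈ˢ H r s
      H-upper β r s = G.∙-cong
        (diagonal→diagonal (upperUnipotent β) (Γ-upper (Π * β)) (mat-≈
          (solve 2 (λ p x → p :* :1 :+ :0 :* :0 := :1 :* p :+ p :* x :* :0) A.refl Π β)
          (solve 2 (λ p x → p :* x :+ :0 :* :1 := :1 :* :0 :+ p :* x :* :1) A.refl Π β)
          (solve 1 (λ p → :0 :* :1 :+ :1 :* :0 := :0 :* p :+ :1 :* :0) A.refl Π)
          (solve 1 (λ x → :0 :* x :+ :1 :* :1 := :0 :* :0 :+ :1 :* :1) A.refl β)) r s)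
        (G.trans (∑-cong F.elements shift)
          (∑-reindex (λ e → tri-cong e r s) (F._+ β₀) (F._- β₀)
            (λ d e e₁ → F.trans (F.sym (cancel d)) (F.+-congʳ e₁))
            (λ d e e₁ → F.trans (F.+-congʳ e₁) (cancel′ e))))
        where
        m : Poly
        m = proj₁ (residue (linear a) β)
        β₀ : F.Carrier
        β₀ = proj₁ (proj₂ (residue (linear a) β))
        β≈ : β ≈ m * Π + const β₀
        β≈ = proj₂ (proj₂ (residue (linear a) β))
        module FS = CommutativeRingSolver F.commutativeRing
        cancel : ∀ d → (d F.+ β₀) F.- β₀ F.≈ d
        cancel d = FS.solve 2 (λ d b → (d FS.:+ b) FS.:- b FS.:= d) F.refl d β₀
        cancel′ : ∀ d → (d F.- β₀) F.+ β₀ F.≈ d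
        cancel′ d = FS.solve 2 (λ d b → (d FS.:- b) FS.:+ b FS.:= d) F.refl d β₀
        shift : ∀ b → tri b (ιᴳ (upperUnipotent β) · r) (ιᴳ (upperUnipotent β) · s) ≈ˢ tri (b F.+ β₀) r s
        shift b = triangular→triangular (upperUnipotent β) (Γ-upper m) (const b) (const (b F.+ β₀)) (mat-≈
          (solve 2 (λ b m → :1 :* :1 :+ b :* :0 := :1 :* :1 :+ m :* :0) A.refl (const b) m)
          (A.trans (A.+-congʳ {const b * 1ᴬ} (A.*-congˡ {1ᴬ} β≈)) (A.trans
            (solve 4 (λ b m p x → :1 :* (m :* p :+ x) :+ b :* :1 := :1 :* (b :+ x) :+ m :* p) A.refl (const b) m Π (const β₀))
            (A.+-congʳ {m * Π} (A.*-congˡ {1ᴬ} (A.sym (const-+ b β₀))))))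
          (solve 1 (λ p → :0 :* :1 :+ p :* :0 := :0 :* :1 :+ :1 :* :0) A.refl Π)
          (solve 3 (λ x p b → :0 :* x :+ p :* :1 := :0 :* b :+ :1 :* p) A.refl β Π (const (b F.+ β₀)))) r s

      -- The cosets are indexed by t = 1/b ∈ ℙ¹(𝔽), with the diagonal matrix at t = 0 and b = 0 at t = ∞;
      -- in this coordinate a lower unipotent matrix acts by a translation.
      slot : F.Carrier → ℙ¹ → ℙ¹ → Symbol
      slot t r s = if does (t F.≟ F.0#) then image diagonal r s else tri (recip t) r s

      slot-0 : ∀ {t} → t F.≈ F.0# → ∀ r s → slot t r s ≈ˢ image diagonal r s
      slot-0 {t} t≈0 r s = if-yes (t F.≟ F.0#) (image diagonal r s) (tri (recip t) r s) t≈0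

      slot-≉0 : ∀ {t} → ¬ (t F.≈ F.0#) → ∀ r s → slot t r s ≈ˢ tri (recip t) r s
      slot-≉0 {t} t≉0 r s = if-no (t F.≟ F.0#) (image diagonal r s) (tri (recip t) r s) t≉0

      slot-cong : ∀ {t t′} → t F.≈ t′ → ∀ r s → slot t r s ≈ˢ slot t′ r s
      slot-cong {t} {t′} t≈t′ r s = compare (t F.≟ F.0#)
        where
        compare : Dec (t F.≈ F.0#) → slot t r s ≈ˢ slot t′ r s
        compare (yes t≈0) = G.trans (slot-0 t≈0 r s) (G.sym (slot-0 (F.trans (F.sym t≈t′) t≈0) r s))
        compare (no  t≉0) = G.trans (slot-≉0 t≉0 r s) (G.trans (tri-cong (recip-cong t≈t′) r s)
          (G.sym (slot-≉0 (λ t′≈0 → t≉0 (F.trans t≈t′ t′≈0)) r s)))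

      -- Under b = `recip t` the term t = 0 is the matrix with b = 0. Exchanging it with the
      -- diagonal one puts the latter at t = 0 and leaves b = 0 as the separate term at infinity.
      H≈slots : ∀ r s → H r s ≈ˢ ∑ F.elements (λ t → slot t r s) ∙ tri F.0# r s
      H≈slots r s = begin
        image diagonal r s ∙ ∑ F.elements (λ b → tri b r s)
          ≈⟨ G.comm (image diagonal r s) (∑ F.elements (λ b → tri b r s)) ⟩
        ∑ F.elements (λ b → tri b r s) ∙ image diagonal r s
          ≈⟨ G.∙-congʳ (∑-reindex (λ e → tri-cong e r s) recip recip
               (λ d e eq → F.trans (F.sym (recip-involutive d)) (recip-cong eq)) (λ d e eq → F.trans (recip-cong eq) (recip-involutive e))) ⟨
        ∑ F.elements (λ t → tri (recip t) r s) ∙ image diagonal r s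
          ≈⟨ ∑-exchange F.0# (tri F.0# r s) (image diagonal r s)
               (λ t t≈0 → tri-cong (recip-zero t≈0) r s , slot-0 t≈0 r s) (λ t t≉0 → G.sym (slot-≉0 t≉0 r s)) ⟩
        ∑ F.elements (λ t → slot t r s) ∙ tri F.0# r s ∎
        where open SetoidReasoning G.setoid

      private
        -- Equality modulo relations: the cofactor `k` certifies that l - r is a multiple of x - y,
        -- which is a polynomial identity the ring solver can check.
        cancel₁ : ∀ {l r x y} k → l ≈ r + k * (x A.- y) → x ≈ y → l ≈ r
        cancel₁ {l} {r} {x} {y} k e x≈y = A.trans e (A.trans (A.+-congˡ {r} (A.*-congˡ {k} (A.+-congʳ { - y } x≈y)))
          (solve 3 (λ r k y → r :+ k :* (y :- y) := r) A.refl r k y))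

        cancel₂ : ∀ {l r x y x′ y′} k k′ → l ≈ r + k * (x A.- y) + k′ * (x′ A.- y′) → x ≈ y → x′ ≈ y′ → l ≈ r
        cancel₂ k k′ e x≈y x′≈y′ = cancel₁ k (cancel₁ k′ e x′≈y′) x≈y

        cancel₃ : ∀ {l r x y x′ y′ x″ y″} k k′ k″ → l ≈ r + k * (x A.- y) + k′ * (x′ A.- y′) + k″ * (x″ A.- y″) →
                  x ≈ y → x′ ≈ y′ → x″ ≈ y″ → l ≈ r
        cancel₃ k k′ k″ e e₁ e₂ e₃ = cancel₂ k k′ (cancel₁ k″ e e₃) e₁ e₂

        ∣-respʳ : ∀ {x y} → x ≈ y → ⟪ gen 𝔫 ⟫ x → ⟪ gen 𝔫 ⟫ y
        ∣-respʳ x≈y (s , sn≈x) = s , A.trans sn≈x x≈y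

        -- Π is invertible modulo 𝔫: multiplying xΠ + yn = 1 by m expresses m through mΠ and n.
        multiple∈𝔫 : ∀ {m} → ⟪ gen 𝔫 ⟫ (m * Π) → ⟪ gen 𝔫 ⟫ m
        multiple∈𝔫 {m} (s , sn≈mΠ) with combination₂ (monic1∤⇒comaximal (linear a) P∤𝔫)
        ... | x , y , xΠ+yn≈1 = x * s + m * y , A.trans
          (solve 5 (λ x s m y n → (x :* s :+ m :* y) :* n := x :* (s :* n) :+ m :* (y :* n)) A.refl x s m y (gen 𝔫))
          (A.trans (A.+-congʳ {m * (y * gen 𝔫)} (A.*-congˡ {x} sn≈mΠ))
          (A.trans (solve 5 (λ x m p y n → x :* (m :* p) :+ m :* (y :* n) := m :* (x :* p :+ y :* n)) A.refl x m Π y (gen 𝔫))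
          (A.trans (A.*-congˡ {m} xΠ+yn≈1) (A.*-identityʳ m))))

        Π*∈𝔫 : ∀ {c} → ⟪ gen 𝔫 ⟫ c → ⟪ gen 𝔫 ⟫ (Π * c)
        Π*∈𝔫 {c} (s , sn≈c) = Π * s , A.trans (A.*-assoc Π s (gen 𝔫)) (A.*-congˡ {Π} sn≈c)

        -- In lower-ij, i and j record whether t and t′ = t + c mod Π are zero.
        module _ {c m : Poly} (c∈𝔫 : ⟪ gen 𝔫 ⟫ c) where

          lower-∞ : ∀ r s → image (triangular 0ᴬ) (ιᴳ (lowerUnipotent c) · r) (ιᴳ (lowerUnipotent c) · s) ≈ˢ image (triangular 0ᴬ) r s
          lower-∞ = triangular→triangular (lowerUnipotent c) (γ₀ (lowerUnipotent (Π * c)) (Π*∈𝔫 c∈𝔫)) 0ᴬ 0ᴬ (mat-≈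
            (solve 1 (λ c → :1 :* :1 :+ :0 :* c := :1 :* :1 :+ :0 :* :0) A.refl c)
            (solve 1 (λ p → :1 :* :0 :+ :0 :* :1 := :1 :* :0 :+ :0 :* p) A.refl Π)
            (solve 2 (λ p c → :0 :* :1 :+ p :* c := p :* c :* :1 :+ :1 :* :0) A.refl Π c)
            (solve 2 (λ p c → :0 :* :0 :+ p :* :1 := p :* c :* :0 :+ :1 :* p) A.refl Π c))

          lower-00 : c ≈ m * Π → ∀ r s → image diagonal (ιᴳ (lowerUnipotent c) · r) (ιᴳ (lowerUnipotent c) · s) ≈ˢ image diagonal r s
          lower-00 c≈ = diagonal→diagonal (lowerUnipotent c) (γ₀ (lowerUnipotent m) (multiple∈𝔫 (∣-respʳ c≈ c∈𝔫))) (mat-≈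
            (solve 2 (λ p c → p :* :1 :+ :0 :* c := :1 :* p :+ :0 :* :0) A.refl Π c)
            (solve 1 (λ p → p :* :0 :+ :0 :* :1 := :1 :* :0 :+ :0 :* :1) A.refl Π)
            (A.trans (A.+-congˡ {0ᴬ * 1ᴬ} (A.*-congˡ {1ᴬ} c≈)) (solve 2 (λ m p → :0 :* :1 :+ :1 :* (m :* p) := m :* p :+ :1 :* :0) A.refl m Π))
            (solve 1 (λ m → :0 :* :0 :+ :1 :* :1 := m :* :0 :+ :1 :* :1) A.refl m))

          lower-0t : ∀ {b′ t′} → b′ * t′ ≈ 1ᴬ → c ≈ m * Π + t′ → ∀ r s →
                     image diagonal (ιᴳ (lowerUnipotent c) · r) (ιᴳ (lowerUnipotent c) · s) ≈ˢ image (triangular b′) r s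
          lower-0t {b′} {t′} b′t′≈1 c≈ = diagonal→triangular (lowerUnipotent c)
            -- The lower-right entry of M δ M′⁻¹ is (1 - b′c)/Π, which equals -m b′ since c = mΠ +
            -- t′ and b′t′ = 1.
            (γ₀ (gl (mat Π (- b′) c (- (m * b′))) (isUnit 1ᴬ (cancel₂ b′ 1ᴬ
              (solve 5 (λ p b′ c m t′ → :1 :* (p :* (:- (m :* b′)) :- (:- b′) :* c)
                := :1 :+ b′ :* (c :- (m :* p :+ t′)) :+ :1 :* (b′ :* t′ :- :1)) A.refl Π b′ c m t′) c≈ b′t′≈1))) c∈𝔫) b′ (mat-≈
            (solve 3 (λ p b′ c → p :* :1 :+ :0 :* c := p :* :1 :+ (:- b′) :* :0) A.refl Π b′ c)
            (solve 2 (λ p b′ → p :* :0 :+ :0 :* :1 := p :* b′ :+ (:- b′) :* p) A.refl Π b′)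
            (solve 3 (λ m b′ c → :0 :* :1 :+ :1 :* c := c :* :1 :+ (:- (m :* b′)) :* :0) A.refl m b′ c)
            (cancel₂ (- b′) (- 1ᴬ) (solve 5 (λ p b′ c m t′ → :0 :* :0 :+ :1 :* :1
                := (c :* b′ :+ (:- (m :* b′)) :* p) :+ (:- b′) :* (c :- (m :* p :+ t′)) :+ (:- :1) :* (b′ :* t′ :- :1)) A.refl Π b′ c m t′) c≈ b′t′≈1))

          lower-t0 : ∀ {b t} → b * t ≈ 1ᴬ → c ≈ m * Π A.- t → ∀ r s →
                     image (triangular b) (ιᴳ (lowerUnipotent c) · r) (ιᴳ (lowerUnipotent c) · s) ≈ˢ image diagonal r s
          lower-t0 {b} {t} bt≈1 c≈ = triangular→diagonal (lowerUnipotent c)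
            -- The upper-left entry of M δ M′⁻¹ is (1 + bc)/Π, which equals b m since c = mΠ - t and
            -- bt = 1.
            (γ₀ (gl (mat (b * m) b c Π) (isUnit 1ᴬ (cancel₂ (- b) 1ᴬ
              (solve 5 (λ p b c m t → :1 :* ((b :* m) :* p :- b :* c)
                := :1 :+ (:- b) :* (c :- (m :* p :- t)) :+ :1 :* (b :* t :- :1)) A.refl Π b c m t) c≈ bt≈1))) c∈𝔫) b (mat-≈
            (cancel₂ b (- 1ᴬ) (solve 5 (λ p b c m t → :1 :* :1 :+ b :* c
                := ((b :* m) :* p :+ b :* :0) :+ b :* (c :- (m :* p :- t)) :+ (:- :1) :* (b :* t :- :1)) A.refl Π b c m t) c≈ bt≈1)
            (solve 2 (λ b m → :1 :* :0 :+ b :* :1 := (b :* m) :* :0 :+ b :* :1) A.refl b m)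
            (solve 2 (λ p c → :0 :* :1 :+ p :* c := c :* p :+ p :* :0) A.refl Π c)
            (solve 2 (λ p c → :0 :* :0 :+ p :* :1 := c :* :0 :+ p :* :1) A.refl Π c))

          lower-tt : ∀ {b t b′ t′} → b * t ≈ 1ᴬ → b′ * t′ ≈ 1ᴬ → c ≈ m * Π + (t′ A.- t) → ∀ r s →
                     image (triangular b) (ιᴳ (lowerUnipotent c) · r) (ιᴳ (lowerUnipotent c) · s) ≈ˢ image (triangular b′) r s
          lower-tt {b} {t} {b′} {t′} bt≈1 b′t′≈1 c≈ = triangular→triangular (lowerUnipotent c)
            -- The upper-right entry of M δ M′⁻¹ is (b - b′ - bb′c)/Π. As bb′(t′ - t) = b - b′, it
            -- equals -bb′m.
            (γ₀ (gl (mat (1ᴬ + b * c) (- (b * b′ * m)) (Π * c) (1ᴬ A.- b′ * c)) (isUnit 1ᴬ (cancel₃ (- (b * b′ * c)) (b′ * c) (- (b * c))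
              (solve 7 (λ p b c m t b′ t′ → :1 :* ((:1 :+ b :* c) :* (:1 :- b′ :* c) :- (:- (b :* b′ :* m)) :* (p :* c))
                := :1 :+ (:- (b :* b′ :* c)) :* (c :- (m :* p :+ (t′ :- t))) :+ (b′ :* c) :* (b :* t :- :1) :+ (:- (b :* c)) :* (b′ :* t′ :- :1))
                A.refl Π b c m t b′ t′) c≈ bt≈1 b′t′≈1))) (Π*∈𝔫 c∈𝔫)) b b′ (mat-≈
            (solve 4 (λ b c b′ m → :1 :* :1 :+ b :* c := (:1 :+ b :* c) :* :1 :+ (:- (b :* b′ :* m)) :* :0) A.refl b c b′ m)
            (cancel₃ (- (b * b′)) b′ (- b) (solve 7 (λ p b c m t b′ t′ → :1 :* :0 :+ b :* :1
                := ((:1 :+ b :* c) :* b′ :+ (:- (b :* b′ :* m)) :* p) :+ (:- (b :* b′)) :* (c :- (m :* p :+ (t′ :- t)))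
                   :+ b′ :* (b :* t :- :1) :+ (:- b) :* (b′ :* t′ :- :1)) A.refl Π b c m t b′ t′) c≈ bt≈1 b′t′≈1)
            (solve 3 (λ p b′ c → :0 :* :1 :+ p :* c := p :* c :* :1 :+ (:1 :- b′ :* c) :* :0) A.refl Π b′ c)
            (solve 3 (λ p b′ c → :0 :* :0 :+ p :* :1 := p :* c :* b′ :+ (:1 :- b′ :* c) :* p) A.refl Π b′ c))

      -- The translation is by c₀, the residue of c modulo Π. The correcting matrices γ have
      -- lower-left entry c, Πc or, when the diagonal coset is fixed, c/Π; all three lie in 𝔫
      -- because c does.
      H-lower : ∀ {c} → ⟪ gen 𝔫 ⟫ c → ∀ r s → H (ιᴳ (lowerUnipotent c) · r) (ιᴳ (lowerUnipotent c) · s) ≈ˢ H r s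
      H-lower {c} c∈𝔫 r s = begin
        H λr λs
          ≈⟨ H≈slots λr λs ⟩
        ∑ F.elements (λ t → slot t λr λs) ∙ tri F.0# λr λs
          ≈⟨ G.∙-cong (∑-cong F.elements (λ t → shift t (t F.≟ F.0#) ((t F.+ c₀) F.≟ F.0#))) at-∞ ⟩
        ∑ F.elements (λ t → slot (t F.+ c₀) r s) ∙ tri F.0# r s
          ≈⟨ G.∙-congʳ (∑-reindex (λ e → slot-cong e r s) (F._+ c₀) (F._- c₀)
               (λ d e e₁ → F.trans (F.sym (FS.solve 2 (λ d b → (d FS.:+ b) FS.:- b FS.:= d) F.refl d c₀)) (F.+-congʳ e₁))
               (λ d e e₁ → F.trans (F.+-congʳ e₁) (FS.solve 2 (λ d b → (d FS.:- b) FS.:+ b FS.:= d) F.refl e c₀))) ⟩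
        ∑ F.elements (λ t → slot t r s) ∙ tri F.0# r s
          ≈⟨ H≈slots r s ⟨
        H r s ∎
        where
        open SetoidReasoning G.setoid
        module FS = CommutativeRingSolver F.commutativeRing
        λr λs : ℙ¹
        λr = ιᴳ (lowerUnipotent c) · r
        λs = ιᴳ (lowerUnipotent c) · s
        m : Poly
        m = proj₁ (residue (linear a) c)
        c₀ : F.Carrier
        c₀ = proj₁ (proj₂ (residue (linear a) c))
        c≈ : c ≈ m * Π + const c₀
        c≈ = proj₂ (proj₂ (residue (linear a) c))
        unit : ∀ {t} → ¬ (t F.≈ F.0#) → const (recip t) * const t ≈ 1ᴬ
        unit t≉0 = const-unit (recip-inverse t≉0)
        tri-0 : ∀ r s → tri F.0# r s ≈ˢ image (triangular 0ᴬ) r s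
        tri-0 r s = image-cong (triangular-invertible (const F.0#)) (triangular-invertible 0ᴬ) r s
          (mat-≈ A.refl (const-0 F.refl) A.refl A.refl)
        at-∞ : tri F.0# λr λs ≈ˢ tri F.0# r s
        at-∞ = G.trans (tri-0 λr λs) (G.trans (lower-∞ {m = 0ᴬ} c∈𝔫 r s) (G.sym (tri-0 r s)))
        c₀≈0 : ∀ {t} → t F.≈ F.0# → t F.+ c₀ F.≈ F.0# → c₀ F.≈ F.0#
        c₀≈0 t≈0 t+c₀≈0 = F.trans (F.sym (F.+-identityˡ c₀)) (F.trans (F.+-congʳ (F.sym t≈0)) t+c₀≈0)
        const-c₀ : ∀ t → const c₀ ≈ const (t F.+ c₀) A.- const t
        const-c₀ t = A.trans (solve 2 (λ t c → c := (t :+ c) :- t) A.refl (const t) (const c₀)) (A.+-congʳ { - const t } (A.sym (const-+ t c₀)))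
        c≈+ : ∀ {x} → const c₀ ≈ x → c ≈ m * Π + x
        c≈+ e = A.trans c≈ (A.+-congˡ {m * Π} e)
        shift : ∀ t → Dec (t F.≈ F.0#) → Dec (t F.+ c₀ F.≈ F.0#) → slot t λr λs ≈ˢ slot (t F.+ c₀) r s
        shift t (yes t≈0) (yes t′≈0) = G.trans (slot-0 t≈0 λr λs) (G.trans
          (lower-00 c∈𝔫 (A.trans (c≈+ (const-0 (c₀≈0 t≈0 t′≈0))) (A.+-identityʳ (m * Π))) r s) (G.sym (slot-0 t′≈0 r s)))
        shift t (yes t≈0) (no t′≉0) = G.trans (slot-0 t≈0 λr λs) (G.trans
          (lower-0t c∈𝔫 (unit t′≉0) (c≈+ (const-cong (F.trans (F.sym (F.+-identityˡ c₀)) (F.+-congʳ (F.sym t≈0))))) r s)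
          (G.sym (slot-≉0 t′≉0 r s)))
        shift t (no t≉0) (yes t′≈0) = G.trans (slot-≉0 t≉0 λr λs) (G.trans
          (lower-t0 c∈𝔫 (unit t≉0) (c≈+ (A.trans (const-c₀ t) (A.trans (A.+-congʳ { - const t } (const-0 t′≈0)) (A.+-identityˡ (- const t))))) r s)
          (G.sym (slot-0 t′≈0 r s)))
        shift t (no t≉0) (no t′≉0) = G.trans (slot-≉0 t≉0 λr λs) (G.trans
          (lower-tt c∈𝔫 (unit t≉0) (unit t′≉0) (c≈+ (const-c₀ t)) r s) (G.sym (slot-≉0 t′≉0 r s)))

    -- The identity for every symbol map in which q-fold sums vanish.

    module MainIdentity (P∤𝔫 : ∀ (P : Monic 1) → ¬ (poly P ∣ gen 𝔫)) (∑-constant≈ε : ∀ z → ∑ F.elements (λ _ → z) ≈ˢ ε) (u : Monic 1) where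
      module L a = Linear a (P∤𝔫 (linear a))

      private
        μ : Poly
        μ = poly u

        μ≉0 : ¬ (μ ≈ 0ᴬ)
        μ≉0 = monic≉0 u

        u₀ : F.Carrier
        u₀ = coeff μ 0

        lin≉0 : ∀ a → ¬ ((a ∷ 1ᴬ) ≈ 0ᴬ)
        lin≉0 a = monic≉0 (linear a)

        product≉0 : ∀ a → ¬ ((a ∷ 1ᴬ) * μ ≈ 0ᴬ)
        product≉0 a = *-≉0 (lin≉0 a) μ≉0

        Z Wᵤ : Symbol
        Z  = ⟦ frac 0ᴬ 1ᴬ 1≉0 ⟧
        Wᵤ = ⟦ frac 1ᴬ μ μ≉0 ⟧

        -- With P = T + a, these are W_P, {P/u} and x(Pu : 1). The last arises twice: from the
        -- matrix (1 0; 0 P) and from v = 1.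
        W Vᵤ Q : F.Carrier → Symbol
        W a = ⟦ frac 1ᴬ (a ∷ 1ᴬ) (lin≉0 a) ⟧
        Vᵤ a = ⟦ frac (a ∷ 1ᴬ) μ μ≉0 ⟧
        Q a = ⟦ frac 1ᴬ ((a ∷ 1ᴬ) * μ) (product≉0 a) ⟧ - Z

        -- This is E(P, v) with t = P - v, a constant when v is linear.
        E : F.Carrier → F.Carrier → Symbol
        E a t = ⟦ frac (const t + μ) ((a ∷ 1ᴬ) * μ) (product≉0 a) ⟧

        ⟦⟧-cancel : ∀ {X Y X′ Y′} Y≉0 Y′≉0 t → ¬ (t ≈ 0ᴬ) → X′ ≈ t * X → Y′ ≈ t * Y → ⟦ frac X′ Y′ Y′≉0 ⟧ ≈ˢ ⟦ frac X Y Y≉0 ⟧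
        ⟦⟧-cancel Y≉0 Y′≉0 t t≉0 eX eY = ⟦⟧-cong (P.sym (frac-cancel Y≉0 Y′≉0 t t≉0 eX eY))

        ⟦⟧-resp : ∀ {X Y X′ Y′} Y≉0 Y′≉0 → X′ ≈ X → Y′ ≈ Y → ⟦ frac X′ Y′ Y′≉0 ⟧ ≈ˢ ⟦ frac X Y Y≉0 ⟧
        ⟦⟧-resp {X} {Y} Y≉0 Y′≉0 eX eY = ⟦⟧-cancel Y≉0 Y′≉0 1ᴬ 1≉0 (A.trans eX (A.sym (A.*-identityˡ X))) (A.trans eY (A.sym (A.*-identityˡ Y)))

        E-cong : ∀ a {t t′} → t F.≈ t′ → E a t ≈ˢ E a t′
        E-cong a t≈t′ = ⟦⟧-resp (product≉0 a) (product≉0 a) (A.+-congʳ {μ} (const-cong t≈t′)) A.refl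

        W-cong : ∀ {a a′} → a F.≈ a′ → W a ≈ˢ W a′
        W-cong {a} {a′} a≈a′ = ⟦⟧-resp (lin≉0 a′) (lin≉0 a) A.refl (linear-cong a≈a′)

        -- The case v = P, where the fraction u/(Pu) reduces to 1/P.
        E-0 : ∀ a {t} → t F.≈ F.0# → E a t ≈ˢ W a
        E-0 a {t} t≈0 = ⟦⟧-cancel (lin≉0 a) (product≉0 a) μ μ≉0
          (A.trans (A.+-congʳ {μ} (const-0 t≈0)) (A.trans (A.+-identityˡ μ) (A.sym (A.*-identityʳ μ)))) (A.*-comm (a ∷ 1ᴬ) μ)

        -- The case v = u, where the fraction P/(Pu) reduces to 1/u.
        E-Wᵤ : ∀ a {t} → const t + μ ≈ (a ∷ 1ᴬ) → E a t ≈ˢ Wᵤ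
        E-Wᵤ a e = ⟦⟧-cancel μ≉0 (product≉0 a) (a ∷ 1ᴬ) (lin≉0 a) (A.trans e (A.sym (A.*-identityʳ _))) A.refl

        V-u : ∀ {a} → a F.≈ u₀ → Vᵤ a ≈ˢ Z
        V-u {a} a≈u₀ = G.trans (G.sym (⟦⟧-upper μ≉0 1ᴬ 1ᴬ 1ᴬ (A.*-identityˡ 1ᴬ)
            (A.trans (A.trans (linear-cong a≈u₀) (A.sym (monic1≈linear u))) (solve 1 (λ m → m := :1 :* :0 :+ :1 :* m) A.refl μ))))
          (⟦⟧-cancel 1≉0 μ≉0 μ μ≉0 (A.sym (A.zeroʳ μ)) (A.sym (A.*-identityʳ μ)))

        -- P - u is a non-zero constant, so P/u = (P - u)/u + 1 is obtained from 1/u by an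
        -- admissible affine map.
        V-≉u : ∀ {a} → ¬ (a F.≈ u₀) → Vᵤ a ≈ˢ Wᵤ
        V-≉u {a} a≉u₀ = G.sym (⟦⟧-upper μ≉0 (const (a F.- u₀)) (const (recip (a F.- u₀))) 1ᴬ (const-unit (recip-inverse (difference≉0 a≉u₀)))
          (A.trans (linear-difference a u₀) (A.+-cong (A.sym (A.*-identityʳ _)) (A.trans (A.sym (monic1≈linear u)) (A.sym (A.*-identityˡ μ))))))

        -- The contribution of the unit ideal stands in for the summand missing at P = u, which
        -- completes q equal terms.
        ∑[V-Z] : ∑ F.elements (λ a → Vᵤ a - Z) ∙ (Wᵤ - Z) ≈ˢ ε
        ∑[V-Z] = G.trans (∑-exchange u₀ ε (Wᵤ - Z)
            (λ a a≈u₀ → G.trans (G.∙-congʳ (V-u a≈u₀)) (G.inverseʳ Z) , G.refl)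
            (λ a a≉u₀ → G.∙-congʳ (V-≉u a≉u₀)))
          (G.trans (G.identityʳ _) (∑-constant≈ε (Wᵤ - Z)))

      Ξ[u∶1] : Ξ₁ μ ≈ˢ Wᵤ - Z
      Ξ[u∶1] = Ξ₁-fractions μ (lowerUnipotent μ) 1≉0 μ≉0 A.refl A.refl A.refl A.refl A.refl A.refl

      private
        f₀ f∞ : ℙ¹
        f₀ = frac 0ᴬ 1ᴬ 1≉0
        f∞ = frac 1ᴬ μ μ≉0

      H-representative : ∀ {g₁} → UnipotentFactorisation μ g₁ → ∀ a → L.H a (ιᴳ g₁ · 𝟎) (ιᴳ g₁ · ∞) ≈ˢ L.H a f₀ f∞
      H-representative {g₁} factorisation a = begin
        L.H a (ιᴳ g₁ · 𝟎) (ιᴳ g₁ · ∞)       ≈⟨ L.H-cong a (factors 𝟎) (factors ∞) ⟨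
        L.H a (τ · λ₁ · r) (τ · λ₁ · s)      ≈⟨ L.H-upper a b (λ₁ · r) (λ₁ · s) ⟩
        L.H a (λ₁ · r) (λ₁ · s)              ≈⟨ L.H-lower a m∈𝔫 r s ⟩
        L.H a r s                            ≈⟨ L.H-cong a (·-𝟎 (matrix g) (ιᴹ-invertible _ (GL₂.invertible g)) 1≉0 A.refl A.refl)
                                                            (·-∞ (matrix g) (ιᴹ-invertible _ (GL₂.invertible g)) μ≉0 A.refl A.refl) ⟩
        L.H a f₀ f∞                          ∎
        where
        open SetoidReasoning G.setoid
        open UnipotentFactorisation factorisation
        τ λ₁ : GL₂K.GL₂
        τ  = ιᴳ (upperUnipotent b)
        λ₁ = ιᴳ (lowerUnipotent m)
        g : GL₂
        g = lowerUnipotent μ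
        r s : ℙ¹
        r = ιᴳ g · 𝟎
        s = ιᴳ g · ∞

      private
        module _ (a : F.Carrier) where
          Π : Poly
          Π = a ∷ 1ᴬ

          image-fractions : ∀ M i {X₀ Y₀ X∞ Y∞} Y₀≉0 Y∞≉0 t → ¬ (t ≈ 0ᴬ) → t * X₀ ≈ a₁₂ M → t * Y₀ ≈ a₂₂ M →
            X∞ ≈ a₁₁ M + a₁₂ M * μ → Y∞ ≈ a₂₁ M + a₂₂ M * μ →
            image (GL₂K.gl (ιᴹ M) i) f₀ f∞ ≈ˢ ⟦ frac X∞ Y∞ Y∞≉0 ⟧ - ⟦ frac X₀ Y₀ Y₀≉0 ⟧
          image-fractions M i Y₀≉0 Y∞≉0 t t≉0 eX₀ eY₀ eX∞ eY∞ = G.trans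
            (⇒-cong (·-point M i (nonzero f₀) Y₀≉0 t t≉0 (second eX₀) (second eY₀)) (·-point M i (nonzero f∞) Y∞≉0 1ᴬ 1≉0 (first eX∞) (first eY∞)))
            (⇒-from ∞ _ _)
            where
            second : ∀ {x y z} → x ≈ z → x ≈ y * 0ᴬ + z * 1ᴬ
            second {x} {y} {z} e = A.trans e (solve 2 (λ y z → z := y :* :0 :+ z :* :1) A.refl y z)
            first : ∀ {x y z} → x ≈ y + z * μ → 1ᴬ * x ≈ y * 1ᴬ + z * μ
            first {x} {y} {z} e = A.trans (A.*-identityˡ x) (A.trans e (A.+-congʳ {z * μ} (A.sym (A.*-identityʳ y))))

          diagonal-value : image (L.diagonal a) f₀ f∞ ≈ˢ Vᵤ a - Z
          diagonal-value = image-fractions (mat Π 0ᴬ 0ᴬ 1ᴬ) (upperTriangular-invertible 0ᴬ (lin≉0 a) 1≉0) 1≉0 μ≉0 1ᴬ 1≉0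
            (A.*-identityˡ 0ᴬ) (A.*-identityˡ 1ᴬ)
            (solve 2 (λ p m → p := p :+ :0 :* m) A.refl Π μ) (solve 1 (λ m → m := :0 :+ :1 :* m) A.refl μ)

          tri-0-value : L.tri a F.0# f₀ f∞ ≈ˢ Q a
          -- The image of 0 is (0 : Π), so the common factor `Π` is cancelled to reach 0/1.
          tri-0-value = image-fractions (mat 1ᴬ (const F.0#) 0ᴬ Π) (upperTriangular-invertible (const F.0#) 1≉0 (lin≉0 a)) 1≉0 (product≉0 a) Π (lin≉0 a)
            (A.trans (A.zeroʳ Π) (A.sym (const-0 F.refl))) (A.*-identityʳ Π)
            (A.sym (A.trans (A.+-congˡ {1ᴬ} (A.*-congʳ {μ} (const-0 F.refl))) (solve 1 (λ m → :1 :+ :0 :* m := :1) A.refl μ)))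
            (A.sym (A.+-identityˡ (Π * μ)))

          -- The matrix (1 b; 0 P) sends 0 to b/P and 1/u to (1 + bu)/(Pu). Multiplying both by the
          -- constant t = 1/b gives 1/P and (t + u)/(Pu) without changing the symbols.
          tri-value : ∀ {t} → ¬ (t F.≈ F.0#) → L.tri a (recip t) f₀ f∞ ≈ˢ E a t - W a
          tri-value {t} t≉0 = G.trans
            (image-fractions (mat 1ᴬ b 0ᴬ Π) (upperTriangular-invertible b 1≉0 (lin≉0 a)) (lin≉0 a) (product≉0 a) 1ᴬ 1≉0
              (A.*-identityˡ b) (A.*-identityˡ Π) A.refl (A.sym (A.+-identityˡ (Π * μ))))
            (G.∙-cong (⟦⟧-upper (product≉0 a) (const t) b 0ᴬ bt≈1 (A.sym (A.trans
                (solve 4 (λ t b m p → t :* (:1 :+ b :* m) :+ :0 :* p := t :+ (b :* t) :* m) A.refl (const t) b μ (Π * μ))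
                (A.+-congˡ {const t} (A.trans (A.*-congʳ {μ} bt≈1) (A.*-identityˡ μ))))))
              (G.⁻¹-cong (⟦⟧-upper (lin≉0 a) (const t) b 0ᴬ bt≈1 (A.sym (A.trans
                (solve 3 (λ t b p → t :* b :+ :0 :* p := b :* t) A.refl (const t) b Π) bt≈1)))))
            where
            b : Poly
            b = const (recip t)
            bt≈1 : b * const t ≈ 1ᴬ
            bt≈1 = const-unit (recip-inverse t≉0)

          -- At t = 0 the slot holds the diagonal coset, of value `Vᵤ a - Z`, while `E a t - W a`
          -- vanishes there. Exchanging this one term extends the sum over E to all t, and b = 0
          -- contributes `Q a`.
          H-value : L.H a f₀ f∞ ≈ˢ (∑ F.elements (λ t → E a t - W a) ∙ (Vᵤ a - Z)) ∙ Q a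
          H-value = G.trans (L.H≈slots a f₀ f∞) (G.∙-cong
            (G.trans (G.sym (G.identityʳ _)) (∑-exchange F.0# (Vᵤ a - Z) ε
              (λ t t≈0 → G.trans (L.slot-0 a t≈0 f₀ f∞) diagonal-value , G.trans (G.∙-congʳ (E-0 a t≈0)) (G.inverseʳ (W a)))
              (λ t t≉0 → G.trans (L.slot-≉0 a t≉0 f₀ f∞) (tri-value t≉0))))
            tri-0-value)

          Admissible-value : ∀ v {y} → (poly (proj₂ v) ≈ μ → y ≈ˢ ε) → (poly (proj₂ v) ≈ Π → y ≈ˢ ε) →
            (∀ (adm : Admissible u (linear a)) → Admissible.v adm ≡ v → Ξᴬ u (linear a) adm ≈ˢ y) →
            maybe (Ξᴬ u (linear a)) ε (admissible? u (linear a) v) ≈ˢ y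
          Admissible-value v {y} at-u at-P else = admissible?-elim u (linear a) v (λ m → maybe (Ξᴬ u (linear a)) ε m ≈ˢ y)
            (λ e → G.sym (at-u e)) (λ e → G.sym (at-P e)) else

          term : Monic≤ 1 → Symbol
          term v = maybe (Ξᴬ u (linear a)) ε (admissible? u (linear a) v)

          one≉monic : (f : Monic 1) → ¬ (1ᴬ ≈ poly f)
          one≉monic f (coeffs-≈ e) = F.1≉0 (F.trans (F.sym (IsMonic.leading≈1 (isMonic f))) (F.sym (e 1)))

          Ξ[Pu∶1] : ∀ (adm : Admissible u (linear a)) → Admissible.v adm ≡ one≤ → Ξᴬ u (linear a) adm ≈ˢ Q a
          Ξ[Pu∶1] adm e = Ξᴬ-fractions u (linear a) adm (lowerUnipotent (Π * μ)) 1≉0 (product≉0 a) A.refl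
            (A.reflexive (≡.cong (λ v → poly (proj₂ v)) e)) A.refl A.refl A.refl A.refl

          -- The top row is (P + u − v , 1), so that the determinant is (P + u − v) v − P u = (P − v)(v − u).
          Ξ[Pu∶linear] : ∀ a′ (adm : Admissible u (linear a)) → Admissible.v adm ≡ linear≤ a′ → Ξᴬ u (linear a) adm ≈ˢ E a (a F.- a′) - W a′
          Ξ[Pu∶linear] a′ adm e = Ξᴬ-fractions u (linear a) adm (gl (mat (const t + μ) 1ᴬ (Π * μ) v) (isUnit (const (recip t) * const (recip w)) det≈1))
            (lin≉0 a′) (product≉0 a) A.refl v≈ A.refl A.refl A.refl A.refl
            where
            t w : F.Carrier
            t = a F.- a′
            w = a′ F.- u₀
            v : Poly
            v = a′ ∷ 1ᴬ
            v≈ : poly (proj₂ (Admissible.v adm)) ≈ v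
            v≈ = A.reflexive (≡.cong (λ v → poly (proj₂ v)) e)
            t≉0 : ¬ (t F.≈ F.0#)
            t≉0 = difference≉0 (λ a≈a′ → Admissible.v≢P adm (A.trans v≈ (linear-cong (F.sym a≈a′))))
            w≉0 : ¬ (w F.≈ F.0#)
            w≉0 = difference≉0 (λ a′≈u₀ → Admissible.v≢u adm (A.trans v≈ (A.trans (linear-cong a′≈u₀) (A.sym (monic1≈linear u)))))
            v≈w+μ : v ≈ const w + μ
            v≈w+μ = A.trans (linear-difference a′ u₀) (A.+-congˡ {const w} (A.sym (monic1≈linear u)))
            det≈1 : const (recip t) * const (recip w) * ((const t + μ) * v A.- 1ᴬ * (Π * μ)) ≈ 1ᴬ
            det≈1 = begin
              const (recip t) * const (recip w) * ((const t + μ) * v A.- 1ᴬ * (Π * μ))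
                ≈⟨ A.*-congˡ {const (recip t) * const (recip w)} (A.+-congˡ {(const t + μ) * v} (A.-‿cong (A.*-congˡ {1ᴬ} (A.*-congʳ {μ} (linear-difference a a′))))) ⟩
              const (recip t) * const (recip w) * ((const t + μ) * v A.- 1ᴬ * ((const t + v) * μ))
                ≈⟨ solve 5 (λ t v m i j → i :* j :* ((t :+ m) :* v :- :1 :* ((t :+ v) :* m)) := (i :* t) :* (j :* (v :- m)))
                     A.refl (const t) v μ (const (recip t)) (const (recip w)) ⟩
              (const (recip t) * const t) * (const (recip w) * (v A.- μ))
                ≈⟨ A.*-cong (const-unit (recip-inverse t≉0)) (A.*-congˡ {const (recip w)} (A.trans (A.+-congʳ { - μ } v≈w+μ)
                     (solve 2 (λ w m → (w :+ m) :- m := w) A.refl (const w) μ))) ⟩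
              1ᴬ * (const (recip w) * const w)
                ≈⟨ A.trans (A.*-identityˡ _) (const-unit (recip-inverse w≉0)) ⟩
              1ᴬ ∎
              where open SetoidReasoning A.setoid

          term-one : term one≤ ≈ˢ Q a
          term-one = Admissible-value one≤ (λ e → contradiction e (one≉monic u)) (λ e → contradiction e (one≉monic (linear a))) Ξ[Pu∶1]

          -- For the excluded v = u and v = P the right-hand side vanishes, so the sum may run over all linear v.
          term-linear : ∀ a′ → term (linear≤ a′) ≈ˢ E a (a F.- a′) - W a′
          term-linear a′ = Admissible-value (linear≤ a′)
            (λ v≈u → G.trans (G.∙-congʳ (G.trans (E-Wᵤ a (A.trans (A.+-congˡ {const (a F.- a′)} (A.sym v≈u)) (A.sym (linear-difference a a′))))
              (⟦⟧-resp (lin≉0 a′) μ≉0 A.refl (A.sym v≈u)))) (G.inverseʳ (W a′)))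
            (λ v≈P → G.trans (G.∙-congʳ (G.trans (E-0 a (F.trans (F.+-congˡ (F.-‿cong (linear-injective v≈P))) (F.-‿inverseʳ a)))
              (W-cong (F.sym (linear-injective v≈P))))) (G.inverseʳ (W a′)))
            (Ξ[Pu∶linear] a′)

          ∑E : Symbol
          ∑E = ∑ F.elements (λ a′ → E a (a F.- a′))

          admissible-value : ∑ (admissible u (linear a)) (Ξᴬ u (linear a)) ≈ˢ Q a ∙ (∑E ∙ ∑ F.elements W ⁻¹)
          admissible-value = begin
            ∑ (admissible u (linear a)) (Ξᴬ u (linear a))
              ≈⟨ ∑-mapMaybe (admissible? u (linear a)) (monics≤ 1) (Ξᴬ u (linear a)) ⟩
            ∑ (monics≤ 1) term
              ≈⟨ ∑-monics≤₁ G term ⟩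
            term one≤ ∙ ∑ F.elements (λ a′ → term (linear≤ a′))
              ≈⟨ G.∙-cong term-one (∑-cong F.elements term-linear) ⟩
            Q a ∙ ∑ F.elements (λ a′ → E a (a F.- a′) - W a′)
              ≈⟨ G.∙-congˡ (∑-∙ F.elements (λ a′ → E a (a F.- a′)) (λ a′ → W a′ ⁻¹)) ⟩
            Q a ∙ (∑E ∙ ∑ F.elements (λ a′ → W a′ ⁻¹))
              ≈⟨ G.∙-congˡ (G.∙-congˡ (∑-⁻¹ F.elements W)) ⟩
            Q a ∙ (∑E ∙ ∑ F.elements W ⁻¹) ∎
            where open SetoidReasoning G.setoid

          H-sum : L.H a f₀ f∞ ≈ˢ (∑E ∙ (Vᵤ a - Z)) ∙ Q a
          H-sum = G.trans H-value (G.∙-congʳ (G.∙-congʳ (begin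
            ∑ F.elements (λ t → E a t - W a)
              ≈⟨ ∑-∙ F.elements (E a) (λ _ → W a ⁻¹) ⟩
            ∑ F.elements (E a) ∙ ∑ F.elements (λ _ → W a ⁻¹)
              ≈⟨ G.∙-congˡ (∑-constant≈ε (W a ⁻¹)) ⟩
            ∑ F.elements (E a) ∙ ε
              ≈⟨ G.identityʳ _ ⟩
            ∑ F.elements (E a)
              -- The substitution t = P - v passes from cosets to linear polynomials v.
              ≈⟨ ∑-reindex (E-cong a) (λ d → a F.- d) (λ d → a F.- d)
                   (λ d e eq → F.trans (flip d) (F.+-congˡ (F.-‿cong eq))) (λ d e eq → F.trans (F.+-congˡ (F.-‿cong eq)) (F.sym (flip e))) ⟨
            ∑E ∎)))
            where
            open SetoidReasoning G.setoid
            module FS = CommutativeRingSolver F.commutativeRing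
            flip : ∀ d → d F.≈ a F.- (a F.- d)
            flip d = FS.solve 2 (λ a d → d FS.:= a FS.:- (a FS.:- d)) F.refl a d

      step1 : ∀ {g₁} → UnipotentFactorisation μ g₁ → ∀ a → L.H a (ιᴳ g₁ · 𝟎) (ιᴳ g₁ · ∞) ≈ˢ (Vᵤ a - Z) ∙ (∑E a ∙ Q a)
      step1 {g₁} factorisation a = G.trans (H-representative factorisation a) (G.trans (H-sum a)
               (G.trans (G.∙-congʳ (G.comm (∑E a) (Vᵤ a - Z))) (G.assoc (Vᵤ a - Z) (∑E a) (Q a))))

      -- The sum of the W_v does not depend on P, so subtracting it once for each of the q choices
      -- of P changes nothing; this produces the terms -W_v of the symbols x(Pu : v).
      step2 : (Wᵤ - Z) ∙ ∑ F.elements (λ a → (Vᵤ a - Z) ∙ (∑E a ∙ Q a)) ≈ˢ ∑ F.elements (λ a → (∑E a ∙ Q a) ∙ ∑ F.elements W ⁻¹)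
      step2 = begin
        (Wᵤ - Z) ∙ ∑ F.elements (λ a → (Vᵤ a - Z) ∙ (∑E a ∙ Q a))
          ≈⟨ G.∙-congˡ (∑-∙ F.elements (λ a → Vᵤ a - Z) (λ a → ∑E a ∙ Q a)) ⟩
        (Wᵤ - Z) ∙ (∑ F.elements (λ a → Vᵤ a - Z) ∙ common)
          ≈⟨ G.assoc (Wᵤ - Z) (∑ F.elements (λ a → Vᵤ a - Z)) common ⟨
        ((Wᵤ - Z) ∙ ∑ F.elements (λ a → Vᵤ a - Z)) ∙ common
          ≈⟨ G.∙-congʳ (G.trans (G.comm (Wᵤ - Z) (∑ F.elements (λ a → Vᵤ a - Z))) ∑[V-Z]) ⟩
        ε ∙ common
          ≈⟨ G.comm ε common ⟩
        common ∙ ε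
          ≈⟨ G.∙-congˡ (∑-constant≈ε (∑ F.elements W ⁻¹)) ⟨
        common ∙ ∑ F.elements (λ _ → ∑ F.elements W ⁻¹)
          ≈⟨ ∑-∙ F.elements (λ a → ∑E a ∙ Q a) (λ _ → ∑ F.elements W ⁻¹) ⟨
        ∑ F.elements (λ a → (∑E a ∙ Q a) ∙ ∑ F.elements W ⁻¹) ∎
        where
        open SetoidReasoning G.setoid
        common : Symbol
        common = ∑ F.elements (λ a → ∑E a ∙ Q a)

      step3 : ∀ a → (∑E a ∙ Q a) ∙ ∑ F.elements W ⁻¹ ≈ˢ ∑ (admissible u (linear a)) (Ξᴬ u (linear a))
      step3 a = G.trans (G.∙-congʳ (G.comm (∑E a) (Q a))) (G.trans (G.assoc (Q a) (∑E a) _) (G.sym (admissible-value a)))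

      mainIdentity : ∀ {g₁} → UnipotentFactorisation μ g₁ → Ξ₁ μ ∙ ∑ F.elements (λ a → L.H a (ιᴳ g₁ · 𝟎) (ιᴳ g₁ · ∞)) ≈ˢ
                     ∑ F.elements (λ a → ∑ (admissible u (linear a)) (Ξᴬ u (linear a)))
      mainIdentity {g₁} factorisation = G.trans (G.∙-cong Ξ[u∶1] (∑-cong F.elements (step1 factorisation)))
        (G.trans step2 (∑-cong F.elements step3))

-- Hecke operators on modular symbols modulo p.

module Hecke {c ℓ q} (F : FiniteField c ℓ q) (𝔫 : Ideals.Ideal F) (p : ℕ) where
  open Polynomials F
  open Ideals F
  open LinearPolynomials F
  open MonicSums F
  open ModularSymbols F 𝔫 p
  open Points F 𝔫 p
  open Symbols F 𝔫 p
  open GL₂A using (mat-≈)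
  private
    module F = FiniteField F
    module A = CommutativeRing polynomialRing
    module P = IsEquivalence ≈ᴾ-isEquivalence
    module M = AbelianGroup 𝕄/p

  heckeMatrices : ∀ 𝔭 → HeckePair 𝔭 → List GL₂K.GL₂
  heckeMatrices 𝔭 ((_ , a) , (deg-d , d)) = map (heckeMatrix a d) (polysBelow (Fin.toℕ deg-d))

  -- Opaque, since unification in 𝕄/p itself would unfold divisors and their degree proofs.
  opaque
    𝔾 : AbelianGroup (c ⊔ ℓ) (c ⊔ ℓ)
    𝔾 = 𝕄/p

    class : M.Carrier → AbelianGroup.Carrier 𝔾
    class m = m

    class-injective : ∀ {m n} → AbelianGroup._≈_ 𝔾 (class m) (class n) → m M.≈ n
    class-injective e = e

    class-∑ : ∀ {i} {I : Set i} (is : List I) f → AbelianGroup._≈_ 𝔾 (class (AbelianGroups.∑ 𝕄/p is f)) (AbelianGroups.∑ 𝔾 is (λ i → class (f i)))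
    class-∑ is f = M.refl

    universal : SymbolMap 𝔾
    universal = record
      { _⇒_       = _⟶_
      ; ⇒-cong    = λ r≈r′ s≈s′ → ≈ᴰ⇒≈ (Divisors.div⁰-≈ (Divisors.div-≈ (prep s≈s′ (prep (P.sym r≈r′) ↭-refl))))
      ; ⇒-from    = λ t r s → ≈ᴰ⇒≈ (Divisors.div⁰-≈ (Divisors.div-≈ ↭-refl))
      ; invariant = λ γ r s → AbelianGroups.≈⇒≈[S] 𝕄 _ (AbelianGroups.congruent (AbelianGroups.gen
          (γ , (r ⟶ s) , Divisors.div⁰-≈ (Divisors.div-≈ ↭-refl))))
      }
      where
      open Permutation ℙ¹-setoid
      ≈ᴰ⇒≈ : ∀ {D E} → AbelianGroup._≈_ Div⁰ℙ¹ D E → D M.≈ E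
      ≈ᴰ⇒≈ D≈E = AbelianGroups.≈⇒≈[S] 𝕄 _ (AbelianGroups.≈⇒≈[S] Div⁰ℙ¹ _ D≈E)

  open AbelianGroup 𝔾 using (_∙_; ε) renaming (Carrier to Class; _≈_ to _≈ˢ_)
  open AbelianGroups 𝔾 using (∑)
  open SymbolMap universal using (_⇒_; ⇒-cong)
  open Sums 𝔾
  open FieldSums F 𝔾
  open Symbol universal
  private
    module G = AbelianGroup 𝔾

  opaque
    unfolding 𝔾

    multiple-of-p≈ε : ∀ n z → MonoidMult._×_ G.monoid (p ℕ.* n) z ≈ˢ ε
    multiple-of-p≈ε = /ℕ-multiple≈ε 𝕄 p

  opaque
    unfolding universal

    class-⟶ : ∀ r s → class (r ⟶ s) ≈ˢ r ⇒ s
    class-⟶ r s = M.refl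

    class-act : ∀ g r s → class (act g (r ⟶ s)) ≈ˢ image g r s
    class-act g r s = AbelianGroups.≈⇒≈[S] 𝕄 _ (AbelianGroups.≈⇒≈[S] Div⁰ℙ¹ _ (Divisors.div⁰-≈ (AbelianGroup.refl (Divisors.divisorGroup ℙ¹-setoid))))

  opaque
    heckeTerm : ∀ 𝔭 → ℙ¹ → ℙ¹ → HeckePair 𝔭 → Class
    heckeTerm 𝔭 r s k = if does (isHeckePair? 𝔭 k) then ∑ (heckeMatrices 𝔭 k) (λ g → image g r s) else ε

    heckeTerm-yes : ∀ 𝔭 r s k → IsHeckePair 𝔭 k → heckeTerm 𝔭 r s k ≈ˢ ∑ (heckeMatrices 𝔭 k) (λ g → image g r s)
    heckeTerm-yes 𝔭 r s k = if-yes (isHeckePair? 𝔭 k) (∑ (heckeMatrices 𝔭 k) (λ g → image g r s)) ε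

    heckeTerm-no : ∀ 𝔭 r s k → ¬ IsHeckePair 𝔭 k → heckeTerm 𝔭 r s k ≈ˢ ε
    heckeTerm-no 𝔭 r s k = if-no (isHeckePair? 𝔭 k) (∑ (heckeMatrices 𝔭 k) (λ g → image g r s)) ε

    class-T : ∀ {n} (f : Monic n) r s →
              class (T ⟨ f ⟩ (r ⟶ s)) ≈ˢ ∑ (monics≤ n) (λ a → ∑ (monics≤ n) (λ d → heckeTerm ⟨ f ⟩ r s (a , d)))
    class-T {n} f r s = G.trans (class-∑ (S ⟨ f ⟩) (λ g → act g (r ⟶ s)))
      (G.trans (∑-cong (S ⟨ f ⟩) (λ g → class-act g r s))
        (∑-concatMap-filter-cartesianProduct (isHeckePair? ⟨ f ⟩) (heckeMatrices ⟨ f ⟩) (monics≤ n) (monics≤ n) (λ g → image g r s)))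

  -- For the unit ideal a = d = 1, and 0 is the only polynomial b of degree below 0, so the operator
  -- consists of the identity matrix. It supplies the summand x(u : 1).
  class-T-unit : ∀ r s → class (T ⟨ proj₂ (one≤ {0}) ⟩ (r ⟶ s)) ≈ˢ r ⇒ s
  class-T-unit r s = begin
    class (T 𝔭 (r ⟶ s))                   ≈⟨ class-T (proj₂ (one≤ {0})) r s ⟩
    (heckeTerm 𝔭 r s (one≤ , one≤) ∙ ε) ∙ ε  ≈⟨ G.trans (G.identityʳ _) (G.identityʳ _) ⟩
    heckeTerm 𝔭 r s (one≤ , one≤)         ≈⟨ heckeTerm-yes 𝔭 r s (one≤ , one≤) (A.*-identityˡ 1ᴬ , comaximal-sym (unit-comaximal A.refl)) ⟩
    image h r s ∙ ε                        ≈⟨ G.identityʳ _ ⟩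
    image h r s                            ≈⟨ image-cong (upperTriangular-invertible [] 1≉0 1≉0) (ιᴹ-invertible _ GL₂A.1ᴹ-invertible) r s (mat-≈ A.refl A.refl A.refl A.refl) ⟩
    image (ιᴳ GL₂A.1ᴳ) r s                 ≈⟨ ⇒-cong (identity-acts r) (identity-acts s) ⟩
    r ⇒ s                                  ∎
    where
    open SetoidReasoning G.setoid
    𝔭 : Ideal
    𝔭 = ⟨ proj₂ (one≤ {0}) ⟩
    h : GL₂K.GL₂
    h = heckeMatrix (proj₂ (one≤ {0})) (proj₂ (one≤ {0})) []

  module _ (a : F.Carrier) (P∤𝔫 : ¬ ((a ∷ 1ᴬ) ∣ gen 𝔫)) where

    open Linear a P∤𝔫

    private
      𝔭 : Ideal
      𝔭 = ⟨ linear a ⟩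

      wrong-degree : ∀ {d f} → ¬ (d ≡ 1) → HasDegree d f → ¬ (f ≈ Π)
      wrong-degree d≢1 h e = d≢1 (HasDegree-unique e h (IsMonic⇒HasDegree (isMonic (linear a))))

      one-degree : HasDegree 0 1ᴬ
      one-degree = IsMonic⇒HasDegree (monicPoly-isMonic [])

      linear-degree : ∀ v → HasDegree 1 (v ∷ 1ᴬ)
      linear-degree v = IsMonic⇒HasDegree (isMonic (linear v))

      module _ (r s : ℙ¹) where

        one-one : heckeTerm 𝔭 r s (one≤ , one≤) ≈ˢ ε
        one-one = heckeTerm-no 𝔭 r s (one≤ , one≤) (λ (e , _) → wrong-degree (λ ()) (*-HasDegree one-degree one-degree) e)

        linear-linear : ∀ v w → heckeTerm 𝔭 r s (linear≤ v , linear≤ w) ≈ˢ ε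
        linear-linear v w = heckeTerm-no 𝔭 r s (linear≤ v , linear≤ w)
          (λ (e , _) → wrong-degree (λ ()) (*-HasDegree (linear-degree v) (linear-degree w)) e)

        one-linear : ∀ v → v F.≈ a → heckeTerm 𝔭 r s (one≤ , linear≤ v) ≈ˢ ∑ F.elements (λ b → image (triangular (const b)) r s)
        one-linear v v≈a = begin
          heckeTerm 𝔭 r s (one≤ , linear≤ v)
            ≈⟨ heckeTerm-yes 𝔭 r s (one≤ , linear≤ v) (A.trans (A.*-identityˡ (v ∷ 1ᴬ)) (linear-cong v≈a) , comaximal-sym (unit-comaximal A.refl)) ⟩
          ∑ (map h (polysBelow 1)) (λ g → image g r s)
            ≈⟨ ∑-map h (polysBelow 1) (λ g → image g r s) ⟩
          ∑ (map Vec.toList (tuples 1)) (λ b → image (h b) r s)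
            ≈⟨ ∑-map Vec.toList (tuples 1) (λ b → image (h b) r s) ⟩
          ∑ (tuples 1) (λ b → image (h (Vec.toList b)) r s)
            ≈⟨ ∑-tuples₁ 𝔾 (λ b → image (h (Vec.toList b)) r s) ⟩
          ∑ F.elements (λ b → image (h (const b)) r s)
            ≈⟨ ∑-cong F.elements (λ b →
                 image-cong (upperTriangular-invertible (const b) 1≉0 (monic≉0 (linear v))) (upperTriangular-invertible (const b) 1≉0 Π≉0) r s
                   (mat-≈ A.refl A.refl A.refl (linear-cong v≈a))) ⟩
          ∑ F.elements (λ b → image (triangular (const b)) r s) ∎
          where
          open SetoidReasoning G.setoid
          h : Poly → GL₂K.GL₂
          h = heckeMatrix (proj₂ (one≤ {1})) (linear v)

        one-linear′ : ∀ v → ¬ (v F.≈ a) → heckeTerm 𝔭 r s (one≤ , linear≤ v) ≈ˢ ε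
        one-linear′ v v≉a = heckeTerm-no 𝔭 r s (one≤ , linear≤ v) (λ (e , _) → v≉a (linear-injective (A.trans (A.sym (A.*-identityˡ (v ∷ 1ᴬ))) e)))

        linear-one : ∀ v → v F.≈ a → heckeTerm 𝔭 r s (linear≤ v , one≤) ≈ˢ image diagonal r s
        linear-one v v≈a = begin
          heckeTerm 𝔭 r s (linear≤ v , one≤)
            ≈⟨ heckeTerm-yes 𝔭 r s (linear≤ v , one≤) (A.trans (A.*-identityʳ (v ∷ 1ᴬ)) (linear-cong v≈a) ,
                 -- S_P admits the diagonal matrix only if P is coprime to 𝔫.
                 comaximal-respˡ (linear-cong (F.sym v≈a)) (monic1∤⇒comaximal (linear a) P∤𝔫)) ⟩
          image h r s ∙ ε         ≈⟨ G.identityʳ _ ⟩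
          image h r s             ≈⟨ image-cong (upperTriangular-invertible 0ᴬ (monic≉0 (linear v)) 1≉0) (upperTriangular-invertible 0ᴬ Π≉0 1≉0) r s
                                       (mat-≈ (linear-cong v≈a) A.refl A.refl A.refl) ⟩
          image diagonal r s      ∎
          where
          open SetoidReasoning G.setoid
          h : GL₂K.GL₂
          h = heckeMatrix (linear v) (proj₂ (one≤ {1})) []

        linear-one′ : ∀ v → ¬ (v F.≈ a) → heckeTerm 𝔭 r s (linear≤ v , one≤) ≈ˢ ε
        linear-one′ v v≉a = heckeTerm-no 𝔭 r s (linear≤ v , one≤) (λ (e , _) → v≉a (linear-injective (A.trans (A.sym (A.*-identityʳ (v ∷ 1ᴬ))) e)))

    class-T-linear : ∀ r s → class (T ⟨ linear a ⟩ (r ⟶ s)) ≈ˢ H r s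
    class-T-linear r s = G.trans (class-T (linear a) r s) (∑∑-linear 𝔾 a (λ d d′ → heckeTerm ⟨ linear a ⟩ r s (d , d′))
      (image diagonal r s) (∑ F.elements (λ b → image (triangular (const b)) r s))
      (one-one r s) (linear-linear r s) (linear-one r s) (linear-one′ r s) (one-linear r s) (one-linear′ r s))

  class-∑T : (P∤𝔫 : ∀ (P : Monic 1) → ¬ (poly P ∣ gen 𝔫)) → ∀ r s {D} → D ≡ (r ⟶ s) →
             class (AbelianGroups.∑ 𝕄/p (ideals≤ 1) (λ 𝔭 → T 𝔭 D)) ≈ˢ (r ⇒ s) ∙ ∑ F.elements (λ a → Linear.H a (P∤𝔫 (linear a)) r s)
  class-∑T P∤𝔫 r s ≡.refl = begin
    class (AbelianGroups.∑ 𝕄/p (ideals≤ 1) (λ 𝔭 → T 𝔭 (r ⟶ s)))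
      ≈⟨ class-∑ (ideals≤ 1) (λ 𝔭 → T 𝔭 (r ⟶ s)) ⟩
    ∑ (ideals≤ 1) (λ 𝔭 → class (T 𝔭 (r ⟶ s)))
      ≈⟨ ∑-map (λ f → ⟨ proj₂ f ⟩) (monics≤ 1) (λ 𝔭 → class (T 𝔭 (r ⟶ s))) ⟩
    ∑ (monics≤ 1) (λ f → class (T ⟨ proj₂ f ⟩ (r ⟶ s)))
      ≈⟨ ∑-monics≤₁ 𝔾 (λ f → class (T ⟨ proj₂ f ⟩ (r ⟶ s))) ⟩
    class (T ⟨ proj₂ (one≤ {0}) ⟩ (r ⟶ s)) ∙ ∑ F.elements (λ a → class (T ⟨ linear a ⟩ (r ⟶ s)))
      ≈⟨ G.∙-cong (class-T-unit r s) (∑-cong F.elements (λ a → class-T-linear a (P∤𝔫 (linear a)) r s)) ⟩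
    (r ⇒ s) ∙ ∑ F.elements (λ a → Linear.H a (P∤𝔫 (linear a)) r s) ∎
    where open SetoidReasoning G.setoid

  class-x : ∀ y → class (x y) ≈ˢ Ξ y
  class-x y = G.trans (class-⟶ (ιᴳ (proj₁ (representative y)) · 𝟎) (ιᴳ (proj₁ (representative y)) · ∞)) (G.sym (Ξ-unfold y))

  class-∑x : ∀ u → class (AbelianGroups.∑ 𝕄/p (monics 1) (λ P → AbelianGroups.∑ 𝕄/p (admissible u P) (λ v → x ([Pu∶v] v)))) ≈ˢ
                   ∑ F.elements (λ a → ∑ (admissible u (linear a)) (Ξᴬ u (linear a)))
  class-∑x u = G.trans (class-∑ (monics 1) (λ P → AbelianGroups.∑ 𝕄/p (admissible u P) (λ v → x ([Pu∶v] v))))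
    (G.trans (∑-cong (monics 1) (λ P → G.trans (class-∑ (admissible u P) (λ v → x ([Pu∶v] v)))
      (∑-cong (admissible u P) (λ v → G.trans (class-x ([Pu∶v] v)) (G.sym (Ξᴬ-unfold u P v))))))
    (∑-monics₁ 𝔾 (λ P → ∑ (admissible u P) (Ξᴬ u P))))

  module _ (P∤𝔫 : ∀ (P : Monic 1) → ¬ (poly P ∣ gen 𝔫)) where

    linear-modularSymbol-cuspidal : ∀ (u : Monic 1) → IsCuspidal (x [ poly u ∶1])
    linear-modularSymbol-cuspidal u = x[u∶1]-cuspidal (poly u) (monic1∤⇒comaximal u (P∤𝔫 u)) (monic≉0 u)

    -- Writing q as a multiple of p is what makes constant sums over the field vanish in the
    -- quotient modulo p.
    ∑T-x[u∶1] : ∀ n → q ≡ p ℕ.* n → ∀ (u : Monic 1) →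
      AbelianGroups.∑ 𝕄/p (ideals≤ 1) (λ 𝔭 → T 𝔭 (x [ poly u ∶1])) M.≈
      AbelianGroups.∑ 𝕄/p (monics 1) (λ P → AbelianGroups.∑ 𝕄/p (admissible u P) (λ v → x ([Pu∶v] v)))
    ∑T-x[u∶1] n q≡pn u = class-injective (begin
      class (AbelianGroups.∑ 𝕄/p (ideals≤ 1) (λ 𝔭 → T 𝔭 (x y)))
        ≈⟨ class-∑T P∤𝔫 (ιᴳ (proj₁ (representative y)) · 𝟎) (ιᴳ (proj₁ (representative y)) · ∞) ≡.refl ⟩
      ((ιᴳ (proj₁ (representative y)) · 𝟎) ⇒ (ιᴳ (proj₁ (representative y)) · ∞)) ∙
        ∑ F.elements (λ a → Linear.H a (P∤𝔫 (linear a)) (ιᴳ (proj₁ (representative y)) · 𝟎) (ιᴳ (proj₁ (representative y)) · ∞))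
        ≈⟨ G.∙-congʳ (G.trans (Ξ₁-unfold (poly u)) (Ξ-unfold y)) ⟨
      Ξ₁ (poly u) ∙
        ∑ F.elements (λ a → Linear.H a (P∤𝔫 (linear a)) (ιᴳ (proj₁ (representative y)) · 𝟎) (ιᴳ (proj₁ (representative y)) · ∞))
        ≈⟨ MainIdentity.mainIdentity P∤𝔫 constants-vanish u (representative-factorisation y A.refl) ⟩
      ∑ F.elements (λ a → ∑ (admissible u (linear a)) (Ξᴬ u (linear a)))
        ≈⟨ class-∑x u ⟨
      class (AbelianGroups.∑ 𝕄/p (monics 1) (λ P → AbelianGroups.∑ 𝕄/p (admissible u P) (λ v → x ([Pu∶v] v)))) ∎)
      where
      open SetoidReasoning G.setoid
      y : ℙ¹A/𝔫
      y = [ poly u ∶1]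
      constants-vanish : ∀ z → ∑ F.elements (λ _ → z) ≈ˢ ε
      constants-vanish z = G.trans (∑-elements-const z)
        (G.trans (G.reflexive (≡.cong (λ m → MonoidMult._×_ G.monoid m z) q≡pn)) (multiple-of-p≈ε n z))

-- Cuspidality and the Hecke identity.

proposition6p1 : ∀ {c ℓ} (p k : ℕ) → Prime p → 1 ≤ k →
    (F : FiniteField c ℓ (p ^ k)) →
    let open Ideals F in
    (𝔫 : Ideal) →
    (∀ 𝔮 → IsPrimeIdeal 𝔮 → degree 𝔮 ≡ 1 → ¬ (𝔮 ∣ᴵ 𝔫)) →
    (u : Monic 1) →
    let open ModularSymbols F 𝔫 p
        open AbelianGroup 𝕄/p using (_≈_)
    in
    IsCuspidal (x [ poly u ∶1])
    × (∑[ 𝔭 ∈ ideals≤ 1 ] T 𝔭 (x [ poly u ∶1]) in[ 𝕄/p ])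
      ≈ (∑[ P ∈ monics 1 ] (∑[ v ∈ admissible u P ] x ([Pu∶v] v) in[ 𝕄/p ]) in[ 𝕄/p ])
-- The exponent is positive, and p ^ suc k unfolds to p * p ^ k, which exhibits q as a multiple of
-- p.
proposition6p1 p (suc k) _ _ F 𝔫 no-linear-factor u = linear-modularSymbol-cuspidal P∤𝔫 u , ∑T-x[u∶1] P∤𝔫 (p ^ k) ≡.refl u
  where
  open Hecke F 𝔫 p
  open Polynomials F using (_∣_; _,_)
  open Ideals F
  P∤𝔫 : ∀ (P : Monic 1) → ¬ (poly P ∣ gen 𝔫)
  -- Divisibility of ideals is reverse inclusion, so a linear divisor of the generator of 𝔫 would be
  -- a prime ideal of degree 1 containing 𝔫.
  P∤𝔫 P P∣𝔫 = no-linear-factor ⟨ P ⟩ (LinearPolynomials.monic1-prime F P) ≡.refl (λ 𝔫∣f → ∣-trans P∣𝔫 𝔫∣f)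
    where open SemiringDivisibility (CommutativeRing.semiring (Polynomials.polynomialRing F)) using (∣-trans)
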